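{- Let $n\ge 2$, $t\ge 3$, $\Lambda=PG(2n-1,q^t)$, $\Sigma^*=PG(tn-1,q^t)$ containing $\Lambda$, and $\Sigma=\mathrm{Fix}(\Psi)\cong PG(tn-1,q)$ where $\Psi$ is a semilinear collineation of $\Sigma^*$ of order $t$. Let $L$ be a scattered $\mathbb{F}_q$-linear set of $\Lambda$ of pseudoregulus type with associated pseudoregulus $\mathcal P$, and suppose $L=p_{\Gamma,\Lambda}(\Sigma)$ for an $(n(t-2)-1)$-dimensional subspace $\Gamma$ of $\Sigma^*$ disjoint from $\Sigma$ and from $\Lambda$. Then: (i) the set $\mathcal D_L=\{\langle\Gamma,s\rangle_{q^t}\cap\Sigma: s\in\mathcal P\}$ is a Desarguesian $(t-1)$-spread of $\Sigma$; (ii) there exist a director space $\bar\Theta$ of $\mathcal D_L$ and an integer $m$ with $\gcd(m,t)=1$ such that, with $\tau=\Psi^m$, $$\Gamma=\langle\bar\Theta,\bar\Theta^{\tau},\dots,\bar\Theta^{\tau^{t-3}}\rangle_{q^t}.$$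
   Context: Projection: $p_{\Gamma,\Lambda}(\Sigma)=\{\langle\Gamma,P\rangle_{q^t}\cap\Lambda:P\in\Sigma\}$. Desarguesian spreads: if $\Theta$ is an $(n-1)$-dimensional subspace of $\Sigma^*$ such that $\Theta,\Theta^\Psi,\dots,\Theta^{\Psi^{t-1}}$ span $\Sigma^*$, then $\mathcal D(\Theta)=\{\langle P,P^\Psi,\dots,P^{\Psi^{t-1}}\rangle_{q^t}\cap\Sigma:P\in\Theta\}$ is a $(t-1)$-spread of $\Sigma$ (partition of its points into $(t-1)$-dimensional subspaces) called Desarguesian, and $\Theta^{\Psi^i}$, $i=0,\dots,t-1$, are its director spaces. For an $\mathbb{F}_q$-subspace $U$ of the underlying $\mathbb{F}_{q^t}$-space, $L_U=\{\langle\mathbf u\rangle_{q^t}:\mathbf u\in U\setminus\{\mathbf 0\}\}$ has rank $\dim_{\mathbb F_q}U$, the weight of $PG(W,\mathbb{F}_{q^t})$ in $L_U$ is $\dim_{\mathbb F_q}(W\cap U)$, and $L_U$ is scattered if all points have weight 1. Pseudoregulus type: for $t,n\ge 2$, a scattered $\mathbb{F}_q$-linear set $L$ of $PG(2n-1,q^t)$ of rank $tn$ such that (i) there exist $(q^{nt}-1)/(q^t-1)$ pairwise disjoint lines each of weight $t$ in $L$, and (ii) there exist exactly two $(n-1)$-dimensional subspaces $T_1,T_2$ disjoint from $L$ meeting each of these lines; the set of these lines is the pseudoregulus associated with $L$. -}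

module Defs where

open import Algebra.Apartness.Bundles using (HeytingCommutativeRing; HeytingField)
open import Algebra.Bundles using (CommutativeRing)
open import Algebra.Module.Bundles using (Module)
open import Algebra.Morphism.Structures using (module GroupMorphisms; module RingMorphisms)
open import Algebra.Properties.CommutativeMonoid.Sum using (sum)
open import Data.Fin.Base using (Fin; toℕ)
open import Data.Integer.Base using (ℤ; +_; -[1+_])
open import Data.Nat.Base as ℕ using (ℕ)
open import Data.Nat.GeneralisedArithmetic using (fold)
open import Data.Product.Base using (∃; ∃₂; ∃-syntax; _×_; _,_)
open import Data.Sum.Base using (_⊎_)
open import Data.Unit.Polymorphic.Base using (⊤)
open import Function.Bundles using (Inverse)
open import Level using (Level) renaming (suc to lsuc)
open import Relation.Binary.PropositionalEquality using (_≡_; _≢_)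
import Relation.Binary.PropositionalEquality as ≡
open import Relation.Nullary using (¬_)
open import Relation.Unary using (Pred; _∈_; _⊆_; _≐_; _∩_; _∪_; ⋃; _≬_; _⊥_)
open import Relation.Binary.Definitions using (_Respects_)

private
  variable
    ℓ ℓ₁ ℓ₂ ℓ₃ : Level

-- The fields of the statement are finite, so their equality is decidable and
-- the apartness relation of a Heyting field is just inequality.

ring : HeytingField ℓ ℓ ℓ → CommutativeRing ℓ ℓ
ring F = HeytingCommutativeRing.commutativeRing (HeytingField.heytingCommutativeRing F)

HasOrder : HeytingField ℓ ℓ ℓ → ℕ → Set ℓ
HasOrder F q = Inverse (CommutativeRing.setoid (ring F)) (≡.setoid (Fin q))

IsSubfield : (K F : HeytingField ℓ ℓ ℓ) →
             (HeytingField.Carrier K → HeytingField.Carrier F) → Set ℓ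
IsSubfield K F = RingMorphisms.IsRingMonomorphism
  (CommutativeRing.rawRing (ring K)) (CommutativeRing.rawRing (ring F))

module Linear {R : CommutativeRing ℓ ℓ} (M : Module R ℓ ℓ) where
  open CommutativeRing R using (Carrier; _≈_; 0#)
  open Module M

  record Subspace : Set (lsuc ℓ) where
    field
      El     : Pred Carrierᴹ ℓ
      ≈-resp : El Respects _≈ᴹ_
      0∈     : 0ᴹ ∈ El
      +∈     : ∀ {u v} → u ∈ El → v ∈ El → (u +ᴹ v) ∈ El
      *∈     : ∀ a {v} → v ∈ El → (a *ₗ v) ∈ El

  open Subspace public using (El)

  infix 4 _⊑_ _≋_
  infixr 7 _⊓_
  infixr 6 _⊔_

  _⊑_ : Subspace → Subspace → Set ℓ
  X ⊑ Y = El X ⊆ El Y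

  _≋_ : Subspace → Subspace → Set ℓ
  X ≋ Y = El X ≐ El Y

  data Span (S : Pred Carrierᴹ ℓ) : Pred Carrierᴹ ℓ where
    gen    : ∀ {v} → v ∈ S → Span S v
    ≈-resp : Span S Respects _≈ᴹ_
    0∈     : Span S 0ᴹ
    +∈     : ∀ {u v} → Span S u → Span S v → Span S (u +ᴹ v)
    *∈     : ∀ a {v} → Span S v → Span S (a *ₗ v)

  ⟨_⟩ : Pred Carrierᴹ ℓ → Subspace
  ⟨ S ⟩ = record { El = Span S ; ≈-resp = ≈-resp ; 0∈ = 0∈ ; +∈ = +∈ ; *∈ = *∈ }

  ⟨⟩-family : ∀ {k} → (Fin k → Carrierᴹ) → Subspace
  ⟨⟩-family b = ⟨ (λ v → ∃[ i ] v ≈ᴹ b i) ⟩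

  _⊔_ : Subspace → Subspace → Subspace
  X ⊔ Y = ⟨ El X ∪ El Y ⟩

  join : ∀ {k} → (Fin k → Subspace) → Subspace
  join {k} X = ⟨ ⋃ (Fin k) (λ i → El (X i)) ⟩

  _⊓_ : Subspace → Subspace → Subspace
  X ⊓ Y = record
    { El     = El X ∩ El Y
    ; ≈-resp = λ { e (x , y) → X.≈-resp e x , Y.≈-resp e y }
    ; 0∈     = X.0∈ , Y.0∈
    ; +∈     = λ { (x , y) (x′ , y′) → X.+∈ x x′ , Y.+∈ y y′ }
    ; *∈     = λ { a (x , y) → X.*∈ a x , Y.*∈ a y }
    }
    where
    module X = Subspace X
    module Y = Subspace Y

  whole : Subspace
  whole = record
    { El = λ _ → ⊤ ; ≈-resp = λ _ _ → _ ; 0∈ = _ ; +∈ = λ _ _ → _ ; *∈ = λ _ _ → _ }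

  LinearlyIndependent : ∀ {k} → (Fin k → Carrierᴹ) → Set ℓ
  LinearlyIndependent {k} b =
    ∀ (a : Fin k → Carrier) → sum +ᴹ-commutativeMonoid (λ i → a i *ₗ b i) ≈ᴹ 0ᴹ → ∀ i → a i ≈ 0#

  IsBasis : ∀ {k} → Subspace → (Fin k → Carrierᴹ) → Set ℓ
  IsBasis X b = LinearlyIndependent b × X ≋ ⟨⟩-family b

  -- Vector space dimension; the projective dimension of PG(X) is one less.
  HasDim : Subspace → ℕ → Set ℓ
  HasDim X k = ∃ λ (b : Fin k → Carrierᴹ) → IsBasis X b

  IsPoint IsLine : Subspace → Set ℓ
  IsPoint X = HasDim X 1
  IsLine  X = HasDim X 2

  -- The projective space on X, as the set of its points.
  PG : Subspace → Pred Subspace ℓ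
  PG X P = IsPoint P × P ⊑ X

module _ (K F : HeytingField ℓ ℓ ℓ) {ι : HeytingField.Carrier K → HeytingField.Carrier F}
         (ι-mono : IsSubfield K F ι) (V : Module (ring F) ℓ ℓ) where
  private
    module ι = RingMorphisms.IsRingMonomorphism ι-mono
    module F = CommutativeRing (ring F)
  open Module V

  restrictScalars : Module (ring K) ℓ ℓ
  restrictScalars = record
    { Carrierᴹ = Carrierᴹ
    ; _≈ᴹ_     = _≈ᴹ_
    ; _+ᴹ_     = _+ᴹ_
    ; _*ₗ_     = λ a v → ι a *ₗ v
    ; _*ᵣ_     = λ v a → v *ᵣ ι a
    ; 0ᴹ       = 0ᴹ
    ; -ᴹ_      = -ᴹ_
    ; isModule = record
      { isBimodule = record
        { isBisemimodule = record
          { +ᴹ-isCommutativeMonoid = +ᴹ-isCommutativeMonoid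
          ; isPreleftSemimodule = record
            { *ₗ-cong      = λ a≈b → *ₗ-cong (ι.⟦⟧-cong a≈b)
            ; *ₗ-zeroˡ     = λ v → ≈ᴹ-trans (*ₗ-congʳ ι.0#-homo) (*ₗ-zeroˡ v)
            ; *ₗ-distribʳ  = λ v a b → ≈ᴹ-trans (*ₗ-congʳ (ι.+-homo a b)) (*ₗ-distribʳ v _ _)
            ; *ₗ-identityˡ = λ v → ≈ᴹ-trans (*ₗ-congʳ ι.1#-homo) (*ₗ-identityˡ v)
            ; *ₗ-assoc     = λ a b v → ≈ᴹ-trans (*ₗ-congʳ (ι.*-homo a b)) (*ₗ-assoc _ _ v)
            ; *ₗ-zeroʳ     = λ a → *ₗ-zeroʳ (ι a)
            ; *ₗ-distribˡ  = λ a → *ₗ-distribˡ (ι a)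
            }
          ; isPrerightSemimodule = record
            { *ᵣ-cong      = λ u≈v a≈b → *ᵣ-cong u≈v (ι.⟦⟧-cong a≈b)
            ; *ᵣ-zeroʳ     = λ v → ≈ᴹ-trans (*ᵣ-congˡ ι.0#-homo) (*ᵣ-zeroʳ v)
            ; *ᵣ-distribˡ  = λ v a b → ≈ᴹ-trans (*ᵣ-congˡ (ι.+-homo a b)) (*ᵣ-distribˡ v _ _)
            ; *ᵣ-identityʳ = λ v → ≈ᴹ-trans (*ᵣ-congˡ ι.1#-homo) (*ᵣ-identityʳ v)
            ; *ᵣ-assoc     = λ v a b → ≈ᴹ-trans (*ᵣ-assoc v _ _) (*ᵣ-congˡ (F.sym (ι.*-homo a b)))
            ; *ᵣ-zeroˡ     = λ a → *ᵣ-zeroˡ (ι a)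
            ; *ᵣ-distribʳ  = λ a → *ᵣ-distribʳ (ι a)
            }
          ; *ₗ-*ᵣ-assoc = λ a v b → *ₗ-*ᵣ-assoc (ι a) v (ι b)
          }
        ; -ᴹ‿cong    = -ᴹ‿cong
        ; -ᴹ‿inverse = -ᴹ‿inverse
        }
      ; *ₗ-*ᵣ-coincident = λ a v → *ₗ-*ᵣ-coincident (ι a) v
      }
    }

-- K plays the role of 𝔽_q, F that of 𝔽_{q^t}, and Σ* is PG(V). A point is a
-- one-dimensional F-subspace of V, and a set of points is a predicate on
-- F-subspaces.
module Geometry (K F : HeytingField ℓ ℓ ℓ) {ι : HeytingField.Carrier K → HeytingField.Carrier F}
                (ι-mono : IsSubfield K F ι) (V : Module (ring F) ℓ ℓ) where
  private
    module F = CommutativeRing (ring F)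
  open Module V
  open Linear V public
  module 𝔽q = Linear (restrictScalars K F ι-mono V)

  asK : Subspace → 𝔽q.Subspace
  asK X = record
    { El = El X ; ≈-resp = X.≈-resp ; 0∈ = X.0∈ ; +∈ = X.+∈ ; *∈ = λ a → X.*∈ (ι a) }
    where module X = Subspace X

  L[_] : 𝔽q.Subspace → Pred Subspace ℓ
  L[ U ] P = ∃[ u ] u ∈ 𝔽q.El U × ¬ (u ≈ᴹ 0ᴹ) × P ≋ ⟨ u ≈ᴹ_ ⟩

  HasWeight : 𝔽q.Subspace → Subspace → ℕ → Set ℓ
  HasWeight U X w = 𝔽q.HasDim (asK X 𝔽q.⊓ U) w

  IsScattered : 𝔽q.Subspace → Set (lsuc ℓ)
  IsScattered U = ∀ P → P ∈ L[ U ] → HasWeight U P 1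

  IsTransversal : ∀ {N} → ℕ → Subspace → 𝔽q.Subspace → (Fin N → Subspace) → Subspace → Set (lsuc ℓ)
  IsTransversal n Λ U s T =
    T ⊑ Λ × HasDim T n × PG T ⊥ L[ U ] × (∀ i → PG T ≬ PG (s i))

  -- L[ U ] is a linear set of pseudoregulus type of Λ = PG(2n-1,q^t), and
  -- { s i } its associated pseudoregulus. The number N of lines is
  -- (q^{nt} - 1) / (q^t - 1).
  record IsPseudoregulus (q n t : ℕ) (Λ : Subspace) (U : 𝔽q.Subspace)
                         {N : ℕ} (s : Fin N → Subspace) : Set (lsuc ℓ) where
    field
      U⊆Λ          : 𝔽q.El U ⊆ El Λ
      rank         : 𝔽q.HasDim U (t ℕ.* n)
      scattered    : IsScattered U
      count        : N ℕ.* (q ℕ.^ t ℕ.∸ 1) ≡ q ℕ.^ (n ℕ.* t) ℕ.∸ 1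
      lines        : ∀ i → IsLine (s i) × s i ⊑ Λ
      weight       : ∀ i → HasWeight U (s i) t
      disjoint     : ∀ {i j} → i ≢ j → PG (s i) ⊥ PG (s j)
      transversals : ∃₂ λ T₁ T₂ →
        IsTransversal n Λ U s T₁ × IsTransversal n Λ U s T₂ × ¬ (T₁ ≋ T₂) ×
        (∀ T → IsTransversal n Λ U s T → T ≋ T₁ ⊎ T ≋ T₂)

  -- p_{Γ,Λ}(Σ)
  projection : Subspace → Subspace → Pred Subspace ℓ₁ → Pred Subspace _
  projection Γ Λ Σ X = ∃[ P ] P ∈ Σ × X ≋ (Γ ⊔ P) ⊓ Λ

  record Collineation : Set ℓ where
    field
      to         : Carrierᴹ → Carrierᴹ
      σ          : F.Carrier → F.Carrier
      to-iso     : GroupMorphisms.IsGroupIsomorphism +ᴹ-rawGroup +ᴹ-rawGroup to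
      σ-iso      : RingMorphisms.IsRingIsomorphism F.rawRing F.rawRing σ
      semilinear : ∀ a v → to (a *ₗ v) ≈ᴹ σ a *ₗ to v

  image : Collineation → Subspace → Subspace
  image Ψ X = record
    { El     = λ w → ∃[ v ] v ∈ El X × to v ≈ᴹ w
    ; ≈-resp = λ { e (v , v∈ , p) → v , v∈ , ≈ᴹ-trans p e }
    ; 0∈     = 0ᴹ , X.0∈ , to.ε-homo
    ; +∈     = λ { (v , v∈ , p) (v′ , v′∈ , p′) →
                   v +ᴹ v′ , X.+∈ v∈ v′∈ , ≈ᴹ-trans (to.∙-homo v v′) (+ᴹ-cong p p′) }
    ; *∈     = λ { a (v , v∈ , p) → let (b , b↦a) = σ.surjective a in
                   b *ₗ v , X.*∈ b v∈ ,
                   ≈ᴹ-trans (semilinear b v) (*ₗ-cong (b↦a F.refl) p) }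
    }
    where
    open Collineation Ψ
    module X = Subspace X
    module to = GroupMorphisms.IsGroupIsomorphism to-iso
    module σ = RingMorphisms.IsRingIsomorphism σ-iso

  preimage : Collineation → Subspace → Subspace
  preimage Ψ X = record
    { El     = λ v → to v ∈ El X
    ; ≈-resp = λ e → X.≈-resp (to.⟦⟧-cong e)
    ; 0∈     = X.≈-resp (≈ᴹ-sym to.ε-homo) X.0∈
    ; +∈     = λ {u} {v} p p′ → X.≈-resp (≈ᴹ-sym (to.∙-homo u v)) (X.+∈ p p′)
    ; *∈     = λ a {v} p → X.≈-resp (≈ᴹ-sym (semilinear a v)) (X.*∈ (σ a) p)
    }
    where
    open Collineation Ψ
    module X = Subspace X
    module to = GroupMorphisms.IsGroupIsomorphism to-iso

  infixl 8 _^[_]_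

  -- X ^[ Ψ ] m is the subspace X^{Ψ^m}.
  _^[_]_ : Subspace → Collineation → ℤ → Subspace
  X ^[ Ψ ] (+ m)    = fold X (image Ψ) m
  X ^[ Ψ ] -[1+ m ] = fold X (preimage Ψ) (ℕ.suc m)

  FixesPoints : Collineation → ℕ → Set (lsuc ℓ)
  FixesPoints Ψ i = ∀ P → IsPoint P → P ^[ Ψ ] (+ i) ≋ P

  -- The order of Ψ as a collineation of PG(V), not as a map of vectors.
  HasCollineationOrder : Collineation → ℕ → Set (lsuc ℓ)
  HasCollineationOrder Ψ t =
    FixesPoints Ψ t × (∀ i → 0 ℕ.< i → i ℕ.< t → ¬ FixesPoints Ψ i)

  Fix : Collineation → Pred Subspace ℓ
  Fix Ψ P = IsPoint P × image Ψ P ≋ P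

  -- Σ is a subgeometry PG(k-1,q) of PG(V) = PG(k-1,q^t): its points are those
  -- with a nonzero coordinate vector over 𝔽_q in some F-basis of V. U₀ is the
  -- underlying 𝔽_q-space.
  IsSubgeometry : ℕ → 𝔽q.Subspace → Pred Subspace ℓ → Set (lsuc ℓ)
  IsSubgeometry k U₀ Σ =
    (∃ λ (e : Fin k → Carrierᴹ) → IsBasis whole e × U₀ 𝔽q.≋ 𝔽q.⟨⟩-family e) × Σ ≐ L[ U₀ ]

  -- X is the point set of a (k-1)-dimensional subspace of Σ = L[ U₀ ].
  IsSubspaceOfΣ : 𝔽q.Subspace → ℕ → Pred Subspace ℓ → Set (lsuc ℓ)
  IsSubspaceOfΣ U₀ k X = ∃[ A ] A 𝔽q.⊑ U₀ × 𝔽q.HasDim A k × X ≐ L[ A ]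

  -- D is a (k-1)-spread of Σ = L[ U₀ ].
  IsSpread : 𝔽q.Subspace → ℕ → Pred (Pred Subspace ℓ) (lsuc ℓ) → Set (lsuc ℓ)
  IsSpread U₀ k D =
    (∀ X → X ∈ D → IsSubspaceOfΣ U₀ k X) ×
    (∀ X Y → X ∈ D → Y ∈ D → X ≬ Y → X ≐ Y) ×
    (∀ P → P ∈ L[ U₀ ] → ∃[ X ] X ∈ D × P ∈ X)

  -- ⟨X, X^τ, …, X^{τ^{k-1}}⟩
  conjugateSpan : ℕ → (Subspace → Subspace) → Subspace → Subspace
  conjugateSpan k τ X = join {k} (λ i → fold X τ (toℕ i))

  module Desarguesian (n t : ℕ) (Ψ : Collineation) (U₀ : 𝔽q.Subspace) where

    Spanning : Subspace → Set ℓ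
    Spanning Θ = HasDim Θ n × whole ⊑ conjugateSpan t (image Ψ) Θ

    𝒟 : Subspace → Pred (Pred Subspace ℓ) (lsuc ℓ)
    𝒟 Θ X = ∃[ P ] P ∈ PG Θ × X ≐ PG (conjugateSpan t (image Ψ) P) ∩ Fix Ψ

    IsDesarguesianSpread : Pred (Pred Subspace ℓ) (lsuc ℓ) → Set (lsuc ℓ)
    IsDesarguesianSpread D = IsSpread U₀ t D × (∃[ Θ ] Spanning Θ × D ≐ 𝒟 Θ)

    IsDirectorSpace : Pred (Pred Subspace ℓ) (lsuc ℓ) → Subspace → Set (lsuc ℓ)
    IsDirectorSpace D Θ̄ = ∃[ Θ ] Spanning Θ × D ≐ 𝒟 Θ ×
      (∃[ i ] i ℕ.< t × Θ̄ ≋ Θ ^[ Ψ ] (+ i))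

  -- The set of all ⟨Γ, s i⟩ ∩ Σ.
  𝒟ᴸ : ∀ {N} → Subspace → (Fin N → Subspace) → Pred Subspace ℓ → Pred (Pred Subspace ℓ) (lsuc ℓ)
  𝒟ᴸ Γ s Σ X = ∃[ i ] X ≐ PG (Γ ⊔ s i) ∩ Σ

{-# OPTIONS --safe #-}

-- Let A₁ and A₂ be the joins of Γ with the two transversals, and φ the multiple of Ψ that fixes the 𝔽_q-space U₀ of Σ
-- pointwise. As the fields are finite, dimension arguments are counts. One such count shows that U₀ is a complement of
-- A₁ and of A₂ in V, and so carries two scalar multiplications by 𝔽_{q^t}; this uses only the points of L, as U₀ need
-- not project onto U. The spaces ⟨Γ, s i⟩ cut out the one-dimensional subspaces of U₀ for both multiplications, which
-- hence differ by a map of scalars. On the other hand V is the direct sum of the conjugates of Θ = ⋂_{0<j<t} φ^{-j} A₂.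
-- Comparing traces of vectors of Θ, Dedekind's lemma shows that the map of scalars is a power σ^m and that φ^j Θ lies
-- in A₁ for j ≢ m; scatteredness of L gives gcd (m , t) = 1. Therefore Γ = A₁ ∩ A₂ is the sum of the φ^j Θ with
-- j ≢ 0, m, and ⟨Γ, s i⟩ meets Σ in the spread element of a point of Θ.

module Submission where

open import Defs
open import Algebra.Apartness.Bundles using (HeytingField)
open import Algebra.Bundles using (CommutativeMonoid; CommutativeRing)
open import Algebra.Module.Bundles using (Module)
open import Algebra.Morphism.Structures using (module GroupMorphisms; module RingMorphisms)
import Algebra.Properties.AbelianGroup as AbelianGroupProperties
import Algebra.Properties.CommutativeMonoid.Sum as Sum
import Algebra.Properties.CommutativeSemigroup as CommutativeSemigroupProperties
import Algebra.Properties.Group as GroupProperties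
import Algebra.Properties.Ring as RingProperties
open import Data.Empty using (⊥-elim)
open import Data.Fin.Base using (Fin; zero; suc; toℕ; fromℕ<; combine; remQuot; finToFun; funToFin; punchIn; punchOut)
import Data.Fin.Properties as Finₚ
open import Data.Integer.Base using (+_)
open import Data.Integer.GCD using (gcd)
open import Data.Nat.Base as ℕ using (ℕ; zero; suc; _≤_; _<_; s≤s; z≤n)
open import Data.Nat.Coprimality as Coprimality using (coprime-divisor; gcd≡1⇒coprime)
open import Data.Nat.DivMod using (_%_; _/_; m≡m%n+[m/n]*n; m%n<n; m<n⇒m%n≡m)
open import Data.Nat.Divisibility using (_∣_; divides; m%n≡0⇒n∣m; >⇒∤; ∣m+n∣m⇒∣n; ∣-refl)
import Data.Nat.GCD as GCD
open import Data.Nat.GeneralisedArithmetic using (fold)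
import Data.Nat.Properties as ℕₚ
open import Data.Nat.Solver using (module +-*-Solver)
open import Data.Product.Base using (∃₂; ∃-syntax; _×_; _,_; proj₁; proj₂; uncurry)
open import Data.Sum.Base using (_⊎_; inj₁; inj₂)
open import Data.Unit.Polymorphic.Base using (⊤; tt)
open import Function.Base using (_∘_)
open import Function.Bundles using (Inverse)
open import Function.Definitions using (Injective)
import Level
open import Relation.Binary.Bundles using (Setoid)
open import Relation.Binary.Definitions using (_Respects_; Tri; tri<; tri≈; tri>)
open import Relation.Binary.PropositionalEquality as ≡ using (_≡_; _≢_)
import Relation.Binary.Reasoning.Setoid as SetoidReasoning
open import Relation.Nullary using (¬_; Dec; yes; no)
open import Relation.Nullary.Decidable using (map′)
open import Relation.Unary using (Pred; Decidable; _∈_; _⊆_; _≐_; _∩_; _≬_; _⊥_)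
open import Relation.Unary.Properties using (≐-sym; ≐-trans)

-- Finite counting

-- Only an equality of point sets ties `U₀` to `U`, and one linear set can come from several
-- 𝔽_q-spaces. So vectors of `U₀` and `U` are compared only up to unknown scalars of `F`, and no
-- linear map from one onto the other is at hand. What survives is that `U₀` meets A = Γ ⊔ T
-- trivially for a transversal T; since |Γ| |T| |U₀| = |V|, the elements of `U₀` then represent the
-- classes of V / A. The origin of `Θ`: V / A₂ has dimension n, and by Dedekind's lemma no nonzero
-- vector has all its t conjugates in A₂. Hence v ↦ (φ^j v mod A₂)_j embeds V into (V / A₂)^t, which
-- has the same size, and is a bijection. `Θ` is the preimage of the factor j = 0, and its
-- conjugates are those of the other factors. That the transversals differ is used once: it makes
-- the map of scalars nontrivial, which gives A₁ + A₂ = V and A₁ ∩ A₂ = Γ.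

injective⇒surjective : ∀ {n} (f : Fin n → Fin n) → Injective _≡_ _≡_ f → ∀ y → ∃[ x ] f x ≡ y
injective⇒surjective {suc n} f f-inj y with Finₚ.any? (λ x → f x Finₚ.≟ y)
... | yes ∃x = ∃x
... | no ∄x  = ⊥-elim (ℕₚ.1+n≰n (Finₚ.injective⇒≤ {f = λ x → punchOut (y≢f x)}
                 (λ {i} {j} eq → f-inj (Finₚ.punchOut-injective (y≢f i) (y≢f j) eq))))
  where
  y≢f : ∀ x → y ≢ f x
  y≢f x eq = ∄x (x , ≡.sym eq)

-- A choice of preimages is injective, hence surjective, so it is a two-sided inverse of `f`.
surjective⇒injective : ∀ {n} (f : Fin n → Fin n) → (∀ y → ∃[ x ] f x ≡ y) → Injective _≡_ _≡_ f
surjective⇒injective f f-surj {i} {j} fi≡fj =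
  let (a , ga≡i) = g-surj i
      (b , gb≡j) = g-surj j
      a≡b = ≡.trans (≡.sym (f∘g a)) (≡.trans (≡.cong f ga≡i) (≡.trans fi≡fj (≡.trans (≡.cong f (≡.sym gb≡j)) (f∘g b))))
  in ≡.trans (≡.sym ga≡i) (≡.trans (≡.cong g a≡b) gb≡j)
  where
  g = proj₁ ∘ f-surj
  f∘g = proj₂ ∘ f-surj
  g-surj = injective⇒surjective g (λ {a} {b} eq → ≡.trans (≡.sym (f∘g a)) (≡.trans (≡.cong f eq) (f∘g b)))

-- Pigeonhole for k (m + 1) pairs against k m; it delivers the contradiction with scatteredness.
no-pair-injection : ∀ {k m} → 0 ℕ.< k → (f : Fin k → Fin (suc m) → Fin k) (g : Fin k → Fin (suc m) → Fin m) →
                    ¬ (∀ {i j i′ j′} → f i j ≡ f i′ j′ → g i j ≡ g i′ j′ → i ≡ i′ × j ≡ j′)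
no-pair-injection {k} {m} 0<k f g inj = ℕₚ.<⇒≱ k*m<k*[1+m] (Finₚ.injective⇒≤ {f = h} h-injective)
  where
  k*m<k*[1+m] : k ℕ.* m ℕ.< k ℕ.* suc m
  k*m<k*[1+m] = ≡.subst (k ℕ.* m ℕ.<_) (≡.sym (ℕₚ.*-suc k m)) (ℕₚ.m<n+m (k ℕ.* m) 0<k)
  h : Fin (k ℕ.* suc m) → Fin (k ℕ.* m)
  h x = combine (uncurry f (remQuot (suc m) x)) (uncurry g (remQuot (suc m) x))
  h-injective : ∀ {x y} → h x ≡ h y → x ≡ y
  h-injective {x} {y} eq =
    let (f≡ , g≡) = Finₚ.combine-injective _ _ _ _ eq
        (eqˡ , eqʳ) = inj f≡ g≡
    in ≡.trans (≡.sym (Finₚ.combine-remQuot {k} (suc m) x))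
         (≡.trans (≡.cong₂ combine eqˡ eqʳ) (Finₚ.combine-remQuot {k} (suc m) y))

funToFin-cong : ∀ {m n} {f g : Fin m → Fin n} → (∀ i → f i ≡ g i) → funToFin f ≡ funToFin g
funToFin-cong {zero}  eq = ≡.refl
funToFin-cong {suc m} eq = ≡.cong₂ combine (eq zero) (funToFin-cong (eq ∘ suc))

module Counting {c ℓ} (S : Setoid c ℓ) where
  open Setoid S

  -- `index` takes a proof of membership, so `P` need not be decidable; `elt-injective` and
  -- `elt-index` make its value independent of that proof.
  record Enumeration {p} (P : Pred Carrier p) (n : ℕ) : Set (c Level.⊔ ℓ Level.⊔ p) where
    field
      elt           : Fin n → Carrier
      elt∈          : ∀ i → P (elt i)
      elt-injective : ∀ {i j} → elt i ≈ elt j → i ≡ j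
      index         : ∀ {v} → P v → Fin n
      elt-index     : ∀ {v} (v∈ : P v) → elt (index v∈) ≈ v

  open Enumeration

  enumeration-resize : ∀ {p} {P : Pred Carrier p} {m n} → m ≡ n → Enumeration P m → Enumeration P n
  enumeration-resize ≡.refl e = e

  module _ {p} {P : Pred Carrier p} {n} (e : Enumeration P n)
           (f : Fin n → Carrier) (f∈ : ∀ i → P (f i)) where

    injective⇒covers : (∀ {i j} → f i ≈ f j → i ≡ j) → ∀ {v} → P v → ∃[ i ] f i ≈ v
    injective⇒covers f-inj v∈ =
      let (i , eq) = injective⇒surjective (index e ∘ f∈)
                       (λ {i} {j} eq → f-inj (trans (sym (elt-index e (f∈ i)))
                          (trans (reflexive (≡.cong (elt e) eq)) (elt-index e (f∈ j)))))
                       (index e v∈)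
      in i , trans (sym (elt-index e (f∈ i))) (trans (reflexive (≡.cong (elt e) eq)) (elt-index e v∈))

    covers⇒injective : (∀ {v} → P v → ∃[ i ] f i ≈ v) → ∀ {i j} → f i ≈ f j → i ≡ j
    covers⇒injective cov {i} {j} fi≈fj = surjective⇒injective (index e ∘ f∈) surj
      (elt-injective e (trans (elt-index e (f∈ i)) (trans fi≈fj (sym (elt-index e (f∈ j))))))
      where
      surj : ∀ y → ∃[ x ] index e (f∈ x) ≡ y
      surj y = let (x , eq) = cov (elt∈ e y) in x , elt-injective e (trans (elt-index e (f∈ x)) eq)

  module _ {p} {P : Pred Carrier p} {k m} (e : Enumeration P (k ℕ.* m))
           (f : Fin k → Fin m → Carrier) (f∈ : ∀ i j → P (f i j)) where

    private
      f′ : Fin (k ℕ.* m) → Carrier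
      f′ x = uncurry f (remQuot m x)

      f′∈ : ∀ x → P (f′ x)
      f′∈ x = f∈ _ _

      f′-combine : ∀ i j → f′ (combine i j) ≡ f i j
      f′-combine i j = ≡.cong (uncurry f) (Finₚ.remQuot-combine i j)

    -- This and its converse `covers⇒injective₂` replace the dimension formula: applied to sums of
    -- elements of two subspaces whose sizes multiply to that of the whole space, they make trivial
    -- intersection and spanning equivalent.
    injective⇒covers₂ : (∀ {i j i′ j′} → f i j ≈ f i′ j′ → i ≡ i′ × j ≡ j′) →
                        ∀ {v} → P v → ∃₂ λ i j → f i j ≈ v
    injective⇒covers₂ f-inj v∈ =
      let (x , eq) = injective⇒covers e f′ f′∈
            (λ {x} {y} eq → let (eqˡ , eqʳ) = f-inj eq in
               ≡.trans (≡.sym (Finₚ.combine-remQuot {k} m x))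
                 (≡.trans (≡.cong₂ combine eqˡ eqʳ) (Finₚ.combine-remQuot {k} m y))) v∈
      in _ , _ , eq

    covers⇒injective₂ : (∀ {v} → P v → ∃₂ λ i j → f i j ≈ v) →
                        ∀ {i j i′ j′} → f i j ≈ f i′ j′ → i ≡ i′ × j ≡ j′
    covers⇒injective₂ cov {i} {j} {i′} {j′} eq = Finₚ.combine-injective i j i′ j′
      (covers⇒injective e f′ f′∈
        (λ v∈ → let (i , j , eq) = cov v∈ in combine i j , trans (reflexive (f′-combine i j)) eq)
        (trans (reflexive (f′-combine i j)) (trans eq (reflexive (≡.sym (f′-combine i′ j′))))))

  ≈-dec : ∀ {p} {P : Pred Carrier p} {n} → Enumeration P n → ∀ {v w} → P v → P w → Dec (v ≈ w)
  ≈-dec e v∈ w∈ = map′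
    (λ eq → trans (sym (elt-index e v∈)) (trans (reflexive (≡.cong (elt e) eq)) (elt-index e w∈)))
    (λ v≈w → elt-injective e (trans (elt-index e v∈) (trans v≈w (sym (elt-index e w∈)))))
    (index e v∈ Finₚ.≟ index e w∈)

  remove : ∀ {p} {P : Pred Carrier p} {n} → Enumeration P n → ∀ {x} → P x →
           Enumeration (λ v → P v × ¬ (v ≈ x)) (n ℕ.∸ 1)
  remove {n = zero} e x∈ with () ← index e x∈
  remove {n = suc n} e x∈ = record
    { elt           = λ i → elt e (punchIn k i)
    ; elt∈          = λ i → elt∈ e _ , λ eq →
        Finₚ.punchInᵢ≢i k i (elt-injective e (trans eq (sym (elt-index e x∈))))
    ; elt-injective = λ eq → Finₚ.punchIn-injective k _ _ (elt-injective e eq)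
    ; index         = λ v → punchOut (k≢ v)
    ; elt-index     = λ v → trans (reflexive (≡.cong (elt e) (Finₚ.punchIn-punchOut (k≢ v)))) (elt-index e (proj₁ v))
    }
    where
    k = index e x∈
    k≢ : ∀ {v} (v∈ : _ × ¬ (v ≈ _)) → k ≢ index e (proj₁ v∈)
    k≢ (v∈ , v≉x) eq = v≉x (trans (sym (elt-index e v∈)) (trans (reflexive (≡.cong (elt e) (≡.sym eq))) (elt-index e x∈)))

functions : ∀ k m → Counting.Enumeration (Fin k ≡.→-setoid Fin m) (λ _ → ⊤ {Level.zero}) (m ℕ.^ k)
functions k m = record
  { elt           = finToFun
  ; elt∈          = λ _ → tt
  ; elt-injective = λ {i} {j} eq → ≡.trans (≡.sym (Finₚ.funToFin-finToFin {k} i))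
      (≡.trans (funToFin-cong {f = finToFun {n = k} i} {g = finToFun {n = k} j} eq) (Finₚ.funToFin-finToFin {k} j))
  ; index         = λ {f} _ → funToFin f
  ; elt-index     = λ {f} _ → Finₚ.finToFun-funToFin f
  }

-- Finite fields

module FiniteField {ℓ} (F : HeytingField ℓ ℓ ℓ) {Q : ℕ} (order : HasOrder F Q) where
  open CommutativeRing (ring F) hiding (ring)
  open Inverse order using (to-cong; inverseˡ; inverseʳ) renaming (to to code; from to digit) public

  digit-code : ∀ a → digit (code a) ≈ a
  digit-code a = inverseʳ ≡.refl

  code-digit : ∀ i → code (digit i) ≡ i
  code-digit i = inverseˡ refl

  infix 4 _≟_
  _≟_ : ∀ a b → Dec (a ≈ b)
  a ≟ b = map′ (λ eq → trans (sym (digit-code a)) (trans (reflexive (≡.cong digit eq)) (digit-code b)))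
               to-cong (code a Finₚ.≟ code b)

  search : ∀ {p} {P : Pred Carrier p} → P Respects _≈_ → Decidable P → (∀ a → P a) ⊎ (∃[ a ] ¬ P a)
  search resp P? with Finₚ.all? (P? ∘ digit)
  ... | yes all = inj₁ (λ a → resp (digit-code a) (all (code a)))
  ... | no ¬all = let (i , ¬Pi) = Finₚ.¬∀⟶∃¬ _ _ (P? ∘ digit) ¬all in inj₂ (digit i , ¬Pi)

  private
    module Hey = HeytingField F

  -- The Heyting field axioms speak of invertibility of differences, so a statement about one
  -- element arrives as one about `x - 0#`.
  x-0≈x : ∀ x → x - 0# ≈ x
  x-0≈x x = trans (+-congˡ (trans (sym (+-identityˡ _)) (-‿inverseʳ 0#))) (+-identityʳ x)

  1≉0 : ¬ (1# ≈ 0#)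
  1≉0 1≈0 = Hey.#-irrefl 1≈0 (Hey.invertible⇒#
    (1# , trans (*-identityˡ _) (x-0≈x 1#) , trans (*-identityʳ _) (x-0≈x 1#)))

  -- `¬ (a ≈ 0#)` does not give apartness directly, so the inverse is searched for. If the search
  -- fails, `a` cannot be apart from 0, and tightness makes it 0.
  inverse : ∀ {a} → ¬ (a ≈ 0#) → ∃[ b ] b * a ≈ 1#
  inverse {a} a≉0 with Finₚ.any? (λ i → digit i * a ≟ 1#)
  ... | yes (i , eq) = digit i , eq
  ... | no ∄ = ⊥-elim (a≉0 (proj₁ (Hey.tight a 0#) λ a#0 →
          let (b , eq , _) = Hey.#⇒invertible a#0
          in ∄ (code b , trans (*-cong (digit-code b) (sym (x-0≈x a))) eq)))

  open Counting setoid

  elements : Enumeration (λ _ → ⊤ {ℓ}) Q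
  elements = record
    { elt           = digit
    ; elt∈          = λ _ → tt
    ; elt-injective = λ {i} {j} eq → ≡.trans (≡.sym (code-digit i)) (≡.trans (to-cong eq) (code-digit j))
    ; index         = λ {a} _ → code a
    ; elt-index     = λ {a} _ → digit-code a
    }

  units : Enumeration (λ a → ¬ (a ≈ 0#)) (Q ℕ.∸ 1)
  units = record
    { elt           = E.elt
    ; elt∈          = proj₂ ∘ E.elt∈
    ; elt-injective = E.elt-injective
    ; index         = λ a≉0 → E.index (tt , a≉0)
    ; elt-index     = λ a≉0 → E.elt-index (tt , a≉0)
    }
    where module E = Enumeration (remove elements {0#} tt)

  1<order : 1 ℕ.< Q
  1<order = at-least-two Q (code 0#) (code 1#) λ eq → 1≉0
    (trans (sym (digit-code 1#)) (trans (reflexive (≡.cong digit (≡.sym eq))) (digit-code 0#)))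
    where
    at-least-two : ∀ k (i j : Fin k) → i ≢ j → 1 ℕ.< k
    at-least-two (suc zero)    zero zero i≢j = ⊥-elim (i≢j ≡.refl)
    at-least-two (suc (suc k)) _    _    _   = ℕ.s≤s (ℕ.s≤s ℕ.z≤n)

  digits : ∀ {k} → Fin (Q ℕ.^ k) → Fin k → Carrier
  digits i = digit ∘ finToFun i

  undigits : ∀ {k} → (Fin k → Carrier) → Fin (Q ℕ.^ k)
  undigits a = funToFin (code ∘ a)

  digits-undigits : ∀ {k} (a : Fin k → Carrier) j → digits (undigits a) j ≈ a j
  digits-undigits a j =
    trans (reflexive (≡.cong digit (Finₚ.finToFun-funToFin (code ∘ a) j))) (digit-code (a j))

  digits-injective : ∀ {k} {i i′ : Fin (Q ℕ.^ k)} → (∀ (j : Fin k) → digits i j ≈ digits i′ j) → i ≡ i′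
  digits-injective {k} eq = Counting.Enumeration.elt-injective (functions k Q)
    (λ j → ≡.trans (≡.sym (code-digit _)) (≡.trans (to-cong (eq j)) (code-digit _)))

-- Arithmetic modulo t and the count of a complement

%-cancelʳ : ∀ {t} .{{_ : ℕ.NonZero t}} a b → (b ℕ.+ a) % t ≡ a % t → t ∣ b
%-cancelʳ {t} a b eq = ∣m+n∣m⇒∣n (divides ((b ℕ.+ a) / t) quotients) (divides (a / t) ≡.refl)
  where
  open ≡.≡-Reasoning
  quotients : (a / t) ℕ.* t ℕ.+ b ≡ (b ℕ.+ a) / t ℕ.* t
  quotients = ℕₚ.+-cancelˡ-≡ (a % t) _ _ (begin
    a % t ℕ.+ ((a / t) ℕ.* t ℕ.+ b)             ≡⟨ ℕₚ.+-assoc (a % t) _ b ⟨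
    a % t ℕ.+ (a / t) ℕ.* t ℕ.+ b               ≡⟨ ≡.cong (ℕ._+ b) (m≡m%n+[m/n]*n a t) ⟨
    a ℕ.+ b                                     ≡⟨ ℕₚ.+-comm a b ⟩
    b ℕ.+ a                                     ≡⟨ m≡m%n+[m/n]*n (b ℕ.+ a) t ⟩
    (b ℕ.+ a) % t ℕ.+ (b ℕ.+ a) / t ℕ.* t       ≡⟨ ≡.cong (ℕ._+ (b ℕ.+ a) / t ℕ.* t) eq ⟩
    a % t ℕ.+ (b ℕ.+ a) / t ℕ.* t               ∎)

-- Here t - i stands for -i: undoing the i-th conjugation leaves a proper conjugate of every other
-- summand.
difference-% : ∀ {t i k} .{{_ : ℕ.NonZero t}} → i < t → k < t → i ≢ k → ((t ℕ.∸ i) ℕ.+ k) % t ≢ 0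
difference-% {t} {i} {k} i<t k<t i≢k ≡0 = by-cases (ℕₚ.<-cmp i k)
  where
  t∣ : t ∣ (t ℕ.∸ i) ℕ.+ k
  t∣ = m%n≡0⇒n∣m _ t ≡0
  by-cases : ¬ Tri (i < k) (i ≡ k) (k < i)
  by-cases (tri≈ _ i≡k _) = i≢k i≡k
  by-cases (tri< i<k _ _) = >⇒∤ {{ℕ.>-nonZero (ℕₚ.m<n⇒0<n∸m i<k)}} (ℕₚ.≤-<-trans (ℕₚ.m∸n≤m k i) k<t)
    (∣m+n∣m⇒∣n (≡.subst (t ∣_) (≡.trans (≡.sym (ℕₚ.+-∸-comm k (ℕₚ.<⇒≤ i<t))) (ℕₚ.+-∸-assoc t (ℕₚ.<⇒≤ i<k))) t∣) ∣-refl)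
  by-cases (tri> _ _ k<i) = >⇒∤ {{ℕ.>-nonZero (ℕₚ.<-≤-trans (ℕₚ.m<n⇒0<n∸m i<t) (ℕₚ.m≤m+n _ k))}}
    (ℕₚ.<-≤-trans (ℕₚ.+-monoʳ-< (t ℕ.∸ i) k<i) (ℕₚ.≤-reflexive (ℕₚ.m∸n+n≡m (ℕₚ.<⇒≤ i<t)))) t∣

module MultiplesModulo {t μ : ℕ} .{{_ : ℕ.NonZero t}} (coprime : GCD.gcd μ t ≡ 1) where

  multiples-<-distinct : ∀ {i j} → i < j → j < t → (j ℕ.* μ) % t ≢ (i ℕ.* μ) % t
  multiples-<-distinct {i} {j} i<j j<t eq = >⇒∤ {{ℕ.>-nonZero (ℕₚ.m<n⇒0<n∸m i<j)}} (ℕₚ.≤-<-trans (ℕₚ.m∸n≤m j i) j<t)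
    (coprime-divisor (Coprimality.sym (gcd≡1⇒coprime {μ} {t} coprime))
      (≡.subst (t ∣_) (ℕₚ.*-comm (j ℕ.∸ i) μ) (%-cancelʳ (i ℕ.* μ) ((j ℕ.∸ i) ℕ.* μ)
        (≡.trans (≡.cong (_% t) (≡.trans (≡.sym (ℕₚ.*-distribʳ-+ μ (j ℕ.∸ i) i))
          (≡.cong (ℕ._* μ) (ℕₚ.m∸n+n≡m (ℕₚ.<⇒≤ i<j))))) eq))))

  multiples-injective : ∀ {i j} → i < t → j < t → (i ℕ.* μ) % t ≡ (j ℕ.* μ) % t → i ≡ j
  multiples-injective {i} {j} i<t j<t eq = by-cases (ℕₚ.<-cmp i j)
    where
    by-cases : Tri (i < j) (i ≡ j) (j < i) → i ≡ j
    by-cases (tri< i<j _ _) = ⊥-elim (multiples-<-distinct i<j j<t (≡.sym eq))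
    by-cases (tri≈ _ i≡j _) = i≡j
    by-cases (tri> _ _ j<i) = ⊥-elim (multiples-<-distinct j<i i<t eq)

  multiples-surjective : ∀ {k} → k < t → ∃[ i ] i < t × (i ℕ.* μ) % t ≡ k
  multiples-surjective {k} k<t =
    let (i , eq) = injective⇒surjective f f-injective (fromℕ< k<t) in
    toℕ i , Finₚ.toℕ<n i , ≡.trans (≡.sym (toℕ-f i)) (≡.trans (≡.cong toℕ eq) (Finₚ.toℕ-fromℕ< k<t))
    where
    f : Fin t → Fin t
    f i = fromℕ< (m%n<n (toℕ i ℕ.* μ) t)
    toℕ-f : ∀ i → toℕ (f i) ≡ (toℕ i ℕ.* μ) % t
    toℕ-f i = Finₚ.toℕ-fromℕ< (m%n<n (toℕ i ℕ.* μ) t)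
    f-injective : ∀ {i j} → f i ≡ f j → i ≡ j
    f-injective {i} {j} eq = Finₚ.toℕ-injective (multiples-injective (Finₚ.toℕ<n i) (Finₚ.toℕ<n j)
      (≡.trans (≡.sym (toℕ-f i)) (≡.trans (≡.cong toℕ eq) (toℕ-f j))))

-- The factors are the sizes of Γ, of a transversal and of `U₀`, and the product is the size of V.
-- As exponents of q: t n (t - 2) + t n + t n = t (t n).
complement-count : ∀ q n {t} → 2 ≤ t →
  (q ℕ.^ t) ℕ.^ (n ℕ.* (t ℕ.∸ 2)) ℕ.* (q ℕ.^ t) ℕ.^ n ℕ.* q ℕ.^ (t ℕ.* n) ≡ (q ℕ.^ t) ℕ.^ (t ℕ.* n)
complement-count q n {suc (suc t)} (s≤s (s≤s z≤n)) = begin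
  Q ℕ.^ (n ℕ.* t) ℕ.* Q ℕ.^ n ℕ.* q ℕ.^ (T ℕ.* n) ≡⟨ ≡.cong (Q ℕ.^ (n ℕ.* t) ℕ.* Q ℕ.^ n ℕ.*_) (ℕₚ.^-*-assoc q T n) ⟨
  Q ℕ.^ (n ℕ.* t) ℕ.* Q ℕ.^ n ℕ.* Q ℕ.^ n         ≡⟨ ≡.cong (ℕ._* Q ℕ.^ n) (ℕₚ.^-distribˡ-+-* Q (n ℕ.* t) n) ⟨
  Q ℕ.^ (n ℕ.* t ℕ.+ n) ℕ.* Q ℕ.^ n               ≡⟨ ℕₚ.^-distribˡ-+-* Q (n ℕ.* t ℕ.+ n) n ⟨
  Q ℕ.^ (n ℕ.* t ℕ.+ n ℕ.+ n)                     ≡⟨ ≡.cong (Q ℕ.^_) (solve 2 (λ n t → n :* t :+ n :+ n := (con 2 :+ t) :* n) ≡.refl n t) ⟩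
  Q ℕ.^ (T ℕ.* n)                                 ∎
  where
  open ≡.≡-Reasoning
  open +-*-Solver
  T = suc (suc t)
  Q = q ℕ.^ T

-- Linear algebra over a finite field

module LinearAlgebra {ℓ} (F : HeytingField ℓ ℓ ℓ) {Q : ℕ} (order : HasOrder F Q)
                     (M : Module (ring F) ℓ ℓ) where
  private module F = CommutativeRing (ring F)
  open FiniteField F order
  open F using (Carrier; _≈_; _+_; _*_; -_; _-_; 0#; 1#)
  open Module M
  open Linear M
  open AbelianGroupProperties +ᴹ-abelianGroup public using ()
    renaming (inverseˡ-unique to neg-unique; x∙y⁻¹≈ε⇒x≈y to x-y≈0⇒x≈y; x≈y⇒x∙y⁻¹≈ε to x≈y⇒x-y≈0)
  open CommutativeSemigroupProperties (CommutativeMonoid.commutativeSemigroup +ᴹ-commutativeMonoid)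
    public using (interchange)
  open Sum +ᴹ-commutativeMonoid public using (sum; sum-cong-≋; ∑-distrib-+)
  open Counting ≈ᴹ-setoid public
  open SetoidReasoning ≈ᴹ-setoid

  -*ₗ : ∀ a v → (- a) *ₗ v ≈ᴹ -ᴹ (a *ₗ v)
  -*ₗ a v = neg-unique _ _ (begin
    (- a) *ₗ v +ᴹ a *ₗ v ≈⟨ *ₗ-distribʳ v (- a) a ⟨
    (- a + a) *ₗ v       ≈⟨ *ₗ-congʳ (F.-‿inverseˡ a) ⟩
    0# *ₗ v              ≈⟨ *ₗ-zeroˡ v ⟩
    0ᴹ                   ∎)

  -1*ₗ : ∀ v → (- 1#) *ₗ v ≈ᴹ -ᴹ v
  -1*ₗ v = ≈ᴹ-trans (-*ₗ 1# v) (-ᴹ‿cong (*ₗ-identityˡ v))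

  *ₗ-sub : ∀ a b v → (a - b) *ₗ v ≈ᴹ a *ₗ v +ᴹ -ᴹ (b *ₗ v)
  *ₗ-sub a b v = ≈ᴹ-trans (*ₗ-distribʳ v a (- b)) (+ᴹ-congˡ (-*ₗ b v))

  *ₗ-inverse : ∀ {a} → ¬ (a ≈ 0#) → ∃[ b ] (∀ v → v ≈ᴹ b *ₗ (a *ₗ v))
  *ₗ-inverse {a} a≉0 = let (b , ba≈1) = inverse a≉0 in
    b , λ v → ≈ᴹ-trans (≈ᴹ-sym (*ₗ-identityˡ v)) (≈ᴹ-trans (*ₗ-congʳ (F.sym ba≈1)) (*ₗ-assoc b a v))

  *ₗ-cancel-0 : ∀ {a v} → ¬ (a ≈ 0#) → a *ₗ v ≈ᴹ 0ᴹ → v ≈ᴹ 0ᴹ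
  *ₗ-cancel-0 {a} {v} a≉0 av≈0 = let (b , inv) = *ₗ-inverse a≉0 in begin
    v             ≈⟨ inv v ⟩
    b *ₗ (a *ₗ v) ≈⟨ *ₗ-congˡ av≈0 ⟩
    b *ₗ 0ᴹ       ≈⟨ *ₗ-zeroʳ b ⟩
    0ᴹ            ∎

  *ₗ-injectiveʳ : ∀ {a b v} → ¬ (v ≈ᴹ 0ᴹ) → a *ₗ v ≈ᴹ b *ₗ v → a ≈ b
  *ₗ-injectiveʳ {a} {b} {v} v≉0 av≈bv with a ≟ b
  ... | yes a≈b = a≈b
  ... | no a≉b  = ⊥-elim (v≉0 (*ₗ-cancel-0 (λ a-b≈0 → a≉b (GroupProperties.x∙y⁻¹≈ε⇒x≈y F.+-group a b a-b≈0))
                    (≈ᴹ-trans (*ₗ-sub a b v) (x≈y⇒x-y≈0 av≈bv))))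

  *ₗ-nonzero : ∀ {a v w} → ¬ (w ≈ᴹ 0ᴹ) → w ≈ᴹ a *ₗ v → ¬ (a ≈ 0#)
  *ₗ-nonzero w≉0 w≈av a≈0 = w≉0 (≈ᴹ-trans w≈av (≈ᴹ-trans (*ₗ-congʳ a≈0) (*ₗ-zeroˡ _)))

  -- Subspaces

  open Subspace using () renaming (≈-resp to resp; 0∈ to zero∈; +∈ to add∈; *∈ to scale∈)

  neg∈ : ∀ X {v} → v ∈ El X → (-ᴹ v) ∈ El X
  neg∈ X v∈ = resp X (-1*ₗ _) (scale∈ X (- 1#) v∈)

  sub∈ : ∀ X {v w} → v ∈ El X → w ∈ El X → (v +ᴹ -ᴹ w) ∈ El X
  sub∈ X v∈ w∈ = add∈ X v∈ (neg∈ X w∈)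

  unscale∈ : ∀ X {a v} → ¬ (a ≈ 0#) → (a *ₗ v) ∈ El X → v ∈ El X
  unscale∈ X a≉0 av∈ = let (b , inv) = *ₗ-inverse a≉0 in resp X (≈ᴹ-sym (inv _)) (scale∈ X b av∈)

  sum∈ : ∀ X {k} {f : Fin k → Carrierᴹ} → (∀ i → f i ∈ El X) → sum f ∈ El X
  sum∈ X {zero}  f∈ = zero∈ X
  sum∈ X {suc k} f∈ = add∈ X (f∈ zero) (sum∈ X (f∈ ∘ suc))

  span-least : ∀ {S : Pred Carrierᴹ ℓ} X → (∀ {v} → v ∈ S → v ∈ El X) → ∀ {v} → Span S v → v ∈ El X
  span-least X S⊆X (gen v∈)       = S⊆X v∈
  span-least X S⊆X (≈-resp e v∈)  = resp X e (span-least X S⊆X v∈)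
  span-least X S⊆X 0∈             = zero∈ X
  span-least X S⊆X (+∈ v∈ w∈)     = add∈ X (span-least X S⊆X v∈) (span-least X S⊆X w∈)
  span-least X S⊆X (*∈ a v∈)      = scale∈ X a (span-least X S⊆X v∈)

  ⊔-elim : ∀ {X Y v} → v ∈ El (X ⊔ Y) → ∃₂ λ x y → x ∈ El X × y ∈ El Y × v ≈ᴹ x +ᴹ y
  ⊔-elim {X} {Y} (gen (inj₁ x∈)) = _ , 0ᴹ , x∈ , zero∈ Y , ≈ᴹ-sym (+ᴹ-identityʳ _)
  ⊔-elim {X} {Y} (gen (inj₂ y∈)) = 0ᴹ , _ , zero∈ X , y∈ , ≈ᴹ-sym (+ᴹ-identityˡ _)
  ⊔-elim {X} {Y} (≈-resp e v∈) =
    let (x , y , x∈ , y∈ , eq) = ⊔-elim {X} {Y} v∈ in x , y , x∈ , y∈ , ≈ᴹ-trans (≈ᴹ-sym e) eq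
  ⊔-elim {X} {Y} 0∈ = 0ᴹ , 0ᴹ , zero∈ X , zero∈ Y , ≈ᴹ-sym (+ᴹ-identityˡ _)
  ⊔-elim {X} {Y} (+∈ v∈ w∈) =
    let (x , y , x∈ , y∈ , eq) = ⊔-elim {X} {Y} v∈
        (x′ , y′ , x′∈ , y′∈ , eq′) = ⊔-elim {X} {Y} w∈
    in _ , _ , add∈ X x∈ x′∈ , add∈ Y y∈ y′∈ , ≈ᴹ-trans (+ᴹ-cong eq eq′) (interchange x y x′ y′)
  ⊔-elim {X} {Y} (*∈ a v∈) =
    let (x , y , x∈ , y∈ , eq) = ⊔-elim {X} {Y} v∈
    in _ , _ , scale∈ X a x∈ , scale∈ Y a y∈ , ≈ᴹ-trans (*ₗ-congˡ eq) (*ₗ-distribˡ a x y)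

  ⊔-introˡ : ∀ X Y {v} → v ∈ El X → v ∈ El (X ⊔ Y)
  ⊔-introˡ X Y v∈ = gen (inj₁ v∈)

  ⊔-introʳ : ∀ X Y {v} → v ∈ El Y → v ∈ El (X ⊔ Y)
  ⊔-introʳ X Y v∈ = gen (inj₂ v∈)

  -- Stated for predicates and for the differences actually formed, so that it also applies when one
  -- summand is an `F`-subspace and the other only a `K`-subspace, and to multiples of vectors in a
  -- quotient.
  sum-unique : ∀ {p r} {X : Pred Carrierᴹ p} {Y : Pred Carrierᴹ r} →
               (∀ {v} → v ∈ X → v ∈ Y → v ≈ᴹ 0ᴹ) → X Respects _≈ᴹ_ →
               ∀ {x x′ y y′} → (x +ᴹ -ᴹ x′) ∈ X → (y′ +ᴹ -ᴹ y) ∈ Y →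
               x +ᴹ y ≈ᴹ x′ +ᴹ y′ → x ≈ᴹ x′ × y ≈ᴹ y′
  sum-unique X∩Y X-resp {x} {x′} {y} {y′} x∈ y∈ eq = x≈x′ , GroupProperties.∙-cancelˡ +ᴹ-group x′ _ _
      (≈ᴹ-trans (+ᴹ-congʳ (≈ᴹ-sym x≈x′)) eq)
    where
    difference : x +ᴹ -ᴹ x′ ≈ᴹ y′ +ᴹ -ᴹ y
    difference = GroupProperties.∙-cancelʳ +ᴹ-group (x′ +ᴹ y) _ _ (begin
      (x +ᴹ -ᴹ x′) +ᴹ (x′ +ᴹ y) ≈⟨ +ᴹ-assoc x (-ᴹ x′) (x′ +ᴹ y) ⟩
      x +ᴹ (-ᴹ x′ +ᴹ (x′ +ᴹ y)) ≈⟨ +ᴹ-congˡ (+ᴹ-assoc (-ᴹ x′) x′ y) ⟨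
      x +ᴹ (-ᴹ x′ +ᴹ x′ +ᴹ y)   ≈⟨ +ᴹ-congˡ (≈ᴹ-trans (+ᴹ-congʳ (-ᴹ‿inverseˡ x′)) (+ᴹ-identityˡ y)) ⟩
      x +ᴹ y                    ≈⟨ eq ⟩
      x′ +ᴹ y′                  ≈⟨ +ᴹ-comm x′ y′ ⟩
      y′ +ᴹ x′                  ≈⟨ +ᴹ-congˡ (≈ᴹ-trans (+ᴹ-congʳ (-ᴹ‿inverseˡ y)) (+ᴹ-identityˡ x′)) ⟨
      y′ +ᴹ (-ᴹ y +ᴹ y +ᴹ x′)   ≈⟨ +ᴹ-congˡ (≈ᴹ-trans (+ᴹ-assoc (-ᴹ y) y x′) (+ᴹ-congˡ (+ᴹ-comm y x′))) ⟩
      y′ +ᴹ (-ᴹ y +ᴹ (x′ +ᴹ y)) ≈⟨ +ᴹ-assoc y′ (-ᴹ y) (x′ +ᴹ y) ⟨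
      (y′ +ᴹ -ᴹ y) +ᴹ (x′ +ᴹ y) ∎)
    x≈x′ : x ≈ᴹ x′
    x≈x′ = x-y≈0⇒x≈y x x′ (≈ᴹ-trans difference (X∩Y (X-resp difference x∈) y∈))

  -- Sums and linear combinations

  sum-zero : ∀ {k} {f : Fin k → Carrierᴹ} → (∀ i → f i ≈ᴹ 0ᴹ) → sum f ≈ᴹ 0ᴹ
  sum-zero {zero}  f≈0 = ≈ᴹ-refl
  sum-zero {suc k} f≈0 = ≈ᴹ-trans (+ᴹ-cong (f≈0 zero) (sum-zero (f≈0 ∘ suc))) (+ᴹ-identityˡ 0ᴹ)

  sum-pick : ∀ {k} {f : Fin k → Carrierᴹ} i → (∀ j → j ≢ i → f j ≈ᴹ 0ᴹ) → sum f ≈ᴹ f i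
  sum-pick zero    f≈0 = ≈ᴹ-trans (+ᴹ-congˡ (sum-zero λ j → f≈0 (suc j) λ ())) (+ᴹ-identityʳ _)
  sum-pick (suc i) f≈0 = ≈ᴹ-trans (+ᴹ-cong (f≈0 zero λ ()) (sum-pick i λ j j≢i → f≈0 (suc j) (j≢i ∘ Finₚ.suc-injective)))
                           (+ᴹ-identityˡ _)

  *ₗ-sum : ∀ a {k} (f : Fin k → Carrierᴹ) → a *ₗ sum f ≈ᴹ sum (λ i → a *ₗ f i)
  *ₗ-sum a {zero}  f = *ₗ-zeroʳ a
  *ₗ-sum a {suc k} f = ≈ᴹ-trans (*ₗ-distribˡ a _ _) (+ᴹ-congˡ (*ₗ-sum a (f ∘ suc)))

  lincomb : ∀ {k} → (Fin k → Carrier) → (Fin k → Carrierᴹ) → Carrierᴹ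
  lincomb a b = sum (λ i → a i *ₗ b i)

  lincomb-congʳ : ∀ {k} {a a′ : Fin k → Carrier} b → (∀ i → a i ≈ a′ i) → lincomb a b ≈ᴹ lincomb a′ b
  lincomb-congʳ b eq = sum-cong-≋ (λ i → *ₗ-congʳ (eq i))

  lincomb-+ : ∀ {k} (a a′ : Fin k → Carrier) b →
              lincomb (λ i → a i + a′ i) b ≈ᴹ lincomb a b +ᴹ lincomb a′ b
  lincomb-+ a a′ b = ≈ᴹ-trans (sum-cong-≋ (λ i → *ₗ-distribʳ (b i) (a i) (a′ i)))
                                (∑-distrib-+ (λ i → a i *ₗ b i) (λ i → a′ i *ₗ b i))

  lincomb-* : ∀ {k} c (a : Fin k → Carrier) b → c *ₗ lincomb a b ≈ᴹ lincomb (λ i → c * a i) b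
  lincomb-* c a b = ≈ᴹ-trans (*ₗ-sum c (λ i → a i *ₗ b i)) (sum-cong-≋ (λ i → ≈ᴹ-sym (*ₗ-assoc c (a i) (b i))))

  lincomb∈ : ∀ X {k} a {b : Fin k → Carrierᴹ} → (∀ i → b i ∈ El X) → lincomb a b ∈ El X
  lincomb∈ X a b∈ = sum∈ X (λ i → scale∈ X (a i) (b∈ i))

  δ : ∀ {k} → Fin k → Fin k → Carrier
  δ i j with i Finₚ.≟ j
  ... | yes _ = 1#
  ... | no _  = 0#

  δ-diag : ∀ {k} (i : Fin k) → δ i i ≈ 1#
  δ-diag i with i Finₚ.≟ i
  ... | yes _  = F.refl
  ... | no i≢i = ⊥-elim (i≢i ≡.refl)

  δ-off : ∀ {k} {i j : Fin k} → j ≢ i → δ i j ≈ 0#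
  δ-off {i = i} {j} j≢i with i Finₚ.≟ j
  ... | yes i≡j = ⊥-elim (j≢i (≡.sym i≡j))
  ... | no _    = F.refl

  lincomb-δ : ∀ {k} i (b : Fin k → Carrierᴹ) → lincomb (δ i) b ≈ᴹ b i
  lincomb-δ i b = ≈ᴹ-trans
    (sum-pick i λ j j≢i → ≈ᴹ-trans (*ₗ-congʳ (δ-off j≢i)) (*ₗ-zeroˡ _))
    (≈ᴹ-trans (*ₗ-congʳ (δ-diag i)) (*ₗ-identityˡ _))

  span⇒lincomb : ∀ {k} {b : Fin k → Carrierᴹ} {v} → v ∈ El (⟨⟩-family b) → ∃[ a ] v ≈ᴹ lincomb a b
  span⇒lincomb (gen (i , v≈bi)) = δ i , ≈ᴹ-trans v≈bi (≈ᴹ-sym (lincomb-δ i _))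
  span⇒lincomb (≈-resp e v∈)    = let (a , eq) = span⇒lincomb v∈ in a , ≈ᴹ-trans (≈ᴹ-sym e) eq
  span⇒lincomb {b = b} 0∈       = (λ _ → 0#) , ≈ᴹ-sym (sum-zero (λ i → *ₗ-zeroˡ (b i)))
  span⇒lincomb {b = b} (+∈ v∈ w∈) =
    let (a , eq) = span⇒lincomb v∈
        (a′ , eq′) = span⇒lincomb w∈
    in _ , ≈ᴹ-trans (+ᴹ-cong eq eq′) (≈ᴹ-sym (lincomb-+ a a′ b))
  span⇒lincomb {b = b} (*∈ c v∈) =
    let (a , eq) = span⇒lincomb v∈ in _ , ≈ᴹ-trans (*ₗ-congˡ eq) (lincomb-* c a b)

  lincomb⇒span : ∀ {k} a (b : Fin k → Carrierᴹ) → lincomb a b ∈ El (⟨⟩-family b)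
  lincomb⇒span a b = lincomb∈ (⟨⟩-family b) a (λ i → gen (i , ≈ᴹ-refl))

  independent⇒nonzero : ∀ {k} {b : Fin k → Carrierᴹ} → LinearlyIndependent b → ∀ i → ¬ (b i ≈ᴹ 0ᴹ)
  independent⇒nonzero {b = b} indep i eq =
    1≉0 (F.trans (F.sym (δ-diag i)) (indep (δ i) (≈ᴹ-trans (lincomb-δ i b) eq) i))

  lincomb-unique : ∀ {k} {b : Fin k → Carrierᴹ} → LinearlyIndependent b →
                   ∀ {a a′} → lincomb a b ≈ᴹ lincomb a′ b → ∀ i → a i ≈ a′ i
  lincomb-unique {b = b} indep {a} {a′} eq i = GroupProperties.x∙y⁻¹≈ε⇒x≈y F.+-group _ _
    (indep (λ i → a i - a′ i) (begin
      lincomb (λ i → a i + - a′ i) b                ≈⟨ lincomb-+ a (λ i → - a′ i) b ⟩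
      lincomb a b +ᴹ lincomb (λ i → - a′ i) b       ≈⟨ +ᴹ-cong eq (lincomb-congʳ b λ i → neg (a′ i)) ⟩
      lincomb a′ b +ᴹ lincomb (λ i → - 1# * a′ i) b ≈⟨ +ᴹ-congˡ (lincomb-* (- 1#) a′ b) ⟨
      lincomb a′ b +ᴹ (- 1#) *ₗ lincomb a′ b        ≈⟨ +ᴹ-congˡ (-1*ₗ _) ⟩
      lincomb a′ b +ᴹ -ᴹ lincomb a′ b               ≈⟨ -ᴹ‿inverseʳ _ ⟩
      0ᴹ                                            ∎) i)
    where
    open RingProperties F.ring using (-1*x≈-x)
    neg : ∀ x → - x ≈ - 1# * x
    neg x = F.sym (-1*x≈-x x)

  ⟨⟩-elim : ∀ {v w} → w ∈ El ⟨ v ≈ᴹ_ ⟩ → ∃[ a ] w ≈ᴹ a *ₗ v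
  ⟨⟩-elim (gen v≈w)     = 1# , ≈ᴹ-trans (≈ᴹ-sym v≈w) (≈ᴹ-sym (*ₗ-identityˡ _))
  ⟨⟩-elim (≈-resp e w∈) = let (a , eq) = ⟨⟩-elim w∈ in a , ≈ᴹ-trans (≈ᴹ-sym e) eq
  ⟨⟩-elim 0∈            = 0# , ≈ᴹ-sym (*ₗ-zeroˡ _)
  ⟨⟩-elim (+∈ w∈ w′∈)   = let (a , eq) = ⟨⟩-elim w∈ ; (a′ , eq′) = ⟨⟩-elim w′∈ in
                          a + a′ , ≈ᴹ-trans (+ᴹ-cong eq eq′) (≈ᴹ-sym (*ₗ-distribʳ _ a a′))
  ⟨⟩-elim (*∈ c w∈)     = let (a , eq) = ⟨⟩-elim w∈ in c * a , ≈ᴹ-trans (*ₗ-congˡ eq) (≈ᴹ-sym (*ₗ-assoc c a _))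

  ⟨⟩-intro : ∀ {v w} a → w ≈ᴹ a *ₗ v → w ∈ El ⟨ v ≈ᴹ_ ⟩
  ⟨⟩-intro a eq = ≈-resp (≈ᴹ-sym eq) (*∈ a (gen ≈ᴹ-refl))

  -- Bases and counting

  abstract
    basis-enumeration : ∀ {X k} → HasDim X k → Enumeration (El X) (Q ℕ.^ k)
    basis-enumeration {X} {k} (b , indep , X⊆⟨b⟩ , ⟨b⟩⊆X) = record
      { elt           = λ i → lincomb (digits i) b
      ; elt∈          = λ i → ⟨b⟩⊆X (lincomb⇒span (digits i) b)
      ; elt-injective = λ {i} {i′} eq → digits-injective {k} {i} {i′} (lincomb-unique indep eq)
      ; index         = λ v∈ → undigits (proj₁ (span⇒lincomb (X⊆⟨b⟩ v∈)))
      ; elt-index     = λ v∈ → let (a , eq) = span⇒lincomb (X⊆⟨b⟩ v∈) in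
                          ≈ᴹ-trans (lincomb-congʳ b (digits-undigits a)) (≈ᴹ-sym eq)
      }

  -- The Q^k combinations of `c` are distinct and lie in X, which has only Q^k elements.
  independent⇒spans : ∀ {X k} → HasDim X k → {c : Fin k → Carrierᴹ} → LinearlyIndependent c →
                      (∀ i → c i ∈ El X) → ∀ {v} → v ∈ El X → ∃[ a ] v ≈ᴹ lincomb a c
  independent⇒spans {X} {k} dim {c} indep c∈ v∈ =
    let (i , eq) = injective⇒covers (basis-enumeration {X} {k} dim) (λ i → lincomb (digits i) c)
                     (λ i → lincomb∈ X (digits i) c∈)
                     (λ {i} {i′} eq → digits-injective {k} {i} {i′} (lincomb-unique indep eq)) v∈
    in digits i , ≈ᴹ-sym eq

  abstract
    ⊔-enumeration : ∀ X Y {k m} → (∀ {v} → v ∈ El X → v ∈ El Y → v ≈ᴹ 0ᴹ) →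
                    Enumeration (El X) k → Enumeration (El Y) m → Enumeration (El (X ⊔ Y)) (k ℕ.* m)
    ⊔-enumeration X Y {k} {m} X∩Y eX eY = record
      { elt           = λ i → uncurry elt (remQuot m i)
      ; elt∈          = λ i → add∈ (X ⊔ Y) (⊔-introˡ X Y (X′.elt∈ _)) (⊔-introʳ X Y (Y′.elt∈ _))
      ; elt-injective = λ {i} {j} eq → let (eqˡ , eqʳ) = elt-injective eq in
          ≡.trans (≡.sym (Finₚ.combine-remQuot {k} m i))
            (≡.trans (≡.cong₂ combine eqˡ eqʳ) (Finₚ.combine-remQuot {k} m j))
      ; index         = λ v∈ → let (x , y , x∈ , y∈ , _) = ⊔-elim {X} {Y} v∈ in combine (X′.index x∈) (Y′.index y∈)
      ; elt-index     = λ v∈ → let (x , y , x∈ , y∈ , eq) = ⊔-elim {X} {Y} v∈ in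
          ≈ᴹ-trans (≈ᴹ-reflexive (≡.cong (uncurry elt) (Finₚ.remQuot-combine (X′.index x∈) (Y′.index y∈))))
            (≈ᴹ-trans (+ᴹ-cong (X′.elt-index x∈) (Y′.elt-index y∈)) (≈ᴹ-sym eq))
      }
      where
      module X′ = Enumeration eX
      module Y′ = Enumeration eY
      elt : Fin k → Fin m → Carrierᴹ
      elt i j = X′.elt i +ᴹ Y′.elt j
      elt-injective : ∀ {i j i′ j′} → elt i j ≈ᴹ elt i′ j′ → i ≡ i′ × j ≡ j′
      elt-injective {i} {j} {i′} {j′} eq =
        let (x≈ , y≈) = sum-unique X∩Y (resp X) (sub∈ X (X′.elt∈ i) (X′.elt∈ i′)) (sub∈ Y (Y′.elt∈ j′) (Y′.elt∈ j)) eq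
        in X′.elt-injective x≈ , Y′.elt-injective y≈

  _GeneratedBy_ : Subspace → Carrierᴹ → Set ℓ
  P GeneratedBy v = v ∈ El P × (∀ {w} → w ∈ El P → ∃[ a ] w ≈ᴹ a *ₗ v)

  ≋⇒generated : ∀ {P v} → P ≋ ⟨ v ≈ᴹ_ ⟩ → P GeneratedBy v
  ≋⇒generated (P⊆ , ⊆P) = ⊆P (gen ≈ᴹ-refl) , λ w∈ → ⟨⟩-elim (P⊆ w∈)

  ⟨⟩-generated : ∀ {v} → ⟨ v ≈ᴹ_ ⟩ GeneratedBy v
  ⟨⟩-generated = gen ≈ᴹ-refl , ⟨⟩-elim

  singleton-independent : ∀ {v} → ¬ (v ≈ᴹ 0ᴹ) → LinearlyIndependent {1} (λ _ → v)
  singleton-independent {v} v≉0 a eq zero with a zero ≟ 0#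
  ... | yes a≈0 = a≈0
  ... | no a≉0  = ⊥-elim (v≉0 (*ₗ-cancel-0 a≉0 (≈ᴹ-trans (≈ᴹ-sym (+ᴹ-identityʳ _)) eq)))

  generated⇒point : ∀ {P v} → ¬ (v ≈ᴹ 0ᴹ) → P GeneratedBy v → IsPoint P
  generated⇒point {P} {v} v≉0 (v∈ , mult) = (λ _ → v) , singleton-independent v≉0 ,
    (λ w∈ → let (a , eq) = mult w∈ in ≈-resp (≈ᴹ-sym eq) (*∈ a (gen (zero , ≈ᴹ-refl)))) ,
    span-least P (λ { (zero , eq) → resp P (≈ᴹ-sym eq) v∈ })

  point-generator : ∀ {P} → IsPoint P → ∃[ v ] ¬ (v ≈ᴹ 0ᴹ) × P GeneratedBy v
  point-generator {P} (b , indep , P⊆ , ⊆P) = b zero ,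
    independent⇒nonzero {b = b} indep zero ,
    ⊆P (gen (zero , ≈ᴹ-refl)) ,
    λ w∈ → let (a , eq) = span⇒lincomb (P⊆ w∈) in a zero , ≈ᴹ-trans eq (+ᴹ-identityʳ _)

  generated-by : ∀ {P v} → IsPoint P → v ∈ El P → ¬ (v ≈ᴹ 0ᴹ) → P GeneratedBy v
  generated-by {P} {v} point v∈ v≉0 =
    let (g , _ , g∈ , mult) = point-generator {P} point
        (a , v≈ag) = mult v∈
        (b , inv) = *ₗ-inverse (*ₗ-nonzero v≉0 v≈ag)
    in v∈ , λ {w} w∈ → let (c , w≈cg) = mult w∈ in c * b , (begin
      w             ≈⟨ w≈cg ⟩
      c *ₗ g        ≈⟨ *ₗ-congˡ (≈ᴹ-trans (inv g) (*ₗ-congˡ (≈ᴹ-sym v≈ag))) ⟩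
      c *ₗ (b *ₗ v) ≈⟨ *ₗ-assoc c b v ⟨
      (c * b) *ₗ v  ∎)

  -- Quotients

  infix 4 _∼_[_]

  _∼_[_] : Carrierᴹ → Carrierᴹ → Subspace → Set ℓ
  v ∼ w [ X ] = ∃[ x ] x ∈ El X × v ≈ᴹ w +ᴹ x

  ≈⇒∼ : ∀ X {v w} → v ≈ᴹ w → v ∼ w [ X ]
  ≈⇒∼ X eq = 0ᴹ , zero∈ X , ≈ᴹ-trans eq (≈ᴹ-sym (+ᴹ-identityʳ _))

  ∈⇒∼0 : ∀ X {v} → v ∈ El X → v ∼ 0ᴹ [ X ]
  ∈⇒∼0 X v∈ = _ , v∈ , ≈ᴹ-sym (+ᴹ-identityˡ _)

  ∼0⇒∈ : ∀ X {v} → v ∼ 0ᴹ [ X ] → v ∈ El X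
  ∼0⇒∈ X (x , x∈ , eq) = resp X (≈ᴹ-sym (≈ᴹ-trans eq (+ᴹ-identityˡ x))) x∈

  ∼-mono : ∀ X Y → X ⊑ Y → ∀ {v w} → v ∼ w [ X ] → v ∼ w [ Y ]
  ∼-mono X Y X⊑Y (x , x∈ , eq) = x , X⊑Y x∈ , eq

  ∼-+ᴹ : ∀ X {v v′ w w′} → v ∼ w [ X ] → v′ ∼ w′ [ X ] → v +ᴹ v′ ∼ w +ᴹ w′ [ X ]
  ∼-+ᴹ X {w = w} {w′} (x , x∈ , eq) (x′ , x′∈ , eq′) =
    x +ᴹ x′ , add∈ X x∈ x′∈ , ≈ᴹ-trans (+ᴹ-cong eq eq′) (interchange w x w′ x′)

  ∼-*ₗ : ∀ X a {v w} → v ∼ w [ X ] → a *ₗ v ∼ a *ₗ w [ X ]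
  ∼-*ₗ X a (x , x∈ , eq) = a *ₗ x , scale∈ X a x∈ , ≈ᴹ-trans (*ₗ-congˡ eq) (*ₗ-distribˡ a _ x)

  ∼-sym : ∀ X {v w} → v ∼ w [ X ] → w ∼ v [ X ]
  ∼-sym X {v} {w} (x , x∈ , eq) = -ᴹ x , neg∈ X x∈ , (begin
    w                ≈⟨ +ᴹ-identityʳ w ⟨
    w +ᴹ 0ᴹ          ≈⟨ +ᴹ-congˡ (-ᴹ‿inverseʳ x) ⟨
    w +ᴹ (x +ᴹ -ᴹ x) ≈⟨ +ᴹ-assoc w x (-ᴹ x) ⟨
    w +ᴹ x +ᴹ -ᴹ x   ≈⟨ +ᴹ-congʳ eq ⟨
    v +ᴹ -ᴹ x        ∎)

  ∼-trans : ∀ X {u v w} → u ∼ v [ X ] → v ∼ w [ X ] → u ∼ w [ X ]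
  ∼-trans X {w = w} (x , x∈ , eq) (y , y∈ , eq′) = y +ᴹ x , add∈ X y∈ x∈ ,
    ≈ᴹ-trans eq (≈ᴹ-trans (+ᴹ-congʳ eq′) (+ᴹ-assoc w y x))

  ∼⇒∈ : ∀ X {v w} → v ∼ w [ X ] → w ∈ El X → v ∈ El X
  ∼⇒∈ X (x , x∈ , eq) w∈ = resp X (≈ᴹ-sym eq) (add∈ X w∈ x∈)

  -- X meets every class of V / Y, so choosing a representative maps vectors to `Fin k`, and vectors
  -- with the same residue are congruent modulo Y. This suffices for counting, without dimension
  -- theory for V / Y.
  module Residues {X Y : Subspace} {k : ℕ} (eX : Enumeration (El X) k)
                  (complement : ∀ v → ∃[ x ] x ∈ El X × v ∼ x [ Y ]) where
    private module X′ = Enumeration eX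

    abstract
      residue : Carrierᴹ → Fin k
      residue v = X′.index (proj₁ (proj₂ (complement v)))

      residue∼ : ∀ v → v ∼ X′.elt (residue v) [ Y ]
      residue∼ v = ∼-trans Y (proj₂ (proj₂ (complement v))) (≈⇒∼ Y (≈ᴹ-sym (X′.elt-index _)))

    residue-injective : ∀ {v w} → residue v ≡ residue w → v ∼ w [ Y ]
    residue-injective {v} {w} eq = ∼-trans Y (residue∼ v)
      (∼-trans Y (≈⇒∼ Y (≈ᴹ-reflexive (≡.cong X′.elt eq))) (∼-sym Y (residue∼ w)))

    residue-index : ∀ {v x} (x∈ : x ∈ El X) → residue v ≡ X′.index x∈ → v ∼ x [ Y ]
    residue-index {v} x∈ eq = ∼-trans Y (residue∼ v)
      (≈⇒∼ Y (≈ᴹ-trans (≈ᴹ-reflexive (≡.cong X′.elt eq)) (X′.elt-index x∈)))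

  -- V / X has the carrier of V with a coarser equality. Every lemma on modules therefore holds for
  -- congruences, with no choice of representatives.
  quotient : Subspace → Module (ring F) ℓ ℓ
  quotient X = record
    { Carrierᴹ = Carrierᴹ
    ; _≈ᴹ_     = λ v w → v ∼ w [ X ]
    ; _+ᴹ_     = _+ᴹ_
    ; _*ₗ_     = _*ₗ_
    ; _*ᵣ_     = _*ᵣ_
    ; 0ᴹ       = 0ᴹ
    ; -ᴹ_      = -ᴹ_
    ; isModule = record
      { isBimodule = record
        { isBisemimodule = record
          { +ᴹ-isCommutativeMonoid = record
            { isMonoid = record
              { isSemigroup = record
                { isMagma = record
                  { isEquivalence = record { refl = lift ≈ᴹ-refl ; sym = ∼-sym X ; trans = ∼-trans X }
                  ; ∙-cong = ∼-+ᴹ X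
                  }
                ; assoc = λ u v w → lift (+ᴹ-assoc u v w)
                }
              ; identity = (λ v → lift (+ᴹ-identityˡ v)) , (λ v → lift (+ᴹ-identityʳ v))
              }
            ; comm = λ v w → lift (+ᴹ-comm v w)
            }
          ; isPreleftSemimodule = record
            { *ₗ-cong      = *-cong
            ; *ₗ-zeroˡ     = λ v → lift (*ₗ-zeroˡ v)
            ; *ₗ-distribʳ  = λ v a b → lift (*ₗ-distribʳ v a b)
            ; *ₗ-identityˡ = λ v → lift (*ₗ-identityˡ v)
            ; *ₗ-assoc     = λ a b v → lift (*ₗ-assoc a b v)
            ; *ₗ-zeroʳ     = λ a → lift (*ₗ-zeroʳ a)
            ; *ₗ-distribˡ  = λ a v w → lift (*ₗ-distribˡ a v w)
            }
          ; isPrerightSemimodule = record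
            { *ᵣ-cong      = λ {v} {w} {a} {b} v∼w a≈b →
                ∼-trans X (lift (≈ᴹ-sym (*ₗ-*ᵣ-coincident a v)))
                  (∼-trans X (*-cong a≈b v∼w) (lift (*ₗ-*ᵣ-coincident b w)))
            ; *ᵣ-zeroʳ     = λ v → lift (*ᵣ-zeroʳ v)
            ; *ᵣ-distribˡ  = λ v a b → lift (*ᵣ-distribˡ v a b)
            ; *ᵣ-identityʳ = λ v → lift (*ᵣ-identityʳ v)
            ; *ᵣ-assoc     = λ v a b → lift (*ᵣ-assoc v a b)
            ; *ᵣ-zeroˡ     = λ a → lift (*ᵣ-zeroˡ a)
            ; *ᵣ-distribʳ  = λ a v w → lift (*ᵣ-distribʳ a v w)
            }
          ; *ₗ-*ᵣ-assoc = λ a v b → lift (*ₗ-*ᵣ-assoc a v b)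
          }
        ; -ᴹ‿cong    = λ {v} {w} v∼w → ∼-trans X (lift (≈ᴹ-sym (-1*ₗ v)))
                         (∼-trans X (∼-*ₗ X (- 1#) v∼w) (lift (-1*ₗ w)))
        ; -ᴹ‿inverse = (λ v → lift (-ᴹ‿inverseˡ v)) , (λ v → lift (-ᴹ‿inverseʳ v))
        }
      ; *ₗ-*ᵣ-coincident = λ a v → lift (*ₗ-*ᵣ-coincident a v)
      }
    }
    where
    lift : ∀ {v w} → v ≈ᴹ w → v ∼ w [ X ]
    lift = ≈⇒∼ X
    *-cong : ∀ {a b v w} → a ≈ b → v ∼ w [ X ] → a *ₗ v ∼ b *ₗ w [ X ]
    *-cong {a} a≈b v∼w = ∼-trans X (∼-*ₗ X a v∼w) (lift (*ₗ-congʳ a≈b))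

  -- Dedekind's lemma

  dedekind : ∀ {k} (χ : Fin k → Carrier → Carrier) →
             (∀ j a b → χ j (a * b) ≈ χ j a * χ j b) → (∀ j → χ j 1# ≈ 1#) →
             (∀ {i j} → i ≢ j → ∃[ b ] ¬ (χ i b ≈ χ j b)) →
             (m : Fin k → Carrierᴹ) → (∀ a → sum (λ j → χ j a *ₗ m j) ≈ᴹ 0ᴹ) → ∀ j → m j ≈ᴹ 0ᴹ
  dedekind {suc k} χ χ-* χ-1 distinct m vanish = λ where
      (suc j) → tail≈0 j
      zero    → begin
        m zero                                                      ≈⟨ *ₗ-identityˡ _ ⟨
        1# *ₗ m zero                                                ≈⟨ *ₗ-congʳ (χ-1 zero) ⟨
        χ zero 1# *ₗ m zero                                         ≈⟨ +ᴹ-identityʳ _ ⟨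
        χ zero 1# *ₗ m zero +ᴹ 0ᴹ                                   ≈⟨ +ᴹ-congˡ (sum-zero λ j →
                                                                         ≈ᴹ-trans (*ₗ-congˡ (tail≈0 j)) (*ₗ-zeroʳ _)) ⟨
        χ zero 1# *ₗ m zero +ᴹ sum (λ j → χ (suc j) 1# *ₗ m (suc j)) ≈⟨ vanish 1# ⟩
        0ᴹ                                                          ∎
    where
    -- The relation at `b * a` minus `χ zero b` times the relation at `a` has no term 0 and
    -- coefficients `(χ j b - χ zero b) *ₗ m j`: a shorter relation of the same kind. Taking `b`
    -- with `χ j b` ≠ `χ zero b` recovers `m j`.
    twisted : Carrier → Fin (suc k) → Carrierᴹ
    twisted b j = (χ j b - χ zero b) *ₗ m j

    term : ∀ a b j → χ j a *ₗ twisted b j ≈ᴹ χ j (b * a) *ₗ m j +ᴹ (- χ zero b) *ₗ (χ j a *ₗ m j)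
    term a b j = begin
      χ j a *ₗ ((χ j b - χ zero b) *ₗ m j)                      ≈⟨ *ₗ-comm _ _ _ ⟩
      (χ j b - χ zero b) *ₗ (χ j a *ₗ m j)                      ≈⟨ *ₗ-distribʳ _ _ _ ⟩
      χ j b *ₗ (χ j a *ₗ m j) +ᴹ (- χ zero b) *ₗ (χ j a *ₗ m j) ≈⟨ +ᴹ-congʳ (*ₗ-assoc _ _ _) ⟨
      (χ j b * χ j a) *ₗ m j +ᴹ (- χ zero b) *ₗ (χ j a *ₗ m j)  ≈⟨ +ᴹ-congʳ (*ₗ-congʳ (χ-* j b a)) ⟨
      χ j (b * a) *ₗ m j +ᴹ (- χ zero b) *ₗ (χ j a *ₗ m j)      ∎

    twisted-vanish : ∀ b a → sum (λ j → χ (suc j) a *ₗ twisted b (suc j)) ≈ᴹ 0ᴹ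
    twisted-vanish b a = begin
      S                                ≈⟨ +ᴹ-identityˡ _ ⟨
      0ᴹ +ᴹ S                          ≈⟨ +ᴹ-congʳ head≈0 ⟨
      sum (λ j → χ j a *ₗ twisted b j) ≈⟨ sum-cong-≋ (term a b) ⟩
      sum (λ j → χ j (b * a) *ₗ m j +ᴹ (- χ zero b) *ₗ (χ j a *ₗ m j))
        ≈⟨ ∑-distrib-+ (λ j → χ j (b * a) *ₗ m j) (λ j → (- χ zero b) *ₗ (χ j a *ₗ m j)) ⟩
      sum (λ j → χ j (b * a) *ₗ m j) +ᴹ sum (λ j → (- χ zero b) *ₗ (χ j a *ₗ m j))
        ≈⟨ +ᴹ-cong (vanish (b * a)) (≈ᴹ-sym (*ₗ-sum (- χ zero b) (λ j → χ j a *ₗ m j))) ⟩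
      0ᴹ +ᴹ (- χ zero b) *ₗ sum (λ j → χ j a *ₗ m j)
        ≈⟨ ≈ᴹ-trans (+ᴹ-identityˡ _) (≈ᴹ-trans (*ₗ-congˡ (vanish a)) (*ₗ-zeroʳ _)) ⟩
      0ᴹ                               ∎
      where
      S = sum (λ j → χ (suc j) a *ₗ twisted b (suc j))
      head≈0 : χ zero a *ₗ twisted b zero ≈ᴹ 0ᴹ
      head≈0 = ≈ᴹ-trans (*ₗ-congˡ (≈ᴹ-trans (*ₗ-congʳ (F.-‿inverseʳ _)) (*ₗ-zeroˡ _))) (*ₗ-zeroʳ _)

    tail≈0 : ∀ j → m (suc j) ≈ᴹ 0ᴹ
    tail≈0 j =
      let (b , χ≉) = distinct {suc j} {zero} λ ()
      in *ₗ-cancel-0 (λ eq → χ≉ (GroupProperties.x∙y⁻¹≈ε⇒x≈y F.+-group _ _ eq))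
           (dedekind (χ ∘ suc) (χ-* ∘ suc) (χ-1 ∘ suc) (λ i≢j → distinct (i≢j ∘ Finₚ.suc-injective))
                     (twisted b ∘ suc) (twisted-vanish b) j)

module Frame {ℓ} (K F : HeytingField ℓ ℓ ℓ) {ι : HeytingField.Carrier K → HeytingField.Carrier F}
             (ι-mono : IsSubfield K F ι) (V : Module (ring F) ℓ ℓ) {q t : ℕ}
             (K-order : HasOrder K q) (F-order : HasOrder F (q ℕ.^ t)) where
  module K = CommutativeRing (ring K)
  module F = CommutativeRing (ring F)
  module ι = RingMorphisms.IsRingMonomorphism ι-mono
  module FinK = FiniteField K K-order
  module FinF = FiniteField F F-order
  open F using (_≈_; _+_; _*_; -_; _-_; 0#; 1#)
  open Module V
  open Geometry K F ι-mono V
  open Subspace using () renaming (≈-resp to resp; 0∈ to zero∈; +∈ to add∈; *∈ to scale∈)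
  open LinearAlgebra F F-order V
  module LK = LinearAlgebra K K-order (restrictScalars K F ι-mono V)
  module ≈ᴹ-Reasoning = SetoidReasoning ≈ᴹ-setoid

  module V/ (X : Subspace) = Module (quotient X)
  module L/ (X : Subspace) = LinearAlgebra F F-order (quotient X)
  module ∼-Reasoning (X : Subspace) = SetoidReasoning (V/.≈ᴹ-setoid X)

  sum-shift : ∀ k (g : ℕ → Carrierᴹ) → sum {k} (λ j → g (1 ℕ.+ toℕ j)) +ᴹ g 0 ≈ᴹ sum {k} (λ j → g (toℕ j)) +ᴹ g k
  sum-shift zero    g = ≈ᴹ-refl
  sum-shift (suc k) g = begin
    (g 1 +ᴹ sum {k} (λ j → g (2 ℕ.+ toℕ j))) +ᴹ g 0 ≈⟨ +ᴹ-comm _ _ ⟩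
    g 0 +ᴹ (g 1 +ᴹ sum {k} (λ j → g (2 ℕ.+ toℕ j))) ≈⟨ +ᴹ-congˡ (+ᴹ-comm _ _) ⟩
    g 0 +ᴹ (sum {k} (λ j → g (2 ℕ.+ toℕ j)) +ᴹ g 1) ≈⟨ +ᴹ-congˡ (sum-shift k (λ j → g (1 ℕ.+ j))) ⟩
    g 0 +ᴹ (sum {k} (λ j → g (1 ℕ.+ toℕ j)) +ᴹ g (suc k)) ≈⟨ +ᴹ-assoc _ _ _ ⟨
    g 0 +ᴹ sum {k} (λ j → g (1 ℕ.+ toℕ j)) +ᴹ g (suc k)   ∎
    where open ≈ᴹ-Reasoning

  cyclic-sum : ∀ k (g : ℕ → Carrierᴹ) → g k ≈ᴹ g 0 → sum {k} (λ j → g (1 ℕ.+ toℕ j)) ≈ᴹ sum {k} (λ j → g (toℕ j))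
  cyclic-sum k g gk≈g0 = GroupProperties.∙-cancelʳ +ᴹ-group (g 0) _ _
    (≈ᴹ-trans (sum-shift k g) (+ᴹ-congˡ gk≈g0))

  -- The collineation and the 𝔽_q-space fixed by its normalisation

  module Collineations {k : ℕ} (1<k : 1 < k) (0<t : 0 < t) (Ψ : Collineation) (Ψ-order : HasCollineationOrder Ψ t)
                       (U₀ : 𝔽q.Subspace) (subgeometry : IsSubgeometry k U₀ (Fix Ψ)) where
    open Collineation Ψ using (σ; to-iso; σ-iso; semilinear) renaming (to to ψ)
    module ψ = GroupMorphisms.IsGroupIsomorphism to-iso
    module σ = RingMorphisms.IsRingIsomorphism σ-iso

    e : Fin k → Carrierᴹ
    e = proj₁ (proj₁ subgeometry)

    e-independent : LinearlyIndependent e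
    e-independent = proj₁ (proj₁ (proj₂ (proj₁ subgeometry)))

    e-spans : ∀ v → v ∈ El (⟨⟩-family e)
    e-spans v = proj₁ (proj₂ (proj₁ (proj₂ (proj₁ subgeometry)))) tt

    whole-dim : HasDim whole k
    whole-dim = e , proj₁ (proj₂ (proj₁ subgeometry))

    U₀⊆⟨e⟩ : ∀ {u} → u ∈ 𝔽q.El U₀ → u ∈ 𝔽q.El (𝔽q.⟨⟩-family e)
    U₀⊆⟨e⟩ = proj₁ (proj₂ (proj₂ (proj₁ subgeometry)))

    ⟨e⟩⊆U₀ : ∀ {u} → u ∈ 𝔽q.El (𝔽q.⟨⟩-family e) → u ∈ 𝔽q.El U₀
    ⟨e⟩⊆U₀ = proj₂ (proj₂ (proj₂ (proj₁ subgeometry)))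

    Fix⊆L : ∀ P → P ∈ Fix Ψ → P ∈ L[ U₀ ]
    Fix⊆L P = proj₁ (proj₂ subgeometry) {P}

    L⊆Fix : ∀ P → P ∈ L[ U₀ ] → P ∈ Fix Ψ
    L⊆Fix P = proj₂ (proj₂ subgeometry) {P}

    module U₀ = 𝔽q.Subspace U₀

    infix 4 _≟ᴹ_
    _≟ᴹ_ : ∀ v w → Dec (v ≈ᴹ w)
    v ≟ᴹ w = ≈-dec (basis-enumeration {whole} whole-dim) {v} {w} tt tt

    U₀-dim : 𝔽q.HasDim U₀ k
    U₀-dim = e , (λ a eq i → ι.injective (F.trans (e-independent (ι ∘ a) eq i) (F.sym ι.0#-homo))) ,
             U₀⊆⟨e⟩ , ⟨e⟩⊆U₀

    e∈U₀ : ∀ i → e i ∈ 𝔽q.El U₀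
    e∈U₀ i = ⟨e⟩⊆U₀ (𝔽q.gen (i , ≈ᴹ-refl))

    -- Test vectors: the point of `e i` + a `e j` determines a, so the effect of a semilinear map on
    -- such points reveals its effect on scalars.
    pair : Fin k → Fin k → F.Carrier → F.Carrier → Carrierᴹ
    pair i j a b = a *ₗ e i +ᴹ b *ₗ e j

    coeffs : Fin k → Fin k → F.Carrier → F.Carrier → Fin k → F.Carrier
    coeffs i j a b l = a * δ i l + b * δ j l

    lincomb-coeffs : ∀ i j a b → lincomb (coeffs i j a b) e ≈ᴹ pair i j a b
    lincomb-coeffs i j a b = ≈ᴹ-trans (lincomb-+ (λ l → a * δ i l) (λ l → b * δ j l) e)
      (+ᴹ-cong (≈ᴹ-trans (≈ᴹ-sym (lincomb-* a (δ i) e)) (*ₗ-congˡ (lincomb-δ i e)))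
               (≈ᴹ-trans (≈ᴹ-sym (lincomb-* b (δ j) e)) (*ₗ-congˡ (lincomb-δ j e))))

    pair-coordinates : ∀ {i j a b c} → i ≢ j → pair i j a b ≈ᴹ lincomb c e → a ≈ c i × b ≈ c j
    pair-coordinates {i} {j} {a} {b} {c} i≢j eq =
      F.trans (F.sym at-i) (coeffs≈ i) , F.trans (F.sym at-j) (coeffs≈ j)
      where
      coeffs≈ : ∀ l → coeffs i j a b l ≈ c l
      coeffs≈ = lincomb-unique e-independent (≈ᴹ-trans (lincomb-coeffs i j a b) eq)
      at-i : coeffs i j a b i ≈ a
      at-i = F.trans (F.+-cong (F.trans (F.*-congˡ (δ-diag i)) (F.*-identityʳ a))
                               (F.trans (F.*-congˡ (δ-off i≢j)) (F.zeroʳ b))) (F.+-identityʳ a)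
      at-j : coeffs i j a b j ≈ b
      at-j = F.trans (F.+-cong (F.trans (F.*-congˡ (δ-off (i≢j ∘ ≡.sym))) (F.zeroʳ a))
                               (F.trans (F.*-congˡ (δ-diag j)) (F.*-identityʳ b))) (F.+-identityˡ b)

    pair-injective : ∀ {i j a b a′ b′} → i ≢ j → pair i j a b ≈ᴹ pair i j a′ b′ → a ≈ a′ × b ≈ b′
    pair-injective {i} {j} {a} {b} {a′} {b′} i≢j eq =
      let (a≈ , b≈)   = pair-coordinates i≢j (≈ᴹ-trans eq (≈ᴹ-sym (lincomb-coeffs i j a′ b′)))
          (a′≈ , b′≈) = pair-coordinates i≢j (≈ᴹ-sym (lincomb-coeffs i j a′ b′))
      in F.trans a≈ (F.sym a′≈) , F.trans b≈ (F.sym b′≈)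

    pair-nonzero : ∀ {i j a} → i ≢ j → ¬ (pair i j 1# a ≈ᴹ 0ᴹ)
    pair-nonzero {i} {j} i≢j eq = FinF.1≉0 (proj₁ (pair-injective i≢j (≈ᴹ-trans eq (≈ᴹ-sym
      (≈ᴹ-trans (+ᴹ-cong (*ₗ-zeroˡ (e i)) (*ₗ-zeroˡ (e j))) (+ᴹ-identityˡ 0ᴹ))))))

    pair∈U₀ : ∀ i j a b → pair i j (ι a) (ι b) ∈ 𝔽q.El U₀
    pair∈U₀ i j a b = U₀.+∈ (U₀.*∈ a (e∈U₀ i)) (U₀.*∈ b (e∈U₀ j))

    *ₗ-pair : ∀ {i j} c a b → c *ₗ pair i j a b ≈ᴹ pair i j (c * a) (c * b)
    *ₗ-pair c a b = ≈ᴹ-trans (*ₗ-distribˡ c _ _) (≈ᴹ-sym (+ᴹ-cong (*ₗ-assoc c a _) (*ₗ-assoc c b _)))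

    i₀ i₁ : Fin k
    i₀ = fromℕ< (ℕₚ.<-trans (s≤s z≤n) 1<k)
    i₁ = fromℕ< 1<k

    i₀≢i₁ : i₀ ≢ i₁
    i₀≢i₁ eq with () ← ≡.trans (≡.sym (Finₚ.toℕ-fromℕ< (ℕₚ.<-trans (s≤s z≤n) 1<k)))
                         (≡.trans (≡.cong toℕ eq) (Finₚ.toℕ-fromℕ< 1<k))

    e-nonzero : ∀ i → ¬ (e i ≈ᴹ 0ᴹ)
    e-nonzero = independent⇒nonzero e-independent

    -- Ψ fixes the points of the subgeometry, hence acts on U₀ as a scalar.

    eigenvalue : ∀ {u} → u ∈ 𝔽q.El U₀ → ¬ (u ≈ᴹ 0ᴹ) → ∃[ μ ] ψ u ≈ᴹ μ *ₗ u
    eigenvalue {u} u∈ u≉0 = ⟨⟩-elim (proj₁ (proj₂ (L⊆Fix ⟨ u ≈ᴹ_ ⟩ (u , u∈ , u≉0 , (λ w → w) , (λ w → w))))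
                              (u , gen ≈ᴹ-refl , ≈ᴹ-refl))

    λ₀ : F.Carrier
    λ₀ = proj₁ (eigenvalue (e∈U₀ i₀) (e-nonzero i₀))

    ψ-e₀ : ψ (e i₀) ≈ᴹ λ₀ *ₗ e i₀
    ψ-e₀ = proj₂ (eigenvalue (e∈U₀ i₀) (e-nonzero i₀))

    λ₀≉0 : ¬ (λ₀ ≈ 0#)
    λ₀≉0 eq = e-nonzero i₀ (ψ.injective (≈ᴹ-trans ψ-e₀ (≈ᴹ-trans (*ₗ-congʳ eq)
      (≈ᴹ-trans (*ₗ-zeroˡ _) (≈ᴹ-sym ψ.ε-homo)))))

    ψ-pair : ∀ {i j a b μ ν} → ψ (e i) ≈ᴹ μ *ₗ e i → ψ (e j) ≈ᴹ ν *ₗ e j →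
             ψ (pair i j a b) ≈ᴹ pair i j (σ a * μ) (σ b * ν)
    ψ-pair {i} {j} {a} {b} {μ} {ν} eqᵢ eqⱼ = ≈ᴹ-trans (ψ.∙-homo _ _) (+ᴹ-cong (term a μ eqᵢ) (term b ν eqⱼ))
      where
      term : ∀ c μ {l} → ψ (e l) ≈ᴹ μ *ₗ e l → ψ (c *ₗ e l) ≈ᴹ (σ c * μ) *ₗ e l
      term c μ eq = ≈ᴹ-trans (semilinear c _) (≈ᴹ-trans (*ₗ-congˡ eq) (≈ᴹ-sym (*ₗ-assoc _ _ _)))

    -- The vector `e i₀` + c `e j` lies in `U₀`, hence is an eigenvector of Ψ. Its `e i₀`-coordinate
    -- shows that the eigenvalue is `λ₀`; the `e j`-coordinate is the claim. The case c = 1 gives ν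
    -- = `λ₀`, and then σ fixes `K`.
    σι*λ : ∀ {j ν} → i₀ ≢ j → ψ (e j) ≈ᴹ ν *ₗ e j → ∀ c → σ (ι c) * ν ≈ λ₀ * ι c
    σι*λ {j} {ν} i₀≢j eqⱼ c =
      let (μ , eq) = eigenvalue (pair∈U₀ i₀ j K.1# c)
                       (λ z → pair-nonzero i₀≢j (≈ᴹ-trans (+ᴹ-congʳ (*ₗ-congʳ (F.sym ι.1#-homo))) z))
          (eq₀ , eq₁) = pair-injective i₀≢j (≈ᴹ-trans (≈ᴹ-sym (ψ-pair ψ-e₀ eqⱼ)) (≈ᴹ-trans eq (*ₗ-pair μ _ _)))
          λ₀≈μ = F.trans (F.sym (F.*-identityˡ _)) (F.trans (F.*-congʳ (F.sym (F.trans (σ.⟦⟧-cong ι.1#-homo) σ.1#-homo)))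
                   (F.trans eq₀ (F.trans (F.*-congˡ ι.1#-homo) (F.*-identityʳ μ))))
      in F.trans eq₁ (F.*-congʳ (F.sym λ₀≈μ))

    ψ-e : ∀ j → ψ (e j) ≈ᴹ λ₀ *ₗ e j
    ψ-e j with i₀ Finₚ.≟ j
    ... | yes ≡.refl = ψ-e₀
    ... | no i₀≢j = let (ν , eq) = eigenvalue (e∈U₀ j) (e-nonzero j) in
      ≈ᴹ-trans eq (*ₗ-congʳ (F.trans (F.sym (F.*-identityˡ ν))
        (F.trans (F.*-congʳ (F.sym (F.trans (σ.⟦⟧-cong ι.1#-homo) σ.1#-homo)))
        (F.trans (σι*λ i₀≢j eq K.1#) (F.trans (F.*-congˡ ι.1#-homo) (F.*-identityʳ λ₀))))))

    *-cancelʳ : ∀ {a b c} → ¬ (c ≈ 0#) → a * c ≈ b * c → a ≈ b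
    *-cancelʳ {a} {b} {c} c≉0 eq = let (d , dc≈1) = FinF.inverse c≉0 in
      F.trans (F.sym (cancel a d dc≈1)) (F.trans (F.*-congʳ eq) (cancel b d dc≈1))
      where
      cancel : ∀ x d → d * c ≈ 1# → (x * c) * d ≈ x
      cancel x d dc≈1 = F.trans (F.*-assoc x c d) (F.trans (F.*-congˡ (F.trans (F.*-comm c d) dc≈1)) (F.*-identityʳ x))

    σι : ∀ c → σ (ι c) ≈ ι c
    σι c = *-cancelʳ λ₀≉0 (F.trans (σι*λ i₀≢i₁ (ψ-e i₁) c) (F.*-comm λ₀ (ι c)))

    -- φ = λ₀⁻¹ Ψ induces the same collineation and fixes U₀ pointwise.

    λ₀⁻¹ : F.Carrier
    λ₀⁻¹ = proj₁ (FinF.inverse λ₀≉0)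

    φ : Carrierᴹ → Carrierᴹ
    φ v = λ₀⁻¹ *ₗ ψ v

    φ-cong : ∀ {v w} → v ≈ᴹ w → φ v ≈ᴹ φ w
    φ-cong eq = *ₗ-congˡ (ψ.⟦⟧-cong eq)

    φ-+ : ∀ v w → φ (v +ᴹ w) ≈ᴹ φ v +ᴹ φ w
    φ-+ v w = ≈ᴹ-trans (*ₗ-congˡ (ψ.∙-homo v w)) (*ₗ-distribˡ _ _ _)

    φ-* : ∀ a v → φ (a *ₗ v) ≈ᴹ σ a *ₗ φ v
    φ-* a v = ≈ᴹ-trans (*ₗ-congˡ (semilinear a v)) (*ₗ-comm _ _ _)

    φ-e : ∀ i → φ (e i) ≈ᴹ e i
    φ-e i = ≈ᴹ-trans (*ₗ-congˡ (ψ-e i)) (≈ᴹ-trans (≈ᴹ-sym (*ₗ-assoc _ _ _))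
      (≈ᴹ-trans (*ₗ-congʳ (proj₂ (FinF.inverse λ₀≉0))) (*ₗ-identityˡ _)))

    -- Ψ and φ differ by the scalar `λ₀`, which is σ of some `c`; multiplying by `c` inside X
    -- absorbs it.
    image⇒φ : ∀ X {w} → w ∈ El (image Ψ X) → ∃[ v ] v ∈ El X × φ v ≈ᴹ w
    image⇒φ X {w} (v , v∈ , ψv≈w) = let (c , σ-c) = σ.surjective λ₀ in
      c *ₗ v , scale∈ X c v∈ , (begin
        φ (c *ₗ v)            ≈⟨ φ-* c v ⟩
        σ c *ₗ (λ₀⁻¹ *ₗ ψ v)  ≈⟨ *ₗ-congʳ (σ-c F.refl) ⟩
        λ₀ *ₗ (λ₀⁻¹ *ₗ ψ v)   ≈⟨ *ₗ-assoc _ _ _ ⟨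
        (λ₀ * λ₀⁻¹) *ₗ ψ v    ≈⟨ *ₗ-congʳ (F.trans (F.*-comm _ _) (proj₂ (FinF.inverse λ₀≉0))) ⟩
        1# *ₗ ψ v             ≈⟨ *ₗ-identityˡ _ ⟩
        ψ v                   ≈⟨ ψv≈w ⟩
        w                     ∎)
      where open ≈ᴹ-Reasoning

    φ⇒image : ∀ X {v w} → v ∈ El X → φ v ≈ᴹ w → w ∈ El (image Ψ X)
    φ⇒image X v∈ eq = resp (image Ψ X) eq (scale∈ (image Ψ X) λ₀⁻¹ (_ , v∈ , ≈ᴹ-refl))

    φ^ : ℕ → Carrierᴹ → Carrierᴹ
    φ^ j v = fold v φ j

    σ^ : ℕ → F.Carrier → F.Carrier
    σ^ j a = fold a σ j

    φ^-cong : ∀ j {v w} → v ≈ᴹ w → φ^ j v ≈ᴹ φ^ j w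
    φ^-cong zero    eq = eq
    φ^-cong (suc j) eq = φ-cong (φ^-cong j eq)

    φ^-+ : ∀ j v w → φ^ j (v +ᴹ w) ≈ᴹ φ^ j v +ᴹ φ^ j w
    φ^-+ zero    v w = ≈ᴹ-refl
    φ^-+ (suc j) v w = ≈ᴹ-trans (φ-cong (φ^-+ j v w)) (φ-+ _ _)

    φ^-* : ∀ j a v → φ^ j (a *ₗ v) ≈ᴹ σ^ j a *ₗ φ^ j v
    φ^-* zero    a v = ≈ᴹ-refl
    φ^-* (suc j) a v = ≈ᴹ-trans (φ-cong (φ^-* j a v)) (φ-* _ _)

    φ^-add : ∀ i j v → φ^ (i ℕ.+ j) v ≈ᴹ φ^ i (φ^ j v)
    φ^-add zero    j v = ≈ᴹ-refl
    φ^-add (suc i) j v = φ-cong (φ^-add i j v)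

    σ^-cong : ∀ j {a b} → a ≈ b → σ^ j a ≈ σ^ j b
    σ^-cong zero    eq = eq
    σ^-cong (suc j) eq = σ.⟦⟧-cong (σ^-cong j eq)

    σ^-* : ∀ j a b → σ^ j (a * b) ≈ σ^ j a * σ^ j b
    σ^-* zero    a b = F.refl
    σ^-* (suc j) a b = F.trans (σ.⟦⟧-cong (σ^-* j a b)) (σ.*-homo _ _)

    σ^-1 : ∀ j → σ^ j 1# ≈ 1#
    σ^-1 zero    = F.refl
    σ^-1 (suc j) = F.trans (σ.⟦⟧-cong (σ^-1 j)) σ.1#-homo

    σ^-0 : ∀ j → σ^ j 0# ≈ 0#
    σ^-0 zero    = F.refl
    σ^-0 (suc j) = F.trans (σ.⟦⟧-cong (σ^-0 j)) σ.0#-homo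

    σ^-injective : ∀ j {a b} → σ^ j a ≈ σ^ j b → a ≈ b
    σ^-injective zero    eq = eq
    σ^-injective (suc j) eq = σ^-injective j (σ.injective eq)

    σ^-add : ∀ i j a → σ^ (i ℕ.+ j) a ≡ σ^ i (σ^ j a)
    σ^-add zero    j a = ≡.refl
    σ^-add (suc i) j a = ≡.cong σ (σ^-add i j a)

    φ^-0 : ∀ j → φ^ j 0ᴹ ≈ᴹ 0ᴹ
    φ^-0 j = ≈ᴹ-trans (φ^-cong j (≈ᴹ-sym (*ₗ-zeroˡ 0ᴹ)))
      (≈ᴹ-trans (φ^-* j 0# 0ᴹ) (≈ᴹ-trans (*ₗ-congʳ (σ^-0 j)) (*ₗ-zeroˡ _)))

    φ^-sum : ∀ j {l} (f : Fin l → Carrierᴹ) → φ^ j (sum f) ≈ᴹ sum (λ i → φ^ j (f i))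
    φ^-sum j {zero}  f = φ^-0 j
    φ^-sum j {suc l} f = ≈ᴹ-trans (φ^-+ j _ _) (+ᴹ-congˡ (φ^-sum j (f ∘ suc)))

    φ^-e : ∀ j i → φ^ j (e i) ≈ᴹ e i
    φ^-e zero    i = ≈ᴹ-refl
    φ^-e (suc j) i = ≈ᴹ-trans (φ-cong (φ^-e j i)) (φ-e i)

    φ^-lincomb : ∀ j a → φ^ j (lincomb a e) ≈ᴹ lincomb (σ^ j ∘ a) e
    φ^-lincomb j a = ≈ᴹ-trans (φ^-sum j (λ i → a i *ₗ e i))
      (sum-cong-≋ (λ i → ≈ᴹ-trans (φ^-* j (a i) (e i)) (*ₗ-congˡ (φ^-e j i))))

    φ^-coordinates : ∀ j a → φ^ j (lincomb a e) ≈ᴹ lincomb a e → ∀ i → σ^ j (a i) ≈ a i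
    φ^-coordinates j a eq = lincomb-unique e-independent (≈ᴹ-trans (≈ᴹ-sym (φ^-lincomb j a)) eq)

    φ^-id : ∀ j → (∀ a → σ^ j a ≈ a) → ∀ v → φ^ j v ≈ᴹ v
    φ^-id j σ^≈id v = let (a , v≈) = span⇒lincomb (e-spans v) in
      ≈ᴹ-trans (φ^-cong j v≈) (≈ᴹ-trans (φ^-lincomb j a)
        (≈ᴹ-trans (lincomb-congʳ e (λ i → σ^≈id (a i))) (≈ᴹ-sym v≈)))

    conjugate⇒φ^ : ∀ X j {w} → w ∈ El (fold X (image Ψ) j) → ∃[ v ] v ∈ El X × φ^ j v ≈ᴹ w
    conjugate⇒φ^ X zero    w∈ = _ , w∈ , ≈ᴹ-refl
    conjugate⇒φ^ X (suc j) w∈ =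
      let (u , u∈ , φu≈w) = image⇒φ (fold X (image Ψ) j) w∈
          (v , v∈ , eq) = conjugate⇒φ^ X j u∈
      in v , v∈ , ≈ᴹ-trans (φ-cong eq) φu≈w

    φ^⇒conjugate : ∀ X j {v w} → v ∈ El X → φ^ j v ≈ᴹ w → w ∈ El (fold X (image Ψ) j)
    φ^⇒conjugate X zero    v∈ eq = resp X eq v∈
    φ^⇒conjugate X (suc j) v∈ eq = φ⇒image (fold X (image Ψ) j) (φ^⇒conjugate X j v∈ ≈ᴹ-refl) eq

    φ^-pair : ∀ j a → φ^ j (pair i₀ i₁ 1# a) ≈ᴹ pair i₀ i₁ 1# (σ^ j a)
    φ^-pair j a = ≈ᴹ-trans (φ^-+ j _ _) (+ᴹ-cong
      (≈ᴹ-trans (φ^-* j 1# _) (≈ᴹ-trans (*ₗ-congʳ (σ^-1 j)) (*ₗ-congˡ (φ^-e j i₀))))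
      (≈ᴹ-trans (φ^-* j a _) (*ₗ-congˡ (φ^-e j i₁))))

    -- The order of Ψ is known only on points. Since φ^t fixes the point of `e i₀` + a `e i₁`, it
    -- multiplies this vector by a scalar; the first coordinate makes the scalar 1, and the second
    -- gives the equation. So φ^t is the identity on vectors.
    σ^t : ∀ a → σ^ t a ≈ a
    σ^t a =
      let v = pair i₀ i₁ 1# a
          P = ⟨ v ≈ᴹ_ ⟩
          point = generated⇒point {P} (pair-nonzero i₀≢i₁) ⟨⟩-generated
          (c , eq) = ⟨⟩-elim (proj₁ (proj₁ Ψ-order P point) (φ^⇒conjugate P t (gen ≈ᴹ-refl) (φ^-pair t a)))
          (1≈c , σa≈ca) = pair-injective i₀≢i₁ (≈ᴹ-trans eq (*ₗ-pair c 1# a))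
      in F.trans σa≈ca (F.trans (F.*-congʳ (F.trans (F.sym (F.*-identityʳ c)) (F.sym 1≈c))) (F.*-identityˡ a))

    φ^t : ∀ v → φ^ t v ≈ᴹ v
    φ^t = φ^-id t σ^t

    -- If σ^j were the identity, φ^j would be as well, and Ψ^j would fix every point.
    σ^-nontrivial : ∀ j → 0 < j → j < t → ∃[ a ] ¬ (σ^ j a ≈ a)
    σ^-nontrivial j 0<j j<t
      with FinF.search {P = λ a → σ^ j a ≈ a} (λ eq p → F.trans (σ^-cong j (F.sym eq)) (F.trans p eq))
                       (λ a → σ^ j a FinF.≟ a)
    ... | inj₂ found = found
    ... | inj₁ σ^≈id = ⊥-elim (proj₂ Ψ-order j 0<j j<t λ P _ →
          (λ w∈ → let (v , v∈ , eq) = conjugate⇒φ^ P j w∈ in resp P (≈ᴹ-trans (≈ᴹ-sym (φ^-id j σ^≈id v)) eq) v∈) ,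
          (λ v∈ → φ^⇒conjugate P j v∈ (φ^-id j σ^≈id _)))

    σ^-distinct-< : ∀ {i j} → i < j → j < t → ∃[ a ] ¬ (σ^ j a ≈ σ^ i a)
    σ^-distinct-< {i} {j} i<j j<t =
      let (a , ≉) = σ^-nontrivial (j ℕ.∸ i) (ℕₚ.m<n⇒0<n∸m i<j) (ℕₚ.≤-<-trans (ℕₚ.m∸n≤m j i) j<t)
      in a , λ eq → ≉ (σ^-injective i (F.trans (F.reflexive (≡.trans (≡.sym (σ^-add i (j ℕ.∸ i) a))
           (≡.cong (λ l → σ^ l a) (ℕₚ.m+[n∸m]≡n (ℕₚ.<⇒≤ i<j))))) eq))

    χ : Fin t → F.Carrier → F.Carrier
    χ j = σ^ (toℕ j)

    χ-distinct : ∀ {i j} → i ≢ j → ∃[ a ] ¬ (χ i a ≈ χ j a)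
    χ-distinct {i} {j} i≢j with ℕₚ.<-cmp (toℕ i) (toℕ j)
    ... | tri< i<j _ _ = let (a , ≉) = σ^-distinct-< i<j (Finₚ.toℕ<n j) in a , ≉ ∘ F.sym
    ... | tri≈ _ i≡j _ = ⊥-elim (i≢j (Finₚ.toℕ-injective i≡j))
    ... | tri> _ _ j<i = σ^-distinct-< j<i (Finₚ.toℕ<n i)

    -- Fixed vectors

    σ-fixed⇒K : ∀ {a} → σ a ≈ a → ∃[ c ] ι c ≈ a
    σ-fixed⇒K {a} σa≈a = k₀⁻¹ K.* b i₁ ,
      F.trans (ι.*-homo k₀⁻¹ (b i₁)) (F.trans (F.*-congʳ (F.sym c≈)) (F.sym (proj₂ 1,a≈)))
      where
      -- As `a` is fixed by σ, so is `v` by φ, and its point lies in `L[ U₀ ]`: `v` = c u with the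
      -- coordinates of u in `K`. The coordinate 1 puts c in `K`, and then the other coordinate puts
      -- `a` there.
      v = pair i₀ i₁ 1# a
      φv≈v : φ v ≈ᴹ v
      φv≈v = ≈ᴹ-trans (φ^-pair 1 a) (+ᴹ-congˡ (*ₗ-congʳ σa≈a))
      P = ⟨ v ≈ᴹ_ ⟩
      fixed : image Ψ P ≋ P
      fixed = (λ w∈ → let (x , x∈ , φx≈w) = image⇒φ P w∈ ; (d , x≈dv) = ⟨⟩-elim x∈ in
                  ⟨⟩-intro (σ d) (≈ᴹ-trans (≈ᴹ-sym φx≈w)
                    (≈ᴹ-trans (φ-cong x≈dv) (≈ᴹ-trans (φ-* d v) (*ₗ-congˡ φv≈v))))) ,
              span-least (image Ψ P) (λ v≈w → φ⇒image P (gen ≈ᴹ-refl) (≈ᴹ-trans φv≈v v≈w))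
      inL : P ∈ L[ U₀ ]
      inL = Fix⊆L P (generated⇒point {P} (pair-nonzero i₀≢i₁) ⟨⟩-generated , fixed)
      u = proj₁ inL
      multiple : ∃[ c ] v ≈ᴹ c *ₗ u
      multiple = ⟨⟩-elim (proj₁ (proj₂ (proj₂ (proj₂ inL))) (gen ≈ᴹ-refl))
      c = proj₁ multiple
      coordinates : ∃[ b ] u ≈ᴹ LK.lincomb b e
      coordinates = LK.span⇒lincomb (U₀⊆⟨e⟩ (proj₁ (proj₂ inL)))
      b = proj₁ coordinates
      1,a≈ : 1# ≈ c * ι (b i₀) × a ≈ c * ι (b i₁)
      1,a≈ = pair-coordinates i₀≢i₁ (≈ᴹ-trans (proj₂ multiple)
        (≈ᴹ-trans (*ₗ-congˡ (proj₂ coordinates)) (lincomb-* c (ι ∘ b) e)))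
      1≈ = proj₁ 1,a≈
      k₀≉0 : ¬ (b i₀ K.≈ K.0#)
      k₀≉0 eq = FinF.1≉0 (F.trans 1≈ (F.trans (F.*-congˡ (F.trans (ι.⟦⟧-cong eq) ι.0#-homo)) (F.zeroʳ c)))
      k₀⁻¹ = proj₁ (FinK.inverse k₀≉0)
      c≈ : c ≈ ι k₀⁻¹
      c≈ = *-cancelʳ {c = ι (b i₀)} (λ eq → k₀≉0 (ι.injective (F.trans eq (F.sym ι.0#-homo))))
             (F.trans (F.sym 1≈) (F.trans (F.sym ι.1#-homo)
               (F.trans (ι.⟦⟧-cong (K.sym (proj₂ (FinK.inverse k₀≉0)))) (ι.*-homo _ _))))

    coordinates∈K⇒U₀ : ∀ a → (∀ i → ∃[ c ] ι c ≈ a i) → lincomb a e ∈ 𝔽q.El U₀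
    coordinates∈K⇒U₀ a a∈K = U₀.≈-resp (lincomb-congʳ e (λ i → proj₂ (a∈K i)))
      (⟨e⟩⊆U₀ (LK.lincomb⇒span (λ i → proj₁ (a∈K i)) e))

    φ-fixed⇒U₀ : ∀ {v} → φ v ≈ᴹ v → v ∈ 𝔽q.El U₀
    φ-fixed⇒U₀ φv≈v =
      let (a , v≈) = span⇒lincomb (e-spans _)
      in U₀.≈-resp (≈ᴹ-sym v≈) (coordinates∈K⇒U₀ a (λ i → σ-fixed⇒K
           (φ^-coordinates 1 a (≈ᴹ-trans (φ-cong (≈ᴹ-sym v≈)) (≈ᴹ-trans φv≈v v≈)) i)))

    φ-fixes-U₀ : ∀ {u} → u ∈ 𝔽q.El U₀ → φ u ≈ᴹ u
    φ-fixes-U₀ u∈ =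
      let (c , u≈) = LK.span⇒lincomb (U₀⊆⟨e⟩ u∈)
      in ≈ᴹ-trans (φ-cong u≈) (≈ᴹ-trans (φ^-lincomb 1 (ι ∘ c))
           (≈ᴹ-trans (lincomb-congʳ e (λ i → σι (c i))) (≈ᴹ-sym u≈)))

    trace : Carrierᴹ → Carrierᴹ
    trace v = sum {t} (λ j → φ^ (toℕ j) v)

    -- Because φ^t is the identity, φ permutes the summands of the trace cyclically.
    trace∈U₀ : ∀ v → trace v ∈ 𝔽q.El U₀
    trace∈U₀ v = φ-fixed⇒U₀ (≈ᴹ-trans (φ^-sum 1 {t} (λ j → φ^ (toℕ j) v)) (cyclic-sum t (λ j → φ^ j v) (φ^t v)))

    trace-* : ∀ a v → trace (a *ₗ v) ≈ᴹ sum (λ j → χ j a *ₗ φ^ (toℕ j) v)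
    trace-* a v = sum-cong-≋ {t} (λ j → φ^-* (toℕ j) a v)

    -- The trace of every multiple of `v` lies in A ∩ `U₀` = 0. Read as a relation between the
    -- distinct characters `χ j` with coefficients `φ^ j v`, this makes all conjugates vanish by
    -- Dedekind's lemma.
    trivial-core : ∀ A → (∀ {u} → u ∈ 𝔽q.El U₀ → u ∈ El A → u ≈ᴹ 0ᴹ) →
                   ∀ {v} → (∀ (j : Fin t) → φ^ (toℕ j) v ∈ El A) → v ≈ᴹ 0ᴹ
    trivial-core A A∩U₀ {v} v∈ = ≡.subst (λ j → φ^ j v ≈ᴹ 0ᴹ) (Finₚ.toℕ-fromℕ< 0<t)
      (dedekind χ (λ j → σ^-* (toℕ j)) (λ j → σ^-1 (toℕ j)) χ-distinct (λ j → φ^ (toℕ j) v)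
        (λ a → ≈ᴹ-trans (≈ᴹ-sym (trace-* a v)) (A∩U₀ (trace∈U₀ (a *ₗ v))
          (resp A (≈ᴹ-sym (trace-* a v)) (sum∈ A (λ j → scale∈ A (χ j a) (v∈ j))))))
        (fromℕ< 0<t))

    φ^-neg : ∀ j v → φ^ j (-ᴹ v) ≈ᴹ -ᴹ φ^ j v
    φ^-neg j v = neg-unique _ _ (≈ᴹ-trans (≈ᴹ-sym (φ^-+ j (-ᴹ v) v)) (≈ᴹ-trans (φ^-cong j (-ᴹ‿inverseˡ v)) (φ^-0 j)))

    trivial-core-injective : ∀ A → (∀ {u} → u ∈ 𝔽q.El U₀ → u ∈ El A → u ≈ᴹ 0ᴹ) →
                             ∀ {v w} → (∀ (j : Fin t) → φ^ (toℕ j) v ∼ φ^ (toℕ j) w [ A ]) → v ≈ᴹ w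
    trivial-core-injective A A∩U₀ {v} {w} v∼w = x-y≈0⇒x≈y v w (trivial-core A A∩U₀ λ j →
      resp A (≈ᴹ-sym (≈ᴹ-trans (φ^-+ (toℕ j) v (-ᴹ w)) (+ᴹ-congˡ (φ^-neg (toℕ j) w))))
        (∼0⇒∈ A (L/.x≈y⇒x-y≈0 A (v∼w j))))

    φ^-multiple : ∀ d v → φ^ (d ℕ.* t) v ≈ᴹ v
    φ^-multiple zero    v = ≈ᴹ-refl
    φ^-multiple (suc d) v = ≈ᴹ-trans (φ^-add t (d ℕ.* t) v) (≈ᴹ-trans (φ^t _) (φ^-multiple d v))

    φ^-% : .{{_ : ℕ.NonZero t}} → ∀ j v → φ^ j v ≈ᴹ φ^ (j % t) v
    φ^-% j v = ≈ᴹ-trans (≈ᴹ-reflexive (≡.cong (λ l → φ^ l v) (m≡m%n+[m/n]*n j t)))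
      (≈ᴹ-trans (φ^-add (j % t) (j / t ℕ.* t) v) (φ^-cong (j % t) (φ^-multiple (j / t) v)))

  module Configuration {n : ℕ} (2≤n : 2 ≤ n) (3≤t : 3 ≤ t) where

    Q : ℕ
    Q = q ℕ.^ t

    0<t : 0 < t
    0<t = ℕₚ.<-≤-trans (s≤s z≤n) 3≤t

    2≤t : 2 ≤ t
    2≤t = ℕₚ.<⇒≤ 3≤t

    1<tn : 1 < t ℕ.* n
    1<tn = ℕₚ.≤-trans (s≤s (s≤s z≤n)) (ℕₚ.*-mono-≤ 2≤t 2≤n)

    -- With n ≥ 2 one line is too few to carry all nonzero vectors. The second line is needed to
    -- compare companions.
    two-lines : 1 < q → ∀ {N} → N ℕ.* (Q ℕ.∸ 1) ≡ q ℕ.^ (t ℕ.* n) ℕ.∸ 1 → 1 < N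
    two-lines 1<q {N} eq = ℕₚ.≰⇒> λ N≤1 → ℕₚ.<⇒≱ Q-1<
        (≡.subst (ℕ._≤ Q ℕ.∸ 1) eq (ℕₚ.≤-trans (ℕₚ.*-monoˡ-≤ (Q ℕ.∸ 1) N≤1) (ℕₚ.≤-reflexive (ℕₚ.*-identityˡ _))))
      where
      t<tn : t < t ℕ.* n
      t<tn = ≡.subst (ℕ._< t ℕ.* n) (ℕₚ.*-identityʳ t) (ℕₚ.*-monoʳ-< t {{ℕ.>-nonZero 0<t}} 2≤n)
      Q-1< : Q ℕ.∸ 1 < q ℕ.^ (t ℕ.* n) ℕ.∸ 1
      Q-1< = ℕₚ.∸-monoˡ-< (ℕₚ.^-monoʳ-< q 1<q t<tn) (ℕₚ.m^n>0 q {{ℕ.>-nonZero (ℕₚ.<-trans (s≤s z≤n) 1<q)}} t)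

    -- The linear set as a projection of the subgeometry

    module Pseudoregulus
      (Λ : Subspace) (Ψ : Collineation) (Ψ-order : HasCollineationOrder Ψ t)
      (U₀ : 𝔽q.Subspace) (subgeometry : IsSubgeometry (t ℕ.* n) U₀ (Fix Ψ))
      (U : 𝔽q.Subspace) {N : ℕ} (s : Fin N → Subspace) (pseudoregulus : IsPseudoregulus q n t Λ U s)
      (Γ : Subspace) (Γ-dim : HasDim Γ (n ℕ.* (t ℕ.∸ 2))) (Γ⊥Fix : PG Γ ⊥ Fix Ψ) (Γ⊥Λ : PG Γ ⊥ PG Λ)
      (L≐p : L[ U ] ≐ projection Γ Λ (Fix Ψ)) where

      open Collineations 1<tn 0<t Ψ Ψ-order U₀ subgeometry
      open IsPseudoregulus pseudoregulus
      module U = 𝔽q.Subspace U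

      ⟨⟩-point : ∀ {v} → ¬ (v ≈ᴹ 0ᴹ) → IsPoint ⟨ v ≈ᴹ_ ⟩
      ⟨⟩-point v≉0 = generated⇒point {⟨ _ ≈ᴹ_ ⟩} v≉0 ⟨⟩-generated

      ⟨⟩-⊑ : ∀ X {v} → v ∈ El X → ⟨ v ≈ᴹ_ ⟩ ⊑ X
      ⟨⟩-⊑ X v∈ = span-least X (λ v≈w → resp X v≈w v∈)

      ⟨⟩∈L : ∀ {U u} → u ∈ 𝔽q.El U → ¬ (u ≈ᴹ 0ᴹ) → ⟨ u ≈ᴹ_ ⟩ ∈ L[ U ]
      ⟨⟩∈L u∈ u≉0 = _ , u∈ , u≉0 , (λ w → w) , (λ w → w)

      disjoint⇒0 : ∀ {p} {P : Pred Subspace p} X → PG X ⊥ P → ∀ {v} → v ∈ El X →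
                   (¬ (v ≈ᴹ 0ᴹ) → ⟨ v ≈ᴹ_ ⟩ ∈ P) → v ≈ᴹ 0ᴹ
      disjoint⇒0 X X⊥P {v} v∈ v∈P with v ≟ᴹ 0ᴹ
      ... | yes v≈0 = v≈0
      ... | no v≉0  = ⊥-elim (X⊥P {⟨ v ≈ᴹ_ ⟩} ((⟨⟩-point v≉0 , ⟨⟩-⊑ X v∈) , v∈P v≉0))

      Γ∩Λ : ∀ {v} → v ∈ El Γ → v ∈ El Λ → v ≈ᴹ 0ᴹ
      Γ∩Λ v∈Γ v∈Λ = disjoint⇒0 Γ (λ {P} → Γ⊥Λ {P}) v∈Γ (λ v≉0 → ⟨⟩-point v≉0 , ⟨⟩-⊑ Λ v∈Λ)

      Γ∩U₀ : ∀ {v} → v ∈ El Γ → v ∈ 𝔽q.El U₀ → v ≈ᴹ 0ᴹ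
      Γ∩U₀ {v} v∈Γ v∈U₀ = disjoint⇒0 Γ (λ {P} → Γ⊥Fix {P}) v∈Γ (λ v≉0 → L⊆Fix ⟨ v ≈ᴹ_ ⟩ (⟨⟩∈L {U₀} v∈U₀ v≉0))

      -- The equality of point sets yields a vector of `U` only up to a scalar `a`. It is nonzero,
      -- since otherwise `w` would lie in Γ ∩ Λ = 0.
      project : ∀ {u} → u ∈ 𝔽q.El U₀ → ¬ (u ≈ᴹ 0ᴹ) →
                ∃[ w ] w ∈ 𝔽q.El U × ¬ (w ≈ᴹ 0ᴹ) × ∃[ a ] ¬ (a ≈ 0#) × w ∼ a *ₗ u [ Γ ]
      project {u} u∈ u≉0 =
        let P = ⟨ u ≈ᴹ_ ⟩
            (w , w∈ , w≉0 , _ , w∈X) = proj₂ L≐p {(Γ ⊔ P) ⊓ Λ} (P , L⊆Fix P (⟨⟩∈L {U₀} u∈ u≉0) , (λ v → v) , (λ v → v))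
            (γ , z , γ∈ , z∈ , w≈γ+z) = ⊔-elim {Γ} {P} (proj₁ (w∈X (gen ≈ᴹ-refl)))
            (a , z≈au) = ⟨⟩-elim z∈
            w∼au = γ , γ∈ , ≈ᴹ-trans w≈γ+z (≈ᴹ-trans (+ᴹ-comm γ z) (+ᴹ-congʳ z≈au))
        in w , w∈ , w≉0 , a ,
           (λ a≈0 → w≉0 (Γ∩Λ (∼⇒∈ Γ w∼au (resp Γ (≈ᴹ-sym (≈ᴹ-trans (*ₗ-congʳ a≈0) (*ₗ-zeroˡ u))) (zero∈ Γ))) (U⊆Λ w∈))) ,
           w∼au

      lift : ∀ {w} → w ∈ 𝔽q.El U → ¬ (w ≈ᴹ 0ᴹ) →
             ∃[ u ] u ∈ 𝔽q.El U₀ × ¬ (u ≈ᴹ 0ᴹ) × ∃[ a ] ¬ (a ≈ 0#) × w ∼ a *ₗ u [ Γ ]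
      lift {w} w∈ w≉0 =
        let (P , P∈Fix , w∈X , _) = proj₁ L≐p {⟨ w ≈ᴹ_ ⟩} (⟨⟩∈L {U} w∈ w≉0)
            (u , u∈ , u≉0 , P⊆⟨u⟩ , _) = Fix⊆L P P∈Fix
            (γ , z , γ∈ , z∈ , w≈γ+z) = ⊔-elim {Γ} {P} (proj₁ (w∈X (gen ≈ᴹ-refl)))
            (a , z≈au) = ⟨⟩-elim (P⊆⟨u⟩ z∈)
            w∼au = γ , γ∈ , ≈ᴹ-trans w≈γ+z (≈ᴹ-trans (+ᴹ-comm γ z) (+ᴹ-congʳ z≈au))
        in u , u∈ , u≉0 , a ,
           (λ a≈0 → w≉0 (Γ∩Λ (∼⇒∈ Γ w∼au (resp Γ (≈ᴹ-sym (≈ᴹ-trans (*ₗ-congʳ a≈0) (*ₗ-zeroˡ u))) (zero∈ Γ))) (U⊆Λ w∈))) ,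
           w∼au

      -- The N disjoint lines together carry all q^(tn) ∸ 1 nonzero vectors of U.

      U-enumeration : Enumeration (𝔽q.El U) (q ℕ.^ (t ℕ.* n))
      U-enumeration = LK.basis-enumeration {U} rank

      U₀-enumeration : Enumeration (𝔽q.El U₀) (q ℕ.^ (t ℕ.* n))
      U₀-enumeration = LK.basis-enumeration {U₀} U₀-dim

      U⁰ : Enumeration (λ v → v ∈ 𝔽q.El U × ¬ (v ≈ᴹ 0ᴹ)) (q ℕ.^ (t ℕ.* n) ℕ.∸ 1)
      U⁰ = remove U-enumeration U.0∈

      U₀⁰ : Enumeration (λ v → v ∈ 𝔽q.El U₀ × ¬ (v ≈ᴹ 0ᴹ)) (q ℕ.^ (t ℕ.* n) ℕ.∸ 1)
      U₀⁰ = remove U₀-enumeration U₀.0∈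

      line⁰ : ∀ i → Enumeration (λ v → v ∈ 𝔽q.El (asK (s i) 𝔽q.⊓ U) × ¬ (v ≈ᴹ 0ᴹ)) (Q ℕ.∸ 1)
      line⁰ i = remove (LK.basis-enumeration {asK (s i) 𝔽q.⊓ U} (weight i)) (zero∈ (s i) , U.0∈)

      count′ : q ℕ.^ (t ℕ.* n) ℕ.∸ 1 ≡ N ℕ.* (Q ℕ.∸ 1)
      count′ = ≡.trans (≡.cong (λ k → q ℕ.^ k ℕ.∸ 1) (ℕₚ.*-comm t n)) (≡.sym count)

      lines-meet⇒≡ : ∀ {i j v} → ¬ (v ≈ᴹ 0ᴹ) → v ∈ El (s i) → v ∈ El (s j) → i ≡ j
      lines-meet⇒≡ {i} {j} {v} v≉0 v∈i v∈j with i Finₚ.≟ j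
      ... | yes i≡j = i≡j
      ... | no i≢j  = ⊥-elim (disjoint i≢j {⟨ v ≈ᴹ_ ⟩}
                        ((⟨⟩-point v≉0 , ⟨⟩-⊑ (s i) v∈i) , (⟨⟩-point v≉0 , ⟨⟩-⊑ (s j) v∈j)))

      U-covered : ∀ {w} → w ∈ 𝔽q.El U → ¬ (w ≈ᴹ 0ᴹ) → ∃[ i ] w ∈ El (s i)
      U-covered {w} w∈ w≉0 =
        let (i , a , eq) = injective⇒covers₂ (enumeration-resize count′ U⁰) (λ i → L.elt i)
                             (λ i a → let ((_ , ∈U) , ≉0) = L.elt∈ i a in ∈U , ≉0) inj (w∈ , w≉0)
        in i , resp (s i) eq (proj₁ (proj₁ (L.elt∈ i a)))
        where
        module L i = Enumeration (line⁰ i)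
        inj : ∀ {i a j b} → L.elt i a ≈ᴹ L.elt j b → i ≡ j × a ≡ b
        inj {i} {a} {j} {b} eq
          with lines-meet⇒≡ (proj₂ (L.elt∈ i a)) (proj₁ (proj₁ (L.elt∈ i a)))
                 (resp (s j) (≈ᴹ-sym eq) (proj₁ (proj₁ (L.elt∈ j b))))
        ... | ≡.refl = ≡.refl , L.elt-injective i eq

      S : Fin N → Subspace
      S i = Γ ⊔ s i

      U₀-covered : ∀ {u} → u ∈ 𝔽q.El U₀ → ¬ (u ≈ᴹ 0ᴹ) → ∃[ i ] u ∈ El (S i)
      U₀-covered u∈ u≉0 =
        let (w , w∈ , w≉0 , a , a≉0 , w∼au) = project u∈ u≉0
            (i , w∈si) = U-covered w∈ w≉0
        in i , unscale∈ (S i) a≉0 (∼⇒∈ (S i) (∼-mono Γ (S i) (⊔-introˡ Γ (s i)) (∼-sym Γ w∼au)) (⊔-introʳ Γ (s i) w∈si))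

      -- A nonzero vector of `U` on each line. The line also meets a transversal T, so modulo Γ ⊔ T
      -- it consists of the multiples of `x i`.
      x : Fin N → Carrierᴹ
      x i = proj₁ (weight i) (fromℕ< 0<t)

      x∈ : ∀ i → x i ∈ 𝔽q.El (asK (s i) 𝔽q.⊓ U)
      x∈ i = proj₂ (proj₂ (proj₂ (weight i))) (𝔽q.gen (fromℕ< 0<t , ≈ᴹ-refl))

      x≉0 : ∀ i → ¬ (x i ≈ᴹ 0ᴹ)
      x≉0 i = LK.independent⇒nonzero (proj₁ (proj₂ (weight i))) (fromℕ< 0<t)

      -- The quotient of V by the join of Γ and a transversal

      module Transversal (T : Subspace) (transversal : IsTransversal n Λ U s T) where
        T⊑Λ : T ⊑ Λ
        T⊑Λ = proj₁ transversal

        T-dim : HasDim T n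
        T-dim = proj₁ (proj₂ transversal)

        A : Subspace
        A = Γ ⊔ T

        Γ⊑A : Γ ⊑ A
        Γ⊑A = ⊔-introˡ Γ T

        T⊑A : T ⊑ A
        T⊑A = ⊔-introʳ Γ T

        U∩T : ∀ {w} → w ∈ 𝔽q.El U → w ∈ El T → w ≈ᴹ 0ᴹ
        U∩T w∈U w∈T = disjoint⇒0 T (λ {P} → proj₁ (proj₂ (proj₂ transversal)) {P}) w∈T (⟨⟩∈L {U} w∈U)

        A∩Λ⊑T : ∀ {v} → v ∈ El A → v ∈ El Λ → v ∈ El T
        A∩Λ⊑T {v} v∈A v∈Λ =
          let (γ , τ , γ∈ , τ∈ , v≈γ+τ) = ⊔-elim {Γ} {T} v∈A
              (γ≈0 , _) = sum-unique Γ∩Λ (resp Γ) {x = γ} {x′ = 0ᴹ} {y = τ} {y′ = v}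
                (sub∈ Γ γ∈ (zero∈ Γ)) (sub∈ Λ v∈Λ (T⊑Λ τ∈)) (≈ᴹ-trans (≈ᴹ-sym v≈γ+τ) (≈ᴹ-sym (+ᴹ-identityˡ v)))
          in resp T (≈ᴹ-sym (≈ᴹ-trans v≈γ+τ (≈ᴹ-trans (+ᴹ-congʳ γ≈0) (+ᴹ-identityˡ τ)))) τ∈

        U∩A : ∀ {w} → w ∈ 𝔽q.El U → w ∈ El A → w ≈ᴹ 0ᴹ
        U∩A w∈U w∈A = U∩T w∈U (A∩Λ⊑T w∈A (U⊆Λ w∈U))

        -- A nonzero `u` in A would project to a nonzero vector of `U` in A; the unknown scalar does
        -- no harm, as A is an `F`-subspace.
        U₀∩A : ∀ {u} → u ∈ 𝔽q.El U₀ → u ∈ El A → u ≈ᴹ 0ᴹ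
        U₀∩A {u} u∈ u∈A with u ≟ᴹ 0ᴹ
        ... | yes u≈0 = u≈0
        ... | no u≉0  = let (w , w∈ , w≉0 , a , _ , w∼au) = project u∈ u≉0 in
          ⊥-elim (w≉0 (U∩A w∈ (∼⇒∈ A (∼-mono Γ A Γ⊑A w∼au) (scale∈ A a u∈A))))

        infix 4 _∼ᴬ_
        _∼ᴬ_ : Carrierᴹ → Carrierᴹ → Set ℓ
        v ∼ᴬ w = v ∼ w [ A ]

        A-enumeration : Enumeration (El A) (Q ℕ.^ (n ℕ.* (t ℕ.∸ 2)) ℕ.* Q ℕ.^ n)
        A-enumeration = ⊔-enumeration Γ T (λ v∈Γ v∈T → Γ∩Λ v∈Γ (T⊑Λ v∈T))
                          (basis-enumeration {Γ} Γ-dim) (basis-enumeration {T} T-dim)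

        -- A and `U₀` meet trivially, and by `complement-count` the sums of their elements are as
        -- many as the vectors of V.
        represent : ∀ v → ∃[ u ] u ∈ 𝔽q.El U₀ × v ∼ᴬ u
        represent v =
          let (i , j , eq) = injective⇒covers₂
                (enumeration-resize (≡.sym (complement-count q n 2≤t)) (basis-enumeration {whole} whole-dim))
                (λ i j → A′.elt i +ᴹ U′.elt j) (λ _ _ → tt) inj {v} tt
          in U′.elt j , U′.elt∈ j , A′.elt i , A′.elt∈ i , ≈ᴹ-trans (≈ᴹ-sym eq) (+ᴹ-comm _ _)
          where
          module A′ = Enumeration A-enumeration
          module U′ = Enumeration U₀-enumeration
          inj : ∀ {i j i′ j′} → A′.elt i +ᴹ U′.elt j ≈ᴹ A′.elt i′ +ᴹ U′.elt j′ → i ≡ i′ × j ≡ j′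
          inj {i} {j} {i′} {j′} eq =
            let (a≈ , u≈) = sum-unique (λ v∈A v∈U₀ → U₀∩A v∈U₀ v∈A) (resp A)
                              (sub∈ A (A′.elt∈ i) (A′.elt∈ i′)) (LK.sub∈ U₀ (U′.elt∈ j′) (U′.elt∈ j)) eq
            in A′.elt-injective a≈ , U′.elt-injective u≈

        U₀-unique : ∀ {u u′} → u ∈ 𝔽q.El U₀ → u′ ∈ 𝔽q.El U₀ → u ∼ᴬ u′ → u ≈ᴹ u′
        U₀-unique {u} {u′} u∈ u′∈ (α , α∈ , eq) = proj₁ (sum-unique (λ v∈U₀ v∈A → U₀∩A v∈U₀ v∈A) U₀.≈-resp
          {x = u} {x′ = u′} {y = 0ᴹ} {y′ = α} (LK.sub∈ U₀ u∈ u′∈) (sub∈ A α∈ (zero∈ A))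
          (≈ᴹ-trans (+ᴹ-identityʳ u) eq))

        ∼0⇒≈0 : ∀ {u} → u ∈ 𝔽q.El U₀ → u ∼ᴬ 0ᴹ → u ≈ᴹ 0ᴹ
        ∼0⇒≈0 u∈ u∼0 = U₀-unique u∈ U₀.0∈ u∼0

        x≁0 : ∀ i → ¬ (x i ∼ᴬ 0ᴹ)
        x≁0 i x∼0 = x≉0 i (U∩A (proj₂ (x∈ i)) (∼0⇒∈ A x∼0))

        -- The point `p` where the line meets T and `x i` form a basis of the line, and `p` vanishes
        -- modulo A.
        line-multiple : ∀ {i v} → v ∈ El (s i) → ∃[ c ] v ∼ᴬ c *ₗ x i
        line-multiple {i} {v} v∈ =
          let (a , eq) = independent⇒spans {s i} (proj₁ (lines i)) {c = c} independent
                           (λ { zero → p∈s ; (suc zero) → proj₁ (x∈ i) }) v∈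
          in a (suc zero) , a zero *ₗ p , scale∈ A (a zero) (T⊑A p∈T) , ≈ᴹ-trans eq
               (≈ᴹ-trans (+ᴹ-congˡ (+ᴹ-identityʳ _)) (+ᴹ-comm _ _))
          where
          P = proj₁ (proj₂ (proj₂ (proj₂ transversal)) i)
          P∈ = proj₂ (proj₂ (proj₂ (proj₂ transversal)) i)
          generator = point-generator {P} (proj₁ (proj₁ P∈))
          p = proj₁ generator
          p≉0 = proj₁ (proj₂ generator)
          p∈T : p ∈ El T
          p∈T = proj₂ (proj₁ P∈) (proj₁ (proj₂ (proj₂ generator)))
          p∈s : p ∈ El (s i)
          p∈s = proj₂ (proj₂ P∈) (proj₁ (proj₂ (proj₂ generator)))
          c : Fin 2 → Carrierᴹ
          c zero       = p
          c (suc zero) = x i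
          independent : LinearlyIndependent c
          independent a eq = λ { zero → a₀≈0 ; (suc zero) → a₁≈0 }
            where
            a₁≈0 : a (suc zero) ≈ 0#
            a₁≈0 = L/.*ₗ-injectiveʳ A (x≁0 i) (begin
              a (suc zero) *ₗ x i                           ≈⟨ ∈⇒∼0 A (scale∈ A (a zero) (T⊑A p∈T)) ⟨+⟩ V/.≈ᴹ-refl A ⟨
              a zero *ₗ p +ᴹ a (suc zero) *ₗ x i            ≈⟨ ≈⇒∼ A (+ᴹ-congˡ (+ᴹ-identityʳ _)) ⟨
              a zero *ₗ p +ᴹ (a (suc zero) *ₗ x i +ᴹ 0ᴹ)    ≈⟨ ≈⇒∼ A eq ⟩
              0ᴹ                                            ≈⟨ V/.*ₗ-zeroˡ A (x i) ⟨
              0# *ₗ x i                                     ∎)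
              where
              open ∼-Reasoning A
              _⟨+⟩_ : ∀ {v w w′} → v ∼ᴬ 0ᴹ → w ∼ᴬ w′ → v +ᴹ w ∼ᴬ w′
              v∼0 ⟨+⟩ w∼ = V/.≈ᴹ-trans A (V/.+ᴹ-cong A v∼0 w∼) (V/.+ᴹ-identityˡ A _)
            a₀≈0 : a zero ≈ 0#
            a₀≈0 = *ₗ-injectiveʳ p≉0 (≈ᴹ-trans (≈ᴹ-sym (+ᴹ-identityʳ _)) (≈ᴹ-trans (+ᴹ-congˡ (≈ᴹ-sym
              (≈ᴹ-trans (+ᴹ-identityʳ _) (≈ᴹ-trans (*ₗ-congʳ a₁≈0) (*ₗ-zeroˡ _)))))
              (≈ᴹ-trans eq (≈ᴹ-sym (*ₗ-zeroˡ p)))))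

        multiple : ∀ {i v} → v ∈ El (S i) → ∃[ c ] v ∼ᴬ c *ₗ x i
        multiple {i} v∈ =
          let (γ , w , γ∈ , w∈ , v≈γ+w) = ⊔-elim {Γ} {s i} v∈
              (c , w∼cx) = line-multiple w∈
          in c , V/.≈ᴹ-trans A (≈⇒∼ A v≈γ+w) (V/.≈ᴹ-trans A (V/.+ᴹ-cong A (∈⇒∼0 A (Γ⊑A γ∈)) w∼cx) (V/.+ᴹ-identityˡ A _))

        nonzero-multiple : ∀ {i u} → u ∈ 𝔽q.El U₀ → ¬ (u ≈ᴹ 0ᴹ) → u ∈ El (S i) →
                           ∃[ c ] ¬ (c ≈ 0#) × u ∼ᴬ c *ₗ x i
        nonzero-multiple u∈ u≉0 u∈S = let (c , u∼cx) = multiple u∈S in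
          c , L/.*ₗ-nonzero A (u≉0 ∘ ∼0⇒≈0 u∈) u∼cx , u∼cx

        -- V / A has N (q^t ∸ 1) nonzero vectors, and the multiples of the x i reach all of them.
        multiples-distinct : ∀ {i j a b} → ¬ (a ≈ 0#) → ¬ (b ≈ 0#) → a *ₗ x i ∼ᴬ b *ₗ x j → i ≡ j
        multiples-distinct {i} {j} {a} {b} a≉0 b≉0 eq = proj₁ (covers⇒injective₂ (enumeration-resize count′ U₀⁰)
            g g∈ covers {i} {E.index a≉0} {j} {E.index b≉0} (U₀-unique (proj₁ (g∈ _ _)) (proj₁ (g∈ _ _)) (begin
              g i (E.index a≉0)             ≈⟨ g∼ i _ ⟩
              E.elt (E.index a≉0) *ₗ x i    ≈⟨ V/.*ₗ-congʳ A (E.elt-index a≉0) ⟩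
              a *ₗ x i                      ≈⟨ eq ⟩
              b *ₗ x j                      ≈⟨ V/.*ₗ-congʳ A (E.elt-index b≉0) ⟨
              E.elt (E.index b≉0) *ₗ x j    ≈⟨ g∼ j _ ⟨
              g j (E.index b≉0)             ∎)))
          where
          open ∼-Reasoning A
          module E = Counting.Enumeration FinF.units
          g : Fin N → Fin (Q ℕ.∸ 1) → Carrierᴹ
          g i a = proj₁ (represent (E.elt a *ₗ x i))
          g∼ : ∀ i a → g i a ∼ᴬ E.elt a *ₗ x i
          g∼ i a = V/.≈ᴹ-sym A (proj₂ (proj₂ (represent (E.elt a *ₗ x i))))
          g∈ : ∀ i a → g i a ∈ 𝔽q.El U₀ × ¬ (g i a ≈ᴹ 0ᴹ)
          g∈ i a = proj₁ (proj₂ (represent (E.elt a *ₗ x i))) , λ g≈0 →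
            x≁0 i (L/.*ₗ-cancel-0 A (E.elt∈ a) (V/.≈ᴹ-trans A (V/.≈ᴹ-sym A (g∼ i a)) (≈⇒∼ A g≈0)))
          covers : ∀ {u} → u ∈ 𝔽q.El U₀ × ¬ (u ≈ᴹ 0ᴹ) → ∃₂ λ i a → g i a ≈ᴹ u
          covers {u} (u∈ , u≉0) =
            let (i , u∈S) = U₀-covered u∈ u≉0
                (c , c≉0 , u∼cx) = nonzero-multiple u∈ u≉0 u∈S
            in i , E.index c≉0 , U₀-unique (proj₁ (g∈ i _)) u∈ (begin
              g i (E.index c≉0)          ≈⟨ g∼ i _ ⟩
              E.elt (E.index c≉0) *ₗ x i ≈⟨ V/.*ₗ-congʳ A (E.elt-index c≉0) ⟩
              c *ₗ x i                   ≈⟨ u∼cx ⟨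
              u                          ∎)

        -- The representative of `x i` in `U₀` lies in some `S j`. It is then congruent to a
        -- multiple of `x j` as well, which forces i = j.
        line-vector : ∀ i → ∃[ u ] u ∈ 𝔽q.El U₀ × ¬ (u ≈ᴹ 0ᴹ) × u ∈ El (S i) × u ∼ᴬ x i
        line-vector i =
          let (u , u∈ , x∼u) = represent (x i)
              u≉0 u≈0 = x≁0 i (V/.≈ᴹ-trans A x∼u (≈⇒∼ A u≈0))
              (j , u∈S) = U₀-covered u∈ u≉0
              (c , c≉0 , u∼cx) = nonzero-multiple u∈ u≉0 u∈S
              i≡j = multiples-distinct FinF.1≉0 c≉0 (V/.≈ᴹ-trans A (V/.*ₗ-identityˡ A (x i)) (V/.≈ᴹ-trans A x∼u u∼cx))
          in u , u∈ , u≉0 , ≡.subst (λ k → u ∈ El (S k)) (≡.sym i≡j) u∈S , V/.≈ᴹ-sym A x∼u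

        S-disjoint : ∀ {i j u} → u ∈ 𝔽q.El U₀ → ¬ (u ≈ᴹ 0ᴹ) → u ∈ El (S i) → u ∈ El (S j) → i ≡ j
        S-disjoint u∈ u≉0 u∈Si u∈Sj =
          let (a , a≉0 , u∼ax) = nonzero-multiple u∈ u≉0 u∈Si
              (b , b≉0 , u∼bx) = nonzero-multiple u∈ u≉0 u∈Sj
          in multiples-distinct a≉0 b≉0 (V/.≈ᴹ-trans A (V/.≈ᴹ-sym A u∼ax) u∼bx)

        -- With `S-closed`: under the identification of `U₀` with V / A, the sets `S i` ∩ `U₀` are
        -- the one-dimensional subspaces. As `S i` does not involve T, the actions obtained from
        -- both transversals have the same ones.
        S-ratio : ∀ {i u u′} → u ∈ 𝔽q.El U₀ → ¬ (u ≈ᴹ 0ᴹ) → u ∈ El (S i) → u′ ∈ El (S i) →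
                  ∃[ a ] u′ ∼ᴬ a *ₗ u
        S-ratio {i} {u} {u′} u∈ u≉0 u∈S u′∈S =
          let (b , b≉0 , u∼bx) = nonzero-multiple u∈ u≉0 u∈S
              (c , u′∼cx) = multiple u′∈S
              (d , inv) = L/.*ₗ-inverse A b≉0
          in c * d , (begin
            u′                    ≈⟨ u′∼cx ⟩
            c *ₗ x i              ≈⟨ V/.*ₗ-congˡ A (inv (x i)) ⟩
            c *ₗ (d *ₗ (b *ₗ x i)) ≈⟨ V/.*ₗ-congˡ A (V/.*ₗ-congˡ A u∼bx) ⟨
            c *ₗ (d *ₗ u)         ≈⟨ V/.*ₗ-assoc A c d u ⟨
            (c * d) *ₗ u          ∎)
          where open ∼-Reasoning A

        S-closed : ∀ {i u u′ a} → u ∈ 𝔽q.El U₀ → u ∈ El (S i) → u′ ∈ 𝔽q.El U₀ →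
                   u′ ∼ᴬ a *ₗ u → u′ ∈ El (S i)
        S-closed {i} {u} {u′} {a} u∈ u∈S u′∈ u′∼au = by-cases (u′ ≟ᴹ 0ᴹ)
          where
          same-line : ¬ (u′ ≈ᴹ 0ᴹ) → ∀ {j} → u′ ∈ El (S j) → i ≡ j
          same-line u′≉0 u′∈Sj =
            let (b , b≉0 , u′∼bx) = nonzero-multiple u′∈ u′≉0 u′∈Sj
                (c , u∼cx) = multiple u∈S
                ac∼ : (a * c) *ₗ x i ∼ᴬ u′
                ac∼ = V/.≈ᴹ-trans A (V/.*ₗ-assoc A a c (x i)) (V/.≈ᴹ-trans A (V/.*ₗ-congˡ A (V/.≈ᴹ-sym A u∼cx)) (V/.≈ᴹ-sym A u′∼au))
            in multiples-distinct (L/.*ₗ-nonzero A (u′≉0 ∘ ∼0⇒≈0 u′∈) (V/.≈ᴹ-sym A ac∼)) b≉0 (V/.≈ᴹ-trans A ac∼ u′∼bx)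
          by-cases : Dec (u′ ≈ᴹ 0ᴹ) → u′ ∈ El (S i)
          by-cases (yes u′≈0) = resp (S i) (≈ᴹ-sym u′≈0) (zero∈ (S i))
          by-cases (no u′≉0)  = let (j , u′∈Sj) = U₀-covered u′∈ u′≉0 in
            ≡.subst (λ k → u′ ∈ El (S k)) (≡.sym (same-line u′≉0 u′∈Sj)) u′∈Sj

      T₁ T₂ : Subspace
      T₁ = proj₁ transversals
      T₂ = proj₁ (proj₂ transversals)

      T₁≉T₂ : ¬ (T₁ ≋ T₂)
      T₁≉T₂ = proj₁ (proj₂ (proj₂ (proj₂ (proj₂ transversals))))

      module T₁ = Transversal T₁ (proj₁ (proj₂ (proj₂ transversals)))
      module T₂ = Transversal T₂ (proj₁ (proj₂ (proj₂ (proj₂ transversals))))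

      A₁ A₂ : Subspace
      A₁ = T₁.A
      A₂ = T₂.A

      infix 4 _∼₁_ _∼₂_
      _∼₁_ _∼₂_ : Carrierᴹ → Carrierᴹ → Set ℓ
      v ∼₁ w = v ∼ w [ A₁ ]
      v ∼₂ w = v ∼ w [ A₂ ]

      -- U₀ is a complement of A₁ and of A₂, hence inherits two scalar actions of F; a Companion b of a is a scalar
      -- whose first action is the second action of a.

      Companion : F.Carrier → F.Carrier → Set ℓ
      Companion a b = ∀ {u u′} → u ∈ 𝔽q.El U₀ → u′ ∈ 𝔽q.El U₀ → u′ ∼₂ a *ₗ u → u′ ∼₁ b *ₗ u

      Companion-resp : ∀ {a a′ b b′} → a ≈ a′ → b ≈ b′ → Companion a b → Companion a′ b′
      Companion-resp a≈a′ b≈b′ comp u∈ u′∈ eq =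
        V/.≈ᴹ-trans A₁ (comp u∈ u′∈ (V/.≈ᴹ-trans A₂ eq (V/.*ₗ-congʳ A₂ (F.sym a≈a′)))) (V/.*ₗ-congʳ A₁ b≈b′)

      LocalCompanion : F.Carrier → Carrierᴹ → F.Carrier → Set ℓ
      LocalCompanion a u b = ∃[ u′ ] u′ ∈ 𝔽q.El U₀ × u′ ∼₂ a *ₗ u × u′ ∼₁ b *ₗ u

      -- The second action of `a` keeps `u` within its `S i`, where any two vectors are proportional
      -- for the first action if the reference vector is nonzero.
      localCompanion : ∀ a {u} → u ∈ 𝔽q.El U₀ → ¬ (u ≈ᴹ 0ᴹ) → ∃[ b ] LocalCompanion a u b
      localCompanion a {u} u∈ u≉0 =
        let (u′ , u′∈ , au∼u′) = T₂.represent (a *ₗ u)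
            (i , u∈S) = U₀-covered u∈ u≉0
            u′∼au = V/.≈ᴹ-sym A₂ au∼u′
            (b , u′∼bu) = T₁.S-ratio u∈ u≉0 u∈S (T₂.S-closed u∈ u∈S u′∈ u′∼au)
        in b , u′ , u′∈ , u′∼au , u′∼bu

      independent-mod-A₁ : ∀ {i j u v b c b′ c′} → u ∈ 𝔽q.El U₀ → ¬ (u ≈ᴹ 0ᴹ) → u ∈ El (S i) →
                           v ∈ 𝔽q.El U₀ → ¬ (v ≈ᴹ 0ᴹ) → v ∈ El (S j) → i ≢ j →
                           b *ₗ u +ᴹ c *ₗ v ∼₁ b′ *ₗ u +ᴹ c′ *ₗ v → b ≈ b′ × c ≈ c′
      independent-mod-A₁ {i} {j} {u} {v} {b} {c} {b′} {c′} u∈ u≉0 u∈S v∈ v≉0 v∈S i≢j eq =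
        let (bu∼ , cv∼) = L/.sum-unique A₁ {X = multiple-of u} {Y = multiple-of v} disjoint′
              (λ { y∼z (a , y∼au) → a , V/.≈ᴹ-trans A₁ (V/.≈ᴹ-sym A₁ y∼z) y∼au })
              (b - b′ , V/.≈ᴹ-sym A₁ (L/.*ₗ-sub A₁ b b′ u)) (c′ - c , V/.≈ᴹ-sym A₁ (L/.*ₗ-sub A₁ c′ c v)) eq
        in L/.*ₗ-injectiveʳ A₁ (u≉0 ∘ T₁.∼0⇒≈0 u∈) bu∼ , L/.*ₗ-injectiveʳ A₁ (v≉0 ∘ T₁.∼0⇒≈0 v∈) cv∼
        where
        multiple-of : Carrierᴹ → Pred Carrierᴹ ℓ
        multiple-of w z = ∃[ a ] z ∼₁ a *ₗ w
        disjoint′ : ∀ {z} → z ∈ multiple-of u → z ∈ multiple-of v → z ∼₁ 0ᴹ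
        disjoint′ {z} (a , z∼au) (a′ , z∼a′v) = by-cases (a FinF.≟ 0#)
          where
          by-cases : Dec (a ≈ 0#) → z ∼₁ 0ᴹ
          by-cases (yes a≈0) = V/.≈ᴹ-trans A₁ z∼au (V/.≈ᴹ-trans A₁ (V/.*ₗ-congʳ A₁ a≈0) (V/.*ₗ-zeroˡ A₁ u))
          by-cases (no a≉0)  = ⊥-elim (i≢j (T₁.S-disjoint u∈ u≉0 u∈S (T₁.S-closed {a = d * a′} v∈ v∈S u∈
            (V/.≈ᴹ-trans A₁ (proj₂ (L/.*ₗ-inverse A₁ a≉0) u)
              (V/.≈ᴹ-trans A₁ (V/.*ₗ-congˡ A₁ (V/.≈ᴹ-trans A₁ (V/.≈ᴹ-sym A₁ z∼au) z∼a′v)) (V/.≈ᴹ-sym A₁ (V/.*ₗ-assoc A₁ d a′ v)))))))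
            where d = proj₁ (L/.*ₗ-inverse A₁ a≉0)

      -- The classical reason why an additive map preserving all one-dimensional subspaces is a
      -- scalar: the factor d for `u` + `v` satisfies b u + c v = d u + d v modulo A₁, and `u`, `v`
      -- are independent there.
      localCompanion-agree : ∀ {a i j u v b c} → u ∈ 𝔽q.El U₀ → ¬ (u ≈ᴹ 0ᴹ) → u ∈ El (S i) →
                             v ∈ 𝔽q.El U₀ → ¬ (v ≈ᴹ 0ᴹ) → v ∈ El (S j) → i ≢ j →
                             LocalCompanion a u b → LocalCompanion a v c → b ≈ c
      localCompanion-agree {a} {i} {j} {u} {v} {b} {c} u∈ u≉0 u∈S v∈ v≉0 v∈S i≢j
                           (u′ , u′∈ , u′∼au , u′∼bu) (v′ , v′∈ , v′∼av , v′∼cv) =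
        let (d , w′ , w′∈ , w′∼ , w′∼d) = localCompanion a (U₀.+∈ u∈ v∈) u+v≉0
            w′≈u′+v′ = T₂.U₀-unique w′∈ (U₀.+∈ u′∈ v′∈) (V/.≈ᴹ-trans A₂ w′∼
              (V/.≈ᴹ-trans A₂ (V/.*ₗ-distribˡ A₂ a u v) (V/.≈ᴹ-sym A₂ (V/.+ᴹ-cong A₂ u′∼au v′∼av))))
            (b≈d , c≈d) = independent-mod-A₁ u∈ u≉0 u∈S v∈ v≉0 v∈S i≢j
              (V/.≈ᴹ-trans A₁ (V/.≈ᴹ-sym A₁ (V/.+ᴹ-cong A₁ u′∼bu v′∼cv))
                (V/.≈ᴹ-trans A₁ (≈⇒∼ A₁ (≈ᴹ-sym w′≈u′+v′)) (V/.≈ᴹ-trans A₁ w′∼d (V/.*ₗ-distribˡ A₁ d u v))))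
        in F.trans b≈d (F.sym c≈d)
        where
        u+v≉0 : ¬ (u +ᴹ v ≈ᴹ 0ᴹ)
        u+v≉0 u+v≈0 = i≢j (T₁.S-disjoint u∈ u≉0 u∈S
          (resp (S j) (≈ᴹ-sym (neg-unique u v u+v≈0)) (neg∈ (S j) v∈S)))

      i₁≢i₂ : ∃₂ λ (i₁ i₂ : Fin N) → i₁ ≢ i₂
      i₁≢i₂ = fromℕ< (ℕₚ.<-trans (s≤s z≤n) 1<N) , fromℕ< 1<N , λ eq → ℕₚ.0≢1+n
        (≡.trans (≡.sym (Finₚ.toℕ-fromℕ< _)) (≡.trans (≡.cong toℕ eq) (Finₚ.toℕ-fromℕ< 1<N)))
        where
        1<N : 1 < N
        1<N = two-lines FinK.1<order (≡.sym count′)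

      -- Every vector is compared with `v₁` on the line `j₁`; those on `j₁` itself go through `v₂`
      -- on a second line.
      companion : ∀ a → ∃[ b ] Companion a b
      companion a = b , comp
        where
        j₁ = proj₁ i₁≢i₂
        j₂ = proj₁ (proj₂ i₁≢i₂)
        j₁≢j₂ = proj₂ (proj₂ i₁≢i₂)
        v₁ = T₁.line-vector j₁
        v₂ = T₁.line-vector j₂
        v₁∈ = proj₁ (proj₂ v₁)
        v₁≉0 = proj₁ (proj₂ (proj₂ v₁))
        v₁∈S = proj₁ (proj₂ (proj₂ (proj₂ v₁)))
        v₂∈ = proj₁ (proj₂ v₂)
        v₂≉0 = proj₁ (proj₂ (proj₂ v₂))
        v₂∈S = proj₁ (proj₂ (proj₂ (proj₂ v₂)))
        local₁ = localCompanion a v₁∈ v₁≉0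
        local₂ = localCompanion a v₂∈ v₂≉0
        b = proj₁ local₁
        c = proj₁ local₂
        c≈b : c ≈ b
        c≈b = localCompanion-agree v₂∈ v₂≉0 v₂∈S v₁∈ v₁≉0 v₁∈S (j₁≢j₂ ∘ ≡.sym) (proj₂ local₂) (proj₂ local₁)
        agrees : ∀ {u i d} → u ∈ 𝔽q.El U₀ → ¬ (u ≈ᴹ 0ᴹ) → u ∈ El (S i) → LocalCompanion a u d → Dec (i ≡ j₁) → d ≈ b
        agrees u∈ u≉0 u∈S local (no i≢j₁)     = localCompanion-agree u∈ u≉0 u∈S v₁∈ v₁≉0 v₁∈S i≢j₁ local (proj₂ local₁)
        agrees u∈ u≉0 u∈S local (yes ≡.refl) =
          F.trans (localCompanion-agree u∈ u≉0 u∈S v₂∈ v₂≉0 v₂∈S j₁≢j₂ local (proj₂ local₂)) c≈b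
        comp : Companion a b
        comp {u} {u′} u∈ u′∈ u′∼au = by-cases (u ≟ᴹ 0ᴹ)
          where
          by-cases : Dec (u ≈ᴹ 0ᴹ) → u′ ∼₁ b *ₗ u
          by-cases (yes u≈0) = ≈⇒∼ A₁ (≈ᴹ-trans
            (T₂.∼0⇒≈0 u′∈ (V/.≈ᴹ-trans A₂ u′∼au (≈⇒∼ A₂ (≈ᴹ-trans (*ₗ-congˡ u≈0) (*ₗ-zeroʳ a)))))
            (≈ᴹ-sym (≈ᴹ-trans (*ₗ-congˡ u≈0) (*ₗ-zeroʳ b))))
          by-cases (no u≉0) =
            let (i , u∈S) = U₀-covered u∈ u≉0
                (d , local@(u″ , u″∈ , u″∼au , u″∼du)) = localCompanion a u∈ u≉0
                u′≈u″ = T₂.U₀-unique u′∈ u″∈ (V/.≈ᴹ-trans A₂ u′∼au (V/.≈ᴹ-sym A₂ u″∼au))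
            in V/.≈ᴹ-trans A₁ (≈⇒∼ A₁ u′≈u″) (V/.≈ᴹ-trans A₁ u″∼du
                 (V/.*ₗ-congʳ A₁ (agrees u∈ u≉0 u∈S local (i Finₚ.≟ j₁))))

      companion-unique : ∀ {a b c} → Companion a b → Companion a c → b ≈ c
      companion-unique {a} comp-b comp-c =
        let (u , u∈ , u≉0 , _) = T₁.line-vector (proj₁ i₁≢i₂)
            (u′ , u′∈ , au∼u′) = T₂.represent (a *ₗ u)
        in L/.*ₗ-injectiveʳ A₁ (u≉0 ∘ T₁.∼0⇒≈0 u∈) (V/.≈ᴹ-trans A₁ (V/.≈ᴹ-sym A₁ (comp-b u∈ u′∈ (V/.≈ᴹ-sym A₂ au∼u′)))
             (comp-c u∈ u′∈ (V/.≈ᴹ-sym A₂ au∼u′)))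

      Companion? : ∀ a b → Dec (Companion a b)
      Companion? a b = let (c , comp) = companion a in
        map′ (λ b≈c → Companion-resp F.refl (F.sym b≈c) comp) (λ comp′ → companion-unique comp′ comp) (b FinF.≟ c)

      -- If both actions agreed, then every vector would be congruent to the same element of U₀ modulo A₁ and A₂,
      -- which forces A₁ = A₂ and T₁ = T₂.

      nontrivial-companion : ∃[ a ] ¬ Companion a a
      nontrivial-companion = by-cases (FinF.search (λ a≈a′ → Companion-resp a≈a′ a≈a′) (λ a → Companion? a a))
        where
        module _ (trivial : ∀ a → Companion a a) where
          -- Vectors with the same representative in `U₀` modulo A₁ and modulo A₂. Closure under `F`
          -- is exactly the agreement of the two actions, and the basis `e` lies here, so this is
          -- all of V.
          common : Subspace
          common = record
            { El     = λ v → ∃[ u ] u ∈ 𝔽q.El U₀ × v ∼₁ u × v ∼₂ u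
            ; ≈-resp = λ { eq (u , u∈ , v∼₁u , v∼₂u) → u , u∈ , V/.≈ᴹ-trans A₁ (≈⇒∼ A₁ (≈ᴹ-sym eq)) v∼₁u ,
                                                                V/.≈ᴹ-trans A₂ (≈⇒∼ A₂ (≈ᴹ-sym eq)) v∼₂u }
            ; 0∈     = 0ᴹ , U₀.0∈ , V/.≈ᴹ-refl A₁ , V/.≈ᴹ-refl A₂
            ; +∈     = λ { (u , u∈ , v∼₁u , v∼₂u) (u′ , u′∈ , v′∼₁u′ , v′∼₂u′) →
                           u +ᴹ u′ , U₀.+∈ u∈ u′∈ , V/.+ᴹ-cong A₁ v∼₁u v′∼₁u′ , V/.+ᴹ-cong A₂ v∼₂u v′∼₂u′ }
            ; *∈     = λ { a (u , u∈ , v∼₁u , v∼₂u) →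
                           let (u′ , u′∈ , au∼u′) = T₂.represent (a *ₗ u) in
                           u′ , u′∈ ,
                           V/.≈ᴹ-trans A₁ (V/.*ₗ-congˡ A₁ v∼₁u) (V/.≈ᴹ-sym A₁ (trivial a u∈ u′∈ (V/.≈ᴹ-sym A₂ au∼u′))) ,
                           V/.≈ᴹ-trans A₂ (V/.*ₗ-congˡ A₂ v∼₂u) au∼u′ }
            }

          representative : ∀ v → v ∈ El common
          representative v = span-least common
            (λ { (i , eq) → e i , e∈U₀ i , ≈⇒∼ A₁ eq , ≈⇒∼ A₂ eq }) (e-spans v)

          T₁⊑T₂ : T₁ ⊑ T₂
          T₁⊑T₂ {τ} τ∈ =
            let (u , u∈ , τ∼₁u , τ∼₂u) = representative τ
                u≈0 = T₁.∼0⇒≈0 u∈ (V/.≈ᴹ-trans A₁ (V/.≈ᴹ-sym A₁ τ∼₁u) (∈⇒∼0 A₁ (T₁.T⊑A τ∈)))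
            in T₂.A∩Λ⊑T (∼0⇒∈ A₂ (V/.≈ᴹ-trans A₂ τ∼₂u (≈⇒∼ A₂ u≈0))) (T₁.T⊑Λ τ∈)

          T₂⊑T₁ : T₂ ⊑ T₁
          T₂⊑T₁ {τ} τ∈ =
            let (u , u∈ , τ∼₁u , τ∼₂u) = representative τ
                u≈0 = T₂.∼0⇒≈0 u∈ (V/.≈ᴹ-trans A₂ (V/.≈ᴹ-sym A₂ τ∼₂u) (∈⇒∼0 A₂ (T₂.T⊑A τ∈)))
            in T₁.A∩Λ⊑T (∼0⇒∈ A₁ (V/.≈ᴹ-trans A₁ τ∼₁u (≈⇒∼ A₁ u≈0))) (T₂.T⊑Λ τ∈)

        by-cases : (∀ a → Companion a a) ⊎ (∃[ a ] ¬ Companion a a) → ∃[ a ] ¬ Companion a a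
        by-cases (inj₁ trivial) = ⊥-elim (T₁≉T₂ (T₁⊑T₂ trivial , T₂⊑T₁ trivial))
        by-cases (inj₂ found)   = found

      -- For `a` with companion `b` ≠ `a` and `u` in `U₀`, some u′ is congruent to a u modulo A₂ and
      -- to b u modulo A₁. Hence (a - b) u, and so `u`, lies in the join; `U₀` spans V.
      A₁⊔A₂ : ∀ v → v ∈ El (A₁ ⊔ A₂)
      A₁⊔A₂ v = span-least J (λ { (i , eq) → resp J (≈ᴹ-sym eq) (U₀⊑J (e∈U₀ i)) }) (e-spans v)
        where
        J : Subspace
        J = A₁ ⊔ A₂
        a b : F.Carrier
        a = proj₁ nontrivial-companion
        b = proj₁ (companion a)
        a≉b : ¬ (a - b ≈ 0#)
        a≉b eq = proj₂ nontrivial-companion (Companion-resp F.refl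
          (F.sym (GroupProperties.x∙y⁻¹≈ε⇒x≈y F.+-group a b eq)) (proj₂ (companion a)))
        U₀⊑J : ∀ {u} → u ∈ 𝔽q.El U₀ → u ∈ El J
        U₀⊑J {u} u∈ =
          let (u′ , u′∈ , au∼u′) = T₂.represent (a *ₗ u)
              au∼bu = V/.≈ᴹ-trans J (∼-mono A₂ J (⊔-introʳ A₁ A₂) au∼u′)
                (∼-mono A₁ J (⊔-introˡ A₁ A₂) (proj₂ (companion a) u∈ u′∈ (V/.≈ᴹ-sym A₂ au∼u′)))
          in ∼0⇒∈ J (L/.*ₗ-cancel-0 J a≉b (V/.≈ᴹ-trans J (L/.*ₗ-sub J a b u) (L/.x≈y⇒x-y≈0 J au∼bu)))

      -- A₁ and T₂ already span V, because Γ lies in A₁, and their sizes multiply to that of V. So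
      -- sums are unique, and v + 0 = 0 + v forces v = 0.
      A₁∩T₂ : ∀ {v} → v ∈ El A₁ → v ∈ El T₂ → v ≈ᴹ 0ᴹ
      A₁∩T₂ {v} v∈A₁ v∈T₂ =
        let (i≡ , _) = covers⇒injective₂ (enumeration-resize size (basis-enumeration {whole} whole-dim))
                         (λ i j → A′.elt i +ᴹ T′.elt j) (λ _ _ → tt) (λ {v} _ → covers v)
                         {A′.index v∈A₁} {T′.index (zero∈ T₂)} {A′.index (zero∈ A₁)} {T′.index v∈T₂}
                         (≈ᴹ-trans (+ᴹ-cong (A′.elt-index v∈A₁) (T′.elt-index (zero∈ T₂))) (≈ᴹ-trans (+ᴹ-comm v 0ᴹ)
                           (≈ᴹ-sym (+ᴹ-cong (A′.elt-index (zero∈ A₁)) (T′.elt-index v∈T₂)))))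
        in ≈ᴹ-trans (≈ᴹ-sym (A′.elt-index v∈A₁)) (≈ᴹ-trans (≈ᴹ-reflexive (≡.cong A′.elt i≡)) (A′.elt-index (zero∈ A₁)))
        where
        module A′ = Enumeration T₁.A-enumeration
        module T′ = Enumeration (basis-enumeration {T₂} T₂.T-dim)
        size : Q ℕ.^ (t ℕ.* n) ≡ Q ℕ.^ (n ℕ.* (t ℕ.∸ 2)) ℕ.* Q ℕ.^ n ℕ.* Q ℕ.^ n
        size = ≡.trans (≡.sym (complement-count q n 2≤t))
          (≡.cong (Q ℕ.^ (n ℕ.* (t ℕ.∸ 2)) ℕ.* Q ℕ.^ n ℕ.*_) (≡.sym (ℕₚ.^-*-assoc q t n)))
        covers : ∀ v → ∃₂ λ i j → A′.elt i +ᴹ T′.elt j ≈ᴹ v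
        covers v =
          let (α , α′ , α∈ , α′∈ , v≈α+α′) = ⊔-elim {A₁} {A₂} (A₁⊔A₂ v)
              (γ , τ , γ∈ , τ∈ , α′≈γ+τ) = ⊔-elim {Γ} {T₂} α′∈
              α+γ∈ = add∈ A₁ α∈ (T₁.Γ⊑A γ∈)
          in A′.index α+γ∈ , T′.index τ∈ , ≈ᴹ-trans (+ᴹ-cong (A′.elt-index α+γ∈) (T′.elt-index τ∈))
               (≈ᴹ-trans (+ᴹ-assoc α γ τ) (≈ᴹ-trans (+ᴹ-congˡ (≈ᴹ-sym α′≈γ+τ)) (≈ᴹ-sym v≈α+α′)))

      A₂∩T₁ : ∀ {v} → v ∈ El A₂ → v ∈ El T₁ → v ≈ᴹ 0ᴹ
      A₂∩T₁ v∈A₂ v∈T₁ = A₁∩T₂ (T₁.T⊑A v∈T₁) (T₂.A∩Λ⊑T v∈A₂ (T₁.T⊑Λ v∈T₁))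

      A₁∩A₂⊑Γ : ∀ {v} → v ∈ El A₁ → v ∈ El A₂ → v ∈ El Γ
      A₁∩A₂⊑Γ v∈A₁ v∈A₂ =
        let (γ , τ , γ∈ , τ∈ , v≈γ+τ) = ⊔-elim {Γ} {T₁} v∈A₁
            v∼τ = V/.≈ᴹ-trans A₂ (≈⇒∼ A₂ v≈γ+τ) (V/.≈ᴹ-trans A₂ (V/.+ᴹ-congʳ A₂ (∈⇒∼0 A₂ (T₂.Γ⊑A γ∈))) (V/.+ᴹ-identityˡ A₂ τ))
            τ≈0 = A₂∩T₁ (∼⇒∈ A₂ (V/.≈ᴹ-sym A₂ v∼τ) v∈A₂) τ∈
        in resp Γ (≈ᴹ-sym (≈ᴹ-trans v≈γ+τ (≈ᴹ-trans (+ᴹ-congˡ τ≈0) (+ᴹ-identityʳ γ)))) γ∈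

      T₁-representative : ∀ v → ∃[ τ ] τ ∈ El T₁ × v ∼₂ τ
      T₁-representative v =
        let (α , α′ , α∈ , α′∈ , v≈α+α′) = ⊔-elim {A₁} {A₂} (A₁⊔A₂ v)
            (γ , τ , γ∈ , τ∈ , α≈γ+τ) = ⊔-elim {Γ} {T₁} α∈
        in τ , τ∈ , V/.≈ᴹ-trans A₂ (≈⇒∼ A₂ v≈α+α′) (V/.≈ᴹ-trans A₂ (V/.+ᴹ-cong A₂
             (V/.≈ᴹ-trans A₂ (≈⇒∼ A₂ α≈γ+τ) (V/.≈ᴹ-trans A₂ (V/.+ᴹ-congʳ A₂ (∈⇒∼0 A₂ (T₂.Γ⊑A γ∈))) (V/.+ᴹ-identityˡ A₂ τ)))
             (∈⇒∼0 A₂ α′∈)) (V/.+ᴹ-identityʳ A₂ τ))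

      -- The difference of u′ and a u lies in both A₁ and A₂, whose intersection is in Γ.
      companion-mod-Γ : ∀ {a u u′} → Companion a a → u ∈ 𝔽q.El U₀ → u′ ∈ 𝔽q.El U₀ →
                        u′ ∼₂ a *ₗ u → u′ ∼ a *ₗ u [ Γ ]
      companion-mod-Γ {a} {u} {u′} comp u∈ u′∈ (α , α∈ , u′≈au+α) = α , A₁∩A₂⊑Γ
          (∼0⇒∈ A₁ (V/.≈ᴹ-trans A₁ (≈⇒∼ A₁ α≈) (L/.x≈y⇒x-y≈0 A₁ (comp u∈ u′∈ (α , α∈ , u′≈au+α))))) α∈ , u′≈au+α
        where
        α≈ : α ≈ᴹ u′ +ᴹ -ᴹ (a *ₗ u)
        α≈ = ≈ᴹ-trans (≈ᴹ-sym (+ᴹ-identityʳ α)) (≈ᴹ-trans (+ᴹ-congˡ (≈ᴹ-sym (-ᴹ‿inverseʳ (a *ₗ u))))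
          (≈ᴹ-trans (≈ᴹ-sym (+ᴹ-assoc α (a *ₗ u) (-ᴹ (a *ₗ u)))) (+ᴹ-congʳ (≈ᴹ-trans (+ᴹ-comm α (a *ₗ u)) (≈ᴹ-sym u′≈au+α)))))

      instance
        t-nonZero : ℕ.NonZero t
        t-nonZero = ℕ.>-nonZero 0<t

      -- The conjugates of a vector modulo A₂

      core-injective₂ : ∀ {v w} → (∀ k → k < t → φ^ k v ∼₂ φ^ k w) → v ≈ᴹ w
      core-injective₂ v∼w = trivial-core-injective A₂ T₂.U₀∩A (λ j → v∼w (toℕ j) (Finₚ.toℕ<n j))

      T₁-enumeration : Enumeration (El T₁) (Q ℕ.^ n)
      T₁-enumeration = basis-enumeration {T₁} T₁.T-dim

      open Residues {T₁} {A₂} T₁-enumeration T₁-representative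

      conjugate-residues : Carrierᴹ → Fin t → Fin (Q ℕ.^ n)
      conjugate-residues v j = residue (φ^ (toℕ j) v)

      conjugate-residues-injective : ∀ {v w} → (∀ j → conjugate-residues v j ≡ conjugate-residues w j) → v ≈ᴹ w
      conjugate-residues-injective eq = trivial-core-injective A₂ T₂.U₀∩A (λ j → residue-injective (eq j))

      -- An injection of the Q^(t n) vectors of V into the (Q^n)^t families of residues is onto.
      -- Thus the conjugates of a vector can be prescribed independently modulo A₂.
      conjugate-residues-surjective : ∀ f → ∃[ v ] (∀ j → conjugate-residues v j ≡ f j)
      conjugate-residues-surjective f =
        let (i , eq) = Functions.injective⇒covers (Functions.enumeration-resize size (functions t (Q ℕ.^ n)))
                         (λ i → conjugate-residues (V′.elt i)) (λ _ → tt)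
                         (λ eq → V′.elt-injective (conjugate-residues-injective eq)) {f} tt
        in V′.elt i , eq
        where
        module Functions = Counting (Fin t ≡.→-setoid Fin (Q ℕ.^ n))
        module V′ = Enumeration (basis-enumeration {whole} whole-dim)
        size : (Q ℕ.^ n) ℕ.^ t ≡ Q ℕ.^ (t ℕ.* n)
        size = ≡.trans (ℕₚ.^-*-assoc Q n t) (≡.cong (Q ℕ.^_) (ℕₚ.*-comm n t))

      conjugate-lift : (y : ℕ → Carrierᴹ) → (∀ j → y j ∈ El T₁) →
                       ∃[ v ] (∀ j → j < t → φ^ j v ∼₂ y j)
      conjugate-lift y y∈ =
        let (v , eq) = conjugate-residues-surjective (λ j → T′.index (y∈ (toℕ j)))
        in v , λ j j<t → ≡.subst (λ k → φ^ k v ∼₂ y k) (Finₚ.toℕ-fromℕ< j<t)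
             (residue-index (y∈ (toℕ (fromℕ< j<t))) (eq (fromℕ< j<t)))
        where module T′ = Enumeration T₁-enumeration

      -- V is the direct sum of the conjugates of the director space Θ, and A₂ that of the proper ones.

      Θ : Subspace
      Θ = record
        { El     = λ v → ∀ j → 0 < j → j < t → φ^ j v ∈ El A₂
        ; ≈-resp = λ eq v∈ j 0<j j<t → resp A₂ (φ^-cong j eq) (v∈ j 0<j j<t)
        ; 0∈     = λ j _ _ → resp A₂ (≈ᴹ-sym (φ^-0 j)) (zero∈ A₂)
        ; +∈     = λ v∈ w∈ j 0<j j<t → resp A₂ (≈ᴹ-sym (φ^-+ j _ _)) (add∈ A₂ (v∈ j 0<j j<t) (w∈ j 0<j j<t))
        ; *∈     = λ a v∈ j 0<j j<t → resp A₂ (≈ᴹ-sym (φ^-* j a _)) (scale∈ A₂ (σ^ j a) (v∈ j 0<j j<t))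
        }

      Θ-unique : ∀ {v w} → v ∈ El Θ → w ∈ El Θ → v ∼₂ w → v ≈ᴹ w
      Θ-unique {v} {w} v∈ w∈ v∼w = core-injective₂ conjugates
        where
        conjugates : ∀ k → k < t → φ^ k v ∼₂ φ^ k w
        conjugates zero    _   = v∼w
        conjugates (suc k) k<t = V/.≈ᴹ-trans A₂ (∈⇒∼0 A₂ (v∈ (suc k) (s≤s z≤n) k<t))
                                   (V/.≈ᴹ-sym A₂ (∈⇒∼0 A₂ (w∈ (suc k) (s≤s z≤n) k<t)))

      Θ∩A₂ : ∀ {v} → v ∈ El Θ → v ∈ El A₂ → v ≈ᴹ 0ᴹ
      Θ∩A₂ v∈Θ v∈A₂ = Θ-unique v∈Θ (zero∈ Θ) (∈⇒∼0 A₂ v∈A₂)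

      Θ-vanish₂ : ∀ {w} → w ∈ El Θ → ∀ k → k % t ≢ 0 → φ^ k w ∈ El A₂
      Θ-vanish₂ {w} w∈ k k%t≢0 = resp A₂ (≈ᴹ-sym (φ^-% k w)) (w∈ (k % t) (ℕₚ.n≢0⇒n>0 k%t≢0) (m%n<n k t))

      -- Prescribe the residue of `v` for the exponent 0 and 0 for all others. With `Θ-unique`, this
      -- identifies `Θ` with V / A₂.
      Θ-lift : ∀ v → ∃[ w ] w ∈ El Θ × w ∼₂ v
      Θ-lift v =
        let (τ , τ∈ , v∼τ) = T₁-representative v
            y = λ { zero → τ ; (suc _) → 0ᴹ }
            (w , w∼y) = conjugate-lift y (λ { zero → τ∈ ; (suc _) → zero∈ T₁ })
        in w , (λ { (suc j) _ j<t → ∼0⇒∈ A₂ (w∼y (suc j) j<t) }) , V/.≈ᴹ-trans A₂ (w∼y zero 0<t) (V/.≈ᴹ-sym A₂ v∼τ)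

      -- φ^(t - k) undoes φ^k and, modulo A₂, annihilates the other conjugates of `Θ`; the residue
      -- that is left is lifted back to `Θ`.
      component : Carrierᴹ → Fin t → Carrierᴹ
      component v k = proj₁ (Θ-lift (φ^ (t ℕ.∸ toℕ k) v))

      component∈ : ∀ v k → component v k ∈ El Θ
      component∈ v k = proj₁ (proj₂ (Θ-lift (φ^ (t ℕ.∸ toℕ k) v)))

      component∼ : ∀ v k → component v k ∼₂ φ^ (t ℕ.∸ toℕ k) v
      component∼ v k = proj₂ (proj₂ (Θ-lift (φ^ (t ℕ.∸ toℕ k) v)))

      decomposition : ∀ v → v ≈ᴹ sum {t} (λ k → φ^ (toℕ k) (component v k))
      decomposition v = core-injective₂ λ k k<t → V/.≈ᴹ-sym A₂ (conjugates k k<t)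
        where
        D = sum {t} (λ k → φ^ (toℕ k) (component v k))
        at : ∀ (i : Fin t) → φ^ (t ℕ.∸ toℕ i) D ∼₂ φ^ (t ℕ.∸ toℕ i) v
        at i = V/.≈ᴹ-trans A₂ (≈⇒∼ A₂ (φ^-sum (t ℕ.∸ toℕ i) {t} (λ k → φ^ (toℕ k) (component v k))))
          (V/.≈ᴹ-trans A₂ (L/.sum-pick A₂ {t} {λ k → φ^ (t ℕ.∸ toℕ i) (φ^ (toℕ k) (component v k))} i off-diagonal)
          (V/.≈ᴹ-trans A₂ (≈⇒∼ A₂ diagonal) (component∼ v i)))
          where
          off-diagonal : ∀ k → k ≢ i → φ^ (t ℕ.∸ toℕ i) (φ^ (toℕ k) (component v k)) ∼₂ 0ᴹ
          off-diagonal k k≢i = ∈⇒∼0 A₂ (resp A₂ (φ^-add (t ℕ.∸ toℕ i) (toℕ k) _)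
            (Θ-vanish₂ (component∈ v k) _ (difference-% (Finₚ.toℕ<n i) (Finₚ.toℕ<n k) (k≢i ∘ ≡.sym ∘ Finₚ.toℕ-injective))))
          diagonal : φ^ (t ℕ.∸ toℕ i) (φ^ (toℕ i) (component v i)) ≈ᴹ component v i
          diagonal = ≈ᴹ-trans (≈ᴹ-sym (φ^-add (t ℕ.∸ toℕ i) (toℕ i) _))
            (≈ᴹ-trans (≈ᴹ-reflexive (≡.cong (λ k → φ^ k (component v i)) (ℕₚ.m∸n+n≡m (ℕₚ.<⇒≤ (Finₚ.toℕ<n i))))) (φ^t _))
        at′ : ∀ i → i < t → φ^ (t ℕ.∸ i) D ∼₂ φ^ (t ℕ.∸ i) v
        at′ i i<t = ≡.subst (λ k → φ^ (t ℕ.∸ k) D ∼₂ φ^ (t ℕ.∸ k) v) (Finₚ.toℕ-fromℕ< i<t) (at (fromℕ< i<t))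
        -- For i < t the exponents t - i run from 1 to t; the exponent 0 is reached as t.
        conjugates : ∀ k → k < t → φ^ k D ∼₂ φ^ k v
        conjugates zero    _   = V/.≈ᴹ-trans A₂ (≈⇒∼ A₂ (≈ᴹ-sym (φ^t D))) (V/.≈ᴹ-trans A₂ (at′ 0 0<t) (≈⇒∼ A₂ (φ^t v)))
        conjugates (suc k) k<t = ≡.subst (λ l → φ^ l D ∼₂ φ^ l v) (ℕₚ.m∸[m∸n]≡n (ℕₚ.<⇒≤ k<t))
          (at′ (t ℕ.∸ suc k) (ℕₚ.∸-monoʳ-< (s≤s z≤n) (ℕₚ.<⇒≤ k<t)))

      -- All proper conjugates of `w` lie in A₂. So the trace turns a vector of `Θ` into its
      -- representative in `U₀` modulo A₂.
      trace∼ : ∀ {w} → w ∈ El Θ → trace w ∼₂ w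
      trace∼ {w} w∈ = V/.≈ᴹ-trans A₂ (L/.sum-pick A₂ {t} {λ j → φ^ (toℕ j) w} (fromℕ< 0<t) off-diagonal)
          (V/.≈ᴹ-reflexive A₂ (≡.cong (λ k → φ^ k w) (Finₚ.toℕ-fromℕ< 0<t)))
        where
        off-diagonal : ∀ j → j ≢ fromℕ< 0<t → φ^ (toℕ j) w ∼₂ 0ᴹ
        off-diagonal j j≢0 = ∈⇒∼0 A₂ (w∈ (toℕ j) (ℕₚ.n≢0⇒n>0 (λ j≡0 → j≢0 (Finₚ.toℕ-injective
          (≡.trans j≡0 (≡.sym (Finₚ.toℕ-fromℕ< 0<t)))))) (Finₚ.toℕ<n j))

      -- Companions form a power of σ: apply Dedekind's lemma in V / A₁ to trace (a c w) ∼ b trace (c w).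

      twist : ∀ {a b w} → Companion a b → w ∈ El Θ → ∀ j → ((χ j a - b) *ₗ φ^ (toℕ j) w) ∈ El A₁
      twist {a} {b} {w} comp w∈ j = ∼0⇒∈ A₁ (L/.dedekind A₁ χ (λ j → σ^-* (toℕ j)) (λ j → σ^-1 (toℕ j)) χ-distinct
          (λ j → (χ j a - b) *ₗ φ^ (toℕ j) w) vanish j)
        where
        y : Fin t → Carrierᴹ
        y j = φ^ (toℕ j) w
        open ∼-Reasoning A₁
        term : ∀ c j → χ j c *ₗ ((χ j a - b) *ₗ y j) ≈ᴹ χ j (a * c) *ₗ y j +ᴹ (- b) *ₗ (χ j c *ₗ y j)
        term c j = ≈ᴹ-trans (*ₗ-comm _ _ _) (≈ᴹ-trans (*ₗ-distribʳ _ _ _)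
          (+ᴹ-congʳ (≈ᴹ-trans (≈ᴹ-sym (*ₗ-assoc _ _ _)) (*ₗ-congʳ (F.sym (σ^-* (toℕ j) a c))))))
        vanish : ∀ c → sum (λ j → χ j c *ₗ ((χ j a - b) *ₗ y j)) ∼₁ 0ᴹ
        vanish c = begin
          sum (λ j → χ j c *ₗ ((χ j a - b) *ₗ y j))
            ≈⟨ ≈⇒∼ A₁ (sum-cong-≋ {t} (term c)) ⟩
          sum (λ j → χ j (a * c) *ₗ y j +ᴹ (- b) *ₗ (χ j c *ₗ y j))
            ≈⟨ ≈⇒∼ A₁ (∑-distrib-+ (λ j → χ j (a * c) *ₗ y j) (λ j → (- b) *ₗ (χ j c *ₗ y j))) ⟩
          sum (λ j → χ j (a * c) *ₗ y j) +ᴹ sum (λ j → (- b) *ₗ (χ j c *ₗ y j))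
            ≈⟨ ≈⇒∼ A₁ (+ᴹ-cong (≈ᴹ-sym (trace-* (a * c) w))
                 (≈ᴹ-trans (≈ᴹ-sym (*ₗ-sum (- b) (λ j → χ j c *ₗ y j))) (*ₗ-congˡ (≈ᴹ-sym (trace-* c w))))) ⟩
          trace ((a * c) *ₗ w) +ᴹ (- b) *ₗ trace (c *ₗ w)
            ≈⟨ V/.+ᴹ-cong A₁ (comp (trace∈U₀ (c *ₗ w)) (trace∈U₀ ((a * c) *ₗ w)) traces) (≈⇒∼ A₁ (-*ₗ b _)) ⟩
          b *ₗ trace (c *ₗ w) +ᴹ -ᴹ (b *ₗ trace (c *ₗ w))
            ≈⟨ V/.-ᴹ‿inverseʳ A₁ _ ⟩
          0ᴹ ∎
          where
          -- Modulo A₂ the trace is the identity on `Θ`, so multiplying `c *ₗ w` by `a` is the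
          -- second action of `a` on `trace (c *ₗ w)`; the companion then carries this over to A₁.
          traces : trace ((a * c) *ₗ w) ∼₂ a *ₗ trace (c *ₗ w)
          traces = V/.≈ᴹ-trans A₂ (trace∼ (scale∈ Θ (a * c) w∈)) (V/.≈ᴹ-trans A₂ (V/.*ₗ-assoc A₂ a c w)
            (V/.*ₗ-congˡ A₂ (V/.≈ᴹ-sym A₂ (trace∼ (scale∈ Θ c w∈)))))

      Θ-conjugate⊑A₁ : ∀ {j a w} → ¬ Companion a (χ j a) → w ∈ El Θ → φ^ (toℕ j) w ∈ El A₁
      Θ-conjugate⊑A₁ {j} {a} ¬comp w∈ = let (b , comp) = companion a in
        unscale∈ A₁ (λ eq → ¬comp (Companion-resp F.refl (F.sym (GroupProperties.x∙y⁻¹≈ε⇒x≈y F.+-group _ _ eq)) comp))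
          (twist comp w∈ j)

      -- If every power of σ failed at some scalar, all conjugates of `Θ` would lie in A₁, hence all
      -- of V, although `U₀` meets A₁ trivially.
      exponent : ∃[ m ] (∀ a → Companion a (χ m a))
      exponent = by-cases (Finₚ.any? (λ j → decide j (searched j)))
        where
        searched : ∀ j → (∀ a → Companion a (χ j a)) ⊎ (∃[ a ] ¬ Companion a (χ j a))
        searched j = FinF.search (λ a≈a′ → Companion-resp a≈a′ (σ^-cong (toℕ j) a≈a′)) (λ a → Companion? a (χ j a))
        decide : ∀ j → (∀ a → Companion a (χ j a)) ⊎ (∃[ a ] ¬ Companion a (χ j a)) → Dec (∀ a → Companion a (χ j a))
        decide j (inj₁ all)         = yes all
        decide j (inj₂ (a , ¬comp)) = no λ all → ¬comp (all a)
        counterexample : ∀ j → ¬ (∀ a → Companion a (χ j a)) →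
                         (∀ a → Companion a (χ j a)) ⊎ (∃[ a ] ¬ Companion a (χ j a)) → ∃[ a ] ¬ Companion a (χ j a)
        counterexample j ¬all (inj₁ all)   = ⊥-elim (¬all all)
        counterexample j ¬all (inj₂ found) = found
        by-cases : Dec (∃[ m ] (∀ a → Companion a (χ m a))) → ∃[ m ] (∀ a → Companion a (χ m a))
        by-cases (yes found) = found
        by-cases (no ∄) = ⊥-elim (e-nonzero i₀ (T₁.U₀∩A (e∈U₀ i₀) (resp A₁ (≈ᴹ-sym (decomposition (e i₀)))
          (sum∈ A₁ {t} λ j → Θ-conjugate⊑A₁ {j} (proj₂ (counterexample j (λ all → ∄ (j , all)) (searched j)))
                               (component∈ (e i₀) j)))))

      m : Fin t
      m = proj₁ exponent

      μ : ℕ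
      μ = toℕ m

      μ<t : μ < t
      μ<t = Finₚ.toℕ<n m

      m-companion : ∀ a → Companion a (σ^ μ a)
      m-companion = proj₂ exponent

      Θ-vanish₁ : ∀ {w} → w ∈ El Θ → ∀ k → k % t ≢ μ → φ^ k w ∈ El A₁
      Θ-vanish₁ {w} w∈ k k%t≢μ =
        let j = fromℕ< (m%n<n k t)
            toℕ-j = Finₚ.toℕ-fromℕ< (m%n<n k t)
            (a , χ≉) = χ-distinct {j} {m} (λ j≡m → k%t≢μ (≡.trans (≡.sym toℕ-j) (≡.cong toℕ j≡m)))
        in resp A₁ (≈ᴹ-trans (≈ᴹ-reflexive (≡.cong (λ l → φ^ l w) toℕ-j)) (≈ᴹ-sym (φ^-% k w)))
             (Θ-conjugate⊑A₁ {j} {a} (λ comp → χ≉ (companion-unique comp (m-companion a))) w∈)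

      -- The conjugates with the other exponents are in A₁ anyway, so all of them would be, against
      -- `trivial-core` unless `w` is 0.
      Θ-kernel₁ : ∀ {w} → w ∈ El Θ → φ^ μ w ∈ El A₁ → w ≈ᴹ 0ᴹ
      Θ-kernel₁ {w} w∈ φμw∈ = trivial-core A₁ T₁.U₀∩A λ j → by-cases j (toℕ j ℕₚ.≟ μ)
        where
        by-cases : ∀ j → Dec (toℕ j ≡ μ) → φ^ (toℕ j) w ∈ El A₁
        by-cases j (yes eq) = ≡.subst (λ k → φ^ k w ∈ El A₁) (≡.sym eq) φμw∈
        by-cases j (no neq) = Θ-vanish₁ w∈ (toℕ j) (λ eq → neq (≡.trans (≡.sym (m<n⇒m%n≡m (Finₚ.toℕ<n j))) eq))

      -- The fixed field of σ^μ is K: multiplication by a fixed a ∉ K would map U₀ to itself modulo Γ, giving every point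
      -- of L[ U ] at least q preimages in U₀, while scatteredness allows only q ∸ 1.

      Γ-exact : ∀ {v w} → v ∈ El Λ → w ∈ El Λ → v ∼ w [ Γ ] → v ≈ᴹ w
      Γ-exact {v} {w} v∈ w∈ (γ , γ∈ , v≈w+γ) = ≈ᴹ-sym (proj₂ (sum-unique Γ∩Λ (resp Γ) {γ} {0ᴹ} {w} {v}
        (sub∈ Γ γ∈ (zero∈ Γ)) (sub∈ Λ v∈ w∈)
        (≈ᴹ-trans (+ᴹ-comm γ w) (≈ᴹ-trans (≈ᴹ-sym v≈w+γ) (≈ᴹ-sym (+ᴹ-identityˡ v))))))

      -- Both vectors lie in `U` and in one point, whose weight is 1.
      scattered-ratio : ∀ {w w′ d} → w ∈ 𝔽q.El U → ¬ (w ≈ᴹ 0ᴹ) → w′ ∈ 𝔽q.El U → w′ ≈ᴹ d *ₗ w →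
                        ∃[ c ] w′ ≈ᴹ ι c *ₗ w
      scattered-ratio {w} {w′} {d} w∈ w≉0 w′∈ w′≈dw =
        proj₂ (LK.generated-by {asK P 𝔽q.⊓ U} (scattered P (⟨⟩∈L {U} w∈ w≉0)) (gen ≈ᴹ-refl , w∈) w≉0)
          (⟨⟩-intro d w′≈dw , w′∈)
        where
        P : Subspace
        P = ⟨ w ≈ᴹ_ ⟩

      infix 4 _∼Γ_
      _∼Γ_ : Carrierᴹ → Carrierᴹ → Set ℓ
      v ∼Γ w = v ∼ w [ Γ ]

      -- The count is global: a pair of a nonzero vector `y` of `U` and one of q scalars yields a
      -- nonzero vector of `U₀` and a unit of `K`, from which the pair can be recovered. So M q
      -- pairs would inject into M (q - 1).
      module NonScattered {a : F.Carrier} (a-fixed : σ^ μ a ≈ a) (a∉K : ∀ c → ¬ (ι c ≈ a)) where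
        module X = Enumeration U₀⁰
        module Y = Enumeration U⁰
        module κ = Counting.Enumeration FinK.units

        M : ℕ
        M = q ℕ.^ (t ℕ.* n) ℕ.∸ 1

        preimage-of : ∀ y → ∃[ u ] u ∈ 𝔽q.El U₀ × ¬ (u ≈ᴹ 0ᴹ) × ∃[ b ] ¬ (b ≈ 0#) × Y.elt y ∼ b *ₗ u [ Γ ]
        preimage-of y = lift (proj₁ (Y.elt∈ y)) (proj₂ (Y.elt∈ y))

        u : Fin M → Carrierᴹ
        u y = proj₁ (preimage-of y)

        u∈ : ∀ y → u y ∈ 𝔽q.El U₀
        u∈ y = proj₁ (proj₂ (preimage-of y))

        u≁0 : ∀ y → ¬ (u y ∼Γ 0ᴹ)
        u≁0 y u∼0 = proj₁ (proj₂ (proj₂ (preimage-of y))) (Γ∩U₀ (∼0⇒∈ Γ u∼0) (u∈ y))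

        -- The q - 1 units of `K` together with the extra scalar `a`, all of which map `U₀` to
        -- itself modulo Γ.
        c : Fin (suc (q ℕ.∸ 1)) → F.Carrier
        c zero    = a
        c (suc k) = ι (κ.elt k)

        c-injective : ∀ i j → c i ≈ c j → i ≡ j
        c-injective zero    zero    _  = ≡.refl
        c-injective zero    (suc j) eq = ⊥-elim (a∉K _ (F.sym eq))
        c-injective (suc i) zero    eq = ⊥-elim (a∉K _ eq)
        c-injective (suc i) (suc j) eq = ≡.cong suc (κ.elt-injective (ι.injective eq))

        c≉0 : ∀ i → ¬ (c i ≈ 0#)
        c≉0 zero    eq = a∉K K.0# (F.trans ι.0#-homo (F.sym eq))
        c≉0 (suc k) eq = κ.elt∈ k (ι.injective (F.trans eq (F.sym ι.0#-homo)))

        scaled : ∀ y i → ∃[ z ] z ∈ 𝔽q.El U₀ × z ∼Γ c i *ₗ u y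
        scaled y zero    =
          let (z , z∈ , au∼z) = T₂.represent (a *ₗ u y) in
          z , z∈ , companion-mod-Γ (Companion-resp F.refl a-fixed (m-companion a)) (u∈ y) z∈ (V/.≈ᴹ-sym A₂ au∼z)
        scaled y (suc k) = ι (κ.elt k) *ₗ u y , U₀.*∈ (κ.elt k) (u∈ y) , V/.≈ᴹ-refl Γ

        z : Fin M → Fin (suc (q ℕ.∸ 1)) → Carrierᴹ
        z y i = proj₁ (scaled y i)

        z∼ : ∀ y i → z y i ∼Γ c i *ₗ u y
        z∼ y i = proj₂ (proj₂ (scaled y i))

        z∈ : ∀ y i → z y i ∈ 𝔽q.El U₀ × ¬ (z y i ≈ᴹ 0ᴹ)
        z∈ y i = proj₁ (proj₂ (scaled y i)) , λ z≈0 →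
          u≁0 y (L/.*ₗ-cancel-0 Γ (c≉0 i) (V/.≈ᴹ-trans Γ (V/.≈ᴹ-sym Γ (z∼ y i)) (≈⇒∼ Γ z≈0)))

        image-of : ∀ x → ∃[ w ] w ∈ 𝔽q.El U × ¬ (w ≈ᴹ 0ᴹ) × ∃[ b ] ¬ (b ≈ 0#) × w ∼ b *ₗ X.elt x [ Γ ]
        image-of x = project (proj₁ (X.elt∈ x)) (proj₂ (X.elt∈ x))

        w : Fin M → Carrierᴹ
        w x = proj₁ (image-of x)

        x′ : Fin M → Fin (suc (q ℕ.∸ 1)) → Fin M
        x′ y i = X.index (z∈ y i)

        -- Modulo Γ, `Y.elt y` and the projection of the scaled vector are both `F`-multiples of
        -- `u y`, hence proportional in Λ; scatteredness puts their ratio in `K`.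
        ratio : ∀ y i → ∃[ d ] Y.elt y ≈ᴹ ι d *ₗ w (x′ y i)
        ratio y i =
          let (w′ , w′∈ , w′≉0 , b , b≉0 , w∼bx) = image-of (x′ y i)
              (_ , _ , _ , b′ , _ , y∼b′u) = preimage-of y
              w∼ : w′ ∼Γ (b * c i) *ₗ u y
              w∼ = V/.≈ᴹ-trans Γ w∼bx (V/.≈ᴹ-trans Γ (V/.*ₗ-congˡ Γ (V/.≈ᴹ-trans Γ (≈⇒∼ Γ (X.elt-index (z∈ y i))) (z∼ y i)))
                     (V/.≈ᴹ-sym Γ (V/.*ₗ-assoc Γ b (c i) (u y))))
              w≁0 = λ w∼0 → w′≉0 (Γ∩Λ (∼0⇒∈ Γ w∼0) (U⊆Λ w′∈))
              (e′ , inv) = L/.*ₗ-inverse Γ (L/.*ₗ-nonzero Γ w≁0 w∼)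
              y∼ : Y.elt y ∼Γ (b′ * e′) *ₗ w′
              y∼ = V/.≈ᴹ-trans Γ y∼b′u (V/.≈ᴹ-trans Γ (V/.*ₗ-congˡ Γ (V/.≈ᴹ-trans Γ (inv (u y)) (V/.*ₗ-congˡ Γ (V/.≈ᴹ-sym Γ w∼))))
                     (V/.≈ᴹ-sym Γ (V/.*ₗ-assoc Γ b′ e′ w′)))
          in scattered-ratio w′∈ w′≉0 (proj₁ (Y.elt∈ y))
               (Γ-exact (U⊆Λ (proj₁ (Y.elt∈ y))) (scale∈ Λ (b′ * e′) (U⊆Λ w′∈)) y∼)

        ratio≉0 : ∀ y i → ¬ (proj₁ (ratio y i) K.≈ K.0#)
        ratio≉0 y i d≈0 = proj₂ (Y.elt∈ y) (≈ᴹ-trans (proj₂ (ratio y i))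
          (≈ᴹ-trans (*ₗ-congʳ (F.trans (ι.⟦⟧-cong d≈0) ι.0#-homo)) (*ₗ-zeroˡ _)))

        k′ : Fin M → Fin (suc (q ℕ.∸ 1)) → Fin (q ℕ.∸ 1)
        k′ y i = κ.index (ratio≉0 y i)

        determined-y : ∀ {y i y₂ i₂} → x′ y i ≡ x′ y₂ i₂ → k′ y i ≡ k′ y₂ i₂ → y ≡ y₂
        determined-y {y} {i} {y₂} {i₂} x≡ k≡ = Y.elt-injective (≈ᴹ-trans (proj₂ (ratio y i)) (≈ᴹ-trans
          (*ₗ-cong (ι.⟦⟧-cong (K.trans (K.sym (κ.elt-index (ratio≉0 y i))) (K.trans (K.reflexive (≡.cong κ.elt k≡))
            (κ.elt-index (ratio≉0 y₂ i₂))))) (≈ᴹ-reflexive (≡.cong w x≡))) (≈ᴹ-sym (proj₂ (ratio y₂ i₂)))))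

        determined-i : ∀ y {i i₂} → x′ y i ≡ x′ y i₂ → i ≡ i₂
        determined-i y {i} {i₂} x≡ = c-injective i i₂ (L/.*ₗ-injectiveʳ Γ (u≁0 y)
          (V/.≈ᴹ-trans Γ (V/.≈ᴹ-sym Γ (z∼ y i)) (V/.≈ᴹ-trans Γ (≈⇒∼ Γ (≈ᴹ-trans (≈ᴹ-sym (X.elt-index (z∈ y i)))
            (≈ᴹ-trans (≈ᴹ-reflexive (≡.cong X.elt x≡)) (X.elt-index (z∈ y i₂))))) (z∼ y i₂))))

        determined : ∀ {y i y₂ i₂} → x′ y i ≡ x′ y₂ i₂ → k′ y i ≡ k′ y₂ i₂ → y ≡ y₂ × i ≡ i₂
        determined {y} {i} {y₂} {i₂} x≡ k≡ = y≡ , determined-i y (≡.trans x≡ (≡.cong (λ y → x′ y i₂) (≡.sym y≡)))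
          where
          y≡ : y ≡ y₂
          y≡ = determined-y {y} {i} {y₂} {i₂} x≡ k≡

        0<M : 0 < M
        0<M = ℕₚ.≤-<-trans z≤n (Finₚ.toℕ<n (X.index (e∈U₀ i₀ , e-nonzero i₀)))

      σ^μ-fixed⇒K : ∀ {a} → σ^ μ a ≈ a → ∃[ c ] ι c ≈ a
      σ^μ-fixed⇒K {a} a-fixed = by-cases (Finₚ.any? (λ i → ι (FinK.digit i) FinF.≟ a))
        where
        by-cases : Dec (∃[ i ] ι (FinK.digit i) ≈ a) → ∃[ c ] ι c ≈ a
        by-cases (yes (i , eq)) = FinK.digit i , eq
        by-cases (no ∄) = ⊥-elim (no-pair-injection {M} {q ℕ.∸ 1} 0<M x′ k′
          (λ {y} {i} {y₂} {i₂} → determined {y} {i} {y₂} {i₂}))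
          where
          open NonScattered a-fixed (λ c eq → ∄ (FinK.code c , F.trans (ι.⟦⟧-cong (FinK.digit-code c)) eq))

      -- Otherwise, for 0 ≢ w ∈ Θ and d = gcd μ t, the partial trace T = ∑ φ^(i d) w is fixed by σ^μ, hence by φ;
      -- but T ∼ w and φ T ∼ 0 modulo A₂.

      μ-coprime : GCD.gcd μ t ≡ 1
      μ-coprime = by-cases (GCD.gcd μ t ℕₚ.≟ 1) (GCD.gcd[m,n]∣m μ t) (GCD.gcd[m,n]∣n μ t)
        where
        by-cases : ∀ {d} → Dec (d ≡ 1) → d ∣ μ → d ∣ t → d ≡ 1
        by-cases (yes d≡1) _ _ = d≡1
        by-cases {d} (no d≢1) (divides r μ≡rd) (divides s′ t≡sd) = ⊥-elim (w≉0 (Θ∩A₂ w∈ w∈A₂))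
          where
          1<d : 1 < d
          1<d = ℕₚ.≤∧≢⇒< (ℕₚ.n≢0⇒n>0 (λ d≡0 → ℕₚ.<⇒≢ 0<t (≡.sym (≡.trans t≡sd
            (≡.trans (≡.cong (s′ ℕ.*_) d≡0) (ℕₚ.*-zeroʳ s′)))))) (d≢1 ∘ ≡.sym)
          0<s : 0 < s′
          0<s = ℕₚ.n≢0⇒n>0 (λ s≡0 → ℕₚ.<⇒≢ 0<t (≡.sym (≡.trans t≡sd (≡.cong (ℕ._* d) s≡0))))
          w : Carrierᴹ
          w = proj₁ (Θ-lift (e i₀))
          w∈ : w ∈ El Θ
          w∈ = proj₁ (proj₂ (Θ-lift (e i₀)))
          w≉0 : ¬ (w ≈ᴹ 0ᴹ)
          w≉0 w≈0 = e-nonzero i₀ (T₂.∼0⇒≈0 (e∈U₀ i₀)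
            (V/.≈ᴹ-trans A₂ (V/.≈ᴹ-sym A₂ (proj₂ (proj₂ (Θ-lift (e i₀))))) (≈⇒∼ A₂ w≈0)))
          T : Carrierᴹ
          T = sum {s′} (λ i → φ^ (toℕ i ℕ.* d) w)
          φ^d-T : φ^ d T ≈ᴹ T
          φ^d-T = ≈ᴹ-trans (φ^-sum d {s′} (λ i → φ^ (toℕ i ℕ.* d) w))
            (≈ᴹ-trans (sum-cong-≋ {s′} (λ i → ≈ᴹ-sym (φ^-add d (toℕ i ℕ.* d) w)))
              (cyclic-sum s′ (λ i → φ^ (i ℕ.* d) w) (≡.subst (λ l → φ^ l w ≈ᴹ w) t≡sd (φ^t w))))
          φ^rd-T : ∀ r → φ^ (r ℕ.* d) T ≈ᴹ T
          φ^rd-T zero    = ≈ᴹ-refl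
          φ^rd-T (suc r) = ≈ᴹ-trans (φ^-add d (r ℕ.* d) T) (≈ᴹ-trans (φ^-cong d (φ^rd-T r)) φ^d-T)
          -- As d divides μ, φ^μ fixes `T`, so σ^μ fixes its coordinates, which then lie in `K`.
          T∈U₀ : T ∈ 𝔽q.El U₀
          T∈U₀ =
            let (a , T≈) = span⇒lincomb (e-spans T)
                φ^μ-T = ≡.subst (λ l → φ^ l T ≈ᴹ T) (≡.sym μ≡rd) (φ^rd-T r)
            in U₀.≈-resp (≈ᴹ-sym T≈) (coordinates∈K⇒U₀ a (λ i → σ^μ-fixed⇒K
                 (φ^-coordinates μ a (≈ᴹ-trans (φ^-cong μ (≈ᴹ-sym T≈)) (≈ᴹ-trans φ^μ-T T≈)) i)))
          -- This is where d > 1 matters: the exponents i d + 1 of φ T stay strictly between 0 and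
          -- t, so membership in `Θ` puts every summand in A₂.
          below-t : ∀ (i : Fin s′) → suc (toℕ i ℕ.* d) < t
          below-t i = ℕₚ.<-≤-trans (ℕₚ.+-monoˡ-< (toℕ i ℕ.* d) 1<d)
            (ℕₚ.≤-trans (ℕₚ.*-monoˡ-≤ d (Finₚ.toℕ<n i)) (ℕₚ.≤-reflexive (≡.sym t≡sd)))
          φT∈A₂ : φ T ∈ El A₂
          φT∈A₂ = resp A₂ (≈ᴹ-sym (φ^-sum 1 {s′} (λ i → φ^ (toℕ i ℕ.* d) w)))
            (sum∈ A₂ {s′} (λ i → w∈ (suc (toℕ i ℕ.* d)) (s≤s z≤n) (below-t i)))
          T≈0 : T ≈ᴹ 0ᴹ
          T≈0 = T₂.U₀∩A T∈U₀ (resp A₂ (φ-fixes-U₀ T∈U₀) φT∈A₂)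
          off-diagonal : ∀ i → i ≢ fromℕ< 0<s → φ^ (toℕ i ℕ.* d) w ∼₂ 0ᴹ
          off-diagonal i i≢0 = ∈⇒∼0 A₂ (w∈ (toℕ i ℕ.* d)
            (ℕₚ.*-mono-< {0} {toℕ i} {0} {d} (ℕₚ.n≢0⇒n>0 (λ i≡0 → i≢0 (Finₚ.toℕ-injective
              (≡.trans i≡0 (≡.sym (Finₚ.toℕ-fromℕ< 0<s)))))) (ℕₚ.<-trans (s≤s z≤n) 1<d))
            (ℕₚ.<-trans (ℕₚ.n<1+n _) (below-t i)))
          T∼w : T ∼₂ w
          T∼w = V/.≈ᴹ-trans A₂ (L/.sum-pick A₂ {s′} {λ i → φ^ (toℕ i ℕ.* d) w} (fromℕ< 0<s) off-diagonal)
            (V/.≈ᴹ-reflexive A₂ (≡.cong (λ k → φ^ (k ℕ.* d) w) (Finₚ.toℕ-fromℕ< 0<s)))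
          w∈A₂ : w ∈ El A₂
          w∈A₂ = ∼0⇒∈ A₂ (V/.≈ᴹ-trans A₂ (V/.≈ᴹ-sym A₂ T∼w) (≈⇒∼ A₂ T≈0))

      -- The Desarguesian spread

      open Desarguesian n t Ψ U₀

      𝒟Γ : Pred (Pred Subspace ℓ) (Level.suc ℓ)
      𝒟Γ = 𝒟ᴸ Γ s (Fix Ψ)

      span-of : Subspace → Subspace
      span-of = conjugateSpan t (image Ψ)

      φ^∈span-of : ∀ X {v} → v ∈ El X → ∀ k → φ^ k v ∈ El (span-of X)
      φ^∈span-of X {v} v∈ k = gen (fromℕ< (m%n<n k t) , φ^⇒conjugate X (toℕ (fromℕ< (m%n<n k t))) v∈
        (≈ᴹ-trans (≈ᴹ-reflexive (≡.cong (λ l → φ^ l v) (Finₚ.toℕ-fromℕ< (m%n<n k t)))) (≈ᴹ-sym (φ^-% k v))))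

      -- `Θ` and T₁ are both complements of A₂, so lifting a basis of T₁ modulo A₂ gives one of `Θ`.
      Θ-dim : HasDim Θ n
      Θ-dim = θ , independent , spans , span-least Θ (λ { (k , eq) → resp Θ (≈ᴹ-sym eq) (θ∈ k) })
        where
        b : Fin n → Carrierᴹ
        b = proj₁ T₁.T-dim
        b∈ : ∀ k → b k ∈ El T₁
        b∈ k = proj₂ (proj₂ (proj₂ T₁.T-dim)) (gen (k , ≈ᴹ-refl))
        θ : Fin n → Carrierᴹ
        θ k = proj₁ (Θ-lift (b k))
        θ∈ : ∀ k → θ k ∈ El Θ
        θ∈ k = proj₁ (proj₂ (Θ-lift (b k)))
        lincomb∼ : ∀ a → lincomb a θ ∼₂ lincomb a b
        lincomb∼ a = L/.sum-cong-≋ A₂ {n} (λ k → V/.*ₗ-congˡ A₂ (proj₂ (proj₂ (Θ-lift (b k)))))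
        independent : LinearlyIndependent θ
        independent a eq = proj₁ (proj₂ T₁.T-dim) a
          (A₂∩T₁ (∼0⇒∈ A₂ (V/.≈ᴹ-trans A₂ (V/.≈ᴹ-sym A₂ (lincomb∼ a)) (≈⇒∼ A₂ eq))) (lincomb∈ T₁ a b∈))
        spans : ∀ {w} → w ∈ El Θ → w ∈ El (⟨⟩-family θ)
        spans {w} w∈ =
          let (τ , τ∈ , w∼τ) = T₁-representative w
              (a , τ≈) = span⇒lincomb (proj₁ (proj₂ (proj₂ T₁.T-dim)) τ∈)
          in ≈-resp (≈ᴹ-sym (Θ-unique w∈ (lincomb∈ Θ a θ∈)
               (V/.≈ᴹ-trans A₂ w∼τ (V/.≈ᴹ-trans A₂ (≈⇒∼ A₂ τ≈) (V/.≈ᴹ-sym A₂ (lincomb∼ a))))))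
               (lincomb⇒span a θ)

      Θ-spanning : Spanning Θ
      Θ-spanning = Θ-dim , λ {v} _ → ≈-resp (≈ᴹ-sym (decomposition v))
        (sum∈ (span-of Θ) {t} (λ k → φ^∈span-of Θ (component∈ v k) (toℕ k)))

      -- Points of Σ in a subspace

      section : Subspace → Pred Subspace ℓ
      section X = PG X ∩ Fix Ψ

      section⇒L : ∀ X {P} → P ∈ section X → P ∈ L[ asK X 𝔽q.⊓ U₀ ]
      section⇒L X {P} ((_ , P⊑X) , P∈Fix) =
        let (u , u∈ , u≉0 , P≋⟨u⟩) = Fix⊆L P P∈Fix in
        u , (P⊑X (proj₂ P≋⟨u⟩ (gen ≈ᴹ-refl)) , u∈) , u≉0 , P≋⟨u⟩

      L⇒section : ∀ X {P} → P ∈ L[ asK X 𝔽q.⊓ U₀ ] → P ∈ section X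
      L⇒section X {P} (u , (u∈X , u∈) , u≉0 , P≋⟨u⟩) =
        (generated⇒point {P} u≉0 (≋⇒generated {P} P≋⟨u⟩) , λ v∈ → ⟨⟩-⊑ X u∈X (proj₁ P≋⟨u⟩ v∈)) ,
        L⊆Fix P (u , u∈ , u≉0 , P≋⟨u⟩)

      section-mono : ∀ X Y → (∀ {u} → u ∈ 𝔽q.El U₀ → u ∈ El X → u ∈ El Y) → section X ⊆ section Y
      section-mono X Y X⊆Y {P} P∈ =
        let (u , (u∈X , u∈) , u≉0 , P≋⟨u⟩) = section⇒L X {P} P∈ in
        L⇒section Y {P} (u , (X⊆Y u∈ u∈X , u∈) , u≉0 , P≋⟨u⟩)

      -- A `K`-basis of `s i` ∩ `U` is moved to its representatives in `U₀` modulo A₁. They remain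
      -- independent because `K`-combinations of the original vectors stay in `U`, which meets A₁
      -- trivially.
      S-dim : ∀ i → 𝔽q.HasDim (asK (S i) 𝔽q.⊓ U₀) t
      S-dim i = v , independent , spans , LK.span-least (asK (S i) 𝔽q.⊓ U₀)
                  (λ { (l , eq) → resp (S i) (≈ᴹ-sym eq) (v∈S l) , U₀.≈-resp (≈ᴹ-sym eq) (v∈ l) })
        where
        g : Fin t → Carrierᴹ
        g = proj₁ (weight i)
        g∈ : ∀ l → g l ∈ 𝔽q.El (asK (s i) 𝔽q.⊓ U)
        g∈ l = proj₂ (proj₂ (proj₂ (weight i))) (𝔽q.gen (l , ≈ᴹ-refl))
        v : Fin t → Carrierᴹ
        v l = proj₁ (T₁.represent (g l))
        v∈ : ∀ l → v l ∈ 𝔽q.El U₀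
        v∈ l = proj₁ (proj₂ (T₁.represent (g l)))
        v∼g : ∀ l → v l ∼₁ g l
        v∼g l = V/.≈ᴹ-sym A₁ (proj₂ (proj₂ (T₁.represent (g l))))
        v∈S : ∀ l → v l ∈ El (S i)
        v∈S l =
          let (c , g∼cx) = T₁.line-multiple {i} (proj₁ (g∈ l))
              (y , y∈ , _ , y∈S , y∼x) = T₁.line-vector i
          in T₁.S-closed {i} {y} {v l} {c} y∈ y∈S (v∈ l)
               (V/.≈ᴹ-trans A₁ (v∼g l) (V/.≈ᴹ-trans A₁ g∼cx (V/.*ₗ-congˡ A₁ (V/.≈ᴹ-sym A₁ y∼x))))
        lincomb∼ : ∀ k → LK.lincomb k v ∼₁ LK.lincomb k g
        lincomb∼ k = L/.sum-cong-≋ A₁ {t} (λ l → V/.*ₗ-congˡ A₁ (v∼g l))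
        lincomb∈S : ∀ k → LK.lincomb k v ∈ El (S i)
        lincomb∈S k = LK.lincomb∈ (asK (S i)) k v∈S
        lincomb∈U₀ : ∀ k → LK.lincomb k v ∈ 𝔽q.El U₀
        lincomb∈U₀ k = LK.lincomb∈ U₀ k v∈
        independent : 𝔽q.LinearlyIndependent v
        independent k eq = proj₁ (proj₂ (weight i)) k (T₁.U∩A (LK.lincomb∈ U k (λ l → proj₂ (g∈ l)))
          (∼0⇒∈ A₁ (V/.≈ᴹ-trans A₁ (V/.≈ᴹ-sym A₁ (lincomb∼ k)) (≈⇒∼ A₁ eq))))
        -- Spanning is a count: the Q combinations of `v` have distinct coefficients with respect to
        -- `x i`, so these exhaust `F`.
        f : Fin Q → F.Carrier
        f y = proj₁ (T₁.multiple {i} (lincomb∈S (FinK.digits {t} y)))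
        f∼ : ∀ y → LK.lincomb (FinK.digits {t} y) v ∼₁ f y *ₗ x i
        f∼ y = proj₂ (T₁.multiple {i} (lincomb∈S (FinK.digits {t} y)))
        f-injective : ∀ {y y′} → f y ≈ f y′ → y ≡ y′
        f-injective {y} {y′} eq = FinK.digits-injective {t} {y} {y′} (LK.lincomb-unique independent
          (T₁.U₀-unique (lincomb∈U₀ _) (lincomb∈U₀ _)
            (V/.≈ᴹ-trans A₁ (f∼ y) (V/.≈ᴹ-trans A₁ (V/.*ₗ-congʳ A₁ eq) (V/.≈ᴹ-sym A₁ (f∼ y′))))))
        f-surjective : ∀ c → ∃[ y ] f y ≈ c
        f-surjective c = Counting.injective⇒covers F.setoid FinF.elements f (λ _ → tt)
          (λ {y} {y′} → f-injective {y} {y′}) {c} tt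
        spans : ∀ {z} → z ∈ 𝔽q.El (asK (S i) 𝔽q.⊓ U₀) → z ∈ 𝔽q.El (𝔽q.⟨⟩-family v)
        spans {z} (z∈S , z∈) = from-multiple (T₁.multiple {i} {z} z∈S)
          where
          from-index : ∀ {c} → z ∼₁ c *ₗ x i → ∃[ y ] f y ≈ c → z ∈ 𝔽q.El (𝔽q.⟨⟩-family v)
          from-index {c} z∼cx (y , fy≈c) = 𝔽q.Subspace.≈-resp (𝔽q.⟨⟩-family v) {LK.lincomb (FinK.digits {t} y) v} {z}
            (T₁.U₀-unique {LK.lincomb (FinK.digits {t} y) v} {z} (lincomb∈U₀ (FinK.digits {t} y)) z∈
              (V/.≈ᴹ-trans A₁ (f∼ y) (V/.≈ᴹ-trans A₁ (V/.*ₗ-congʳ A₁ fy≈c) (V/.≈ᴹ-sym A₁ z∼cx))))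
            (LK.lincomb⇒span (FinK.digits {t} y) v)
          from-multiple : ∃[ c ] z ∼₁ c *ₗ x i → z ∈ 𝔽q.El (𝔽q.⟨⟩-family v)
          from-multiple (c , z∼cx) = from-index z∼cx (f-surjective c)

      -- The fixed vectors of ⟨w, φ w, …⟩ are the traces of the multiples of w.

      fixed-in-span : ∀ {P w z} → P GeneratedBy w → w ∈ El Θ → z ∈ El (span-of P) → ∃[ c ] z ∼₂ c *ₗ w
      fixed-in-span {P} {w} {z} (_ , multiples) w∈ z∈ =
        span-least multiples-of-w (λ { (j , y∈) → let (v , v∈ , eq) = conjugate⇒φ^ P (toℕ j) y∈ in
          conjugate (toℕ j) (Finₚ.toℕ<n j) v∈ eq }) z∈
        where
        multiples-of-w : Subspace
        multiples-of-w = record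
          { El     = λ v → ∃[ c ] v ∼₂ c *ₗ w
          ; ≈-resp = λ { eq (c , v∼) → c , V/.≈ᴹ-trans A₂ (≈⇒∼ A₂ (≈ᴹ-sym eq)) v∼ }
          ; 0∈     = 0# , V/.≈ᴹ-sym A₂ (V/.*ₗ-zeroˡ A₂ w)
          ; +∈     = λ { (c , v∼) (c′ , v′∼) → c + c′ , V/.≈ᴹ-trans A₂ (V/.+ᴹ-cong A₂ v∼ v′∼) (V/.≈ᴹ-sym A₂ (V/.*ₗ-distribʳ A₂ w c c′)) }
          ; *∈     = λ { a (c , v∼) → a * c , V/.≈ᴹ-trans A₂ (V/.*ₗ-congˡ A₂ v∼) (V/.≈ᴹ-sym A₂ (V/.*ₗ-assoc A₂ a c w)) }
          }
        conjugate : ∀ j → j < t → ∀ {v y} → v ∈ El P → φ^ j v ≈ᴹ y → ∃[ c ] y ∼₂ c *ₗ w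
        conjugate zero    _   v∈ eq = let (c , v≈cw) = multiples v∈ in c , ≈⇒∼ A₂ (≈ᴹ-trans (≈ᴹ-sym eq) v≈cw)
        conjugate (suc j) j<t v∈ eq = let (c , v≈cw) = multiples v∈ in
          0# , V/.≈ᴹ-trans A₂ (∈⇒∼0 A₂ (resp A₂ eq (resp Θ (≈ᴹ-sym v≈cw) (scale∈ Θ c w∈) (suc j) (s≤s z≤n) j<t)))
                 (V/.≈ᴹ-sym A₂ (V/.*ₗ-zeroˡ A₂ w))

      trace-in-span : ∀ {P w z c} → w ∈ El P → w ∈ El Θ → z ∈ 𝔽q.El U₀ → z ∼₂ c *ₗ w → z ∈ El (span-of P)
      trace-in-span {P} {w} {z} {c} w∈P w∈ z∈ z∼cw = resp (span-of P) (≈ᴹ-sym z≈trace)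
        (sum∈ (span-of P) {t} (λ j → φ^∈span-of P (scale∈ P c w∈P) (toℕ j)))
        where
        z≈trace : z ≈ᴹ trace (c *ₗ w)
        z≈trace = T₂.U₀-unique z∈ (trace∈U₀ (c *ₗ w)) (V/.≈ᴹ-trans A₂ z∼cw (V/.≈ᴹ-sym A₂ (trace∼ (scale∈ Θ c w∈))))

      -- For z in `U₀`, lying in `S i` means being congruent to a multiple c u, that is to c w,
      -- modulo A₂. Then z is the trace of c w, since `U₀` contains only one vector of that class.
      section≐ : ∀ {i u w P} → u ∈ 𝔽q.El U₀ → ¬ (u ≈ᴹ 0ᴹ) → u ∈ El (S i) →
                 w ∈ El Θ → w ∼₂ u → P GeneratedBy w → section (S i) ≐ section (span-of P)
      section≐ {i} {u} {w} {P} u∈ u≉0 u∈S w∈ w∼u P-gen =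
        (λ {X} → section-mono (S i) (span-of P) (λ z∈ z∈S →
          let (c , z∼cu) = T₂.S-ratio {i} u∈ u≉0 u∈S z∈S in
          trace-in-span {P} (proj₁ P-gen) w∈ z∈ (V/.≈ᴹ-trans A₂ z∼cu (V/.*ₗ-congˡ A₂ (V/.≈ᴹ-sym A₂ w∼u)))) {X}) ,
        (λ {X} → section-mono (span-of P) (S i) (λ z∈ z∈span →
          let (c , z∼cw) = fixed-in-span {P} P-gen w∈ z∈span in
          T₂.S-closed {i} {a = c} u∈ u∈S z∈ (V/.≈ᴹ-trans A₂ z∼cw (V/.*ₗ-congˡ A₂ w∼u))) {X})

      -- A line gives the point of the vector of `Θ` that lifts a vector of `S i` ∩ `U₀`. Conversely
      -- a point of `Θ` gives the line whose `S i` contains the trace of a generator; that trace is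
      -- nonzero, as it is congruent to the generator modulo A₂.
      𝒟Γ≐𝒟Θ : 𝒟Γ ≐ 𝒟 Θ
      𝒟Γ≐𝒟Θ = (λ {X} → to-𝒟Θ X) , (λ {X} → from-𝒟Θ X)
        where
        to-𝒟Θ : ∀ X → X ∈ 𝒟Γ → X ∈ 𝒟 Θ
        to-𝒟Θ X (i , X≐) = from-vector (T₁.line-vector i)
          where
          from-lift : ∀ {u} → u ∈ 𝔽q.El U₀ → ¬ (u ≈ᴹ 0ᴹ) → u ∈ El (S i) →
                      ∃[ w ] w ∈ El Θ × w ∼₂ u → X ∈ 𝒟 Θ
          from-lift u∈ u≉0 u∈S (w , w∈ , w∼u) = ⟨ w ≈ᴹ_ ⟩ ,
            (⟨⟩-point (λ w≈0 → u≉0 (T₂.∼0⇒≈0 u∈ (V/.≈ᴹ-trans A₂ (V/.≈ᴹ-sym A₂ w∼u) (≈⇒∼ A₂ w≈0)))) , ⟨⟩-⊑ Θ w∈) ,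
            ≐-trans {i = X} {j = section (S i)} {k = section (span-of ⟨ w ≈ᴹ_ ⟩)} X≐
              (section≐ {i} {w = w} {P = ⟨ w ≈ᴹ_ ⟩} u∈ u≉0 u∈S w∈ w∼u (⟨⟩-generated {w}))
          from-vector : ∃[ u ] u ∈ 𝔽q.El U₀ × ¬ (u ≈ᴹ 0ᴹ) × u ∈ El (S i) × u ∼₁ x i → X ∈ 𝒟 Θ
          from-vector (u , u∈ , u≉0 , u∈S , _) = from-lift u∈ u≉0 u∈S (Θ-lift u)
        from-𝒟Θ : ∀ X → X ∈ 𝒟 Θ → X ∈ 𝒟Γ
        from-𝒟Θ X (P , (point , P⊑Θ) , X≐) = from-generator (point-generator {P} point)
          where
          from-line : ∀ {w} → w ∈ El Θ → P GeneratedBy w → ¬ (trace w ≈ᴹ 0ᴹ) →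
                      ∃[ i ] trace w ∈ El (S i) → X ∈ 𝒟Γ
          from-line {w} w∈ P-gen u≉0 (i , u∈S) = i , ≐-trans {i = X} {j = section (span-of P)} {k = section (S i)} X≐
            (≐-sym {x = section (S i)} {y = section (span-of P)}
              (section≐ {i} {trace w} {w} {P} (trace∈U₀ w) u≉0 u∈S w∈ (V/.≈ᴹ-sym A₂ (trace∼ w∈)) P-gen))
          from-generator : ∃[ w ] ¬ (w ≈ᴹ 0ᴹ) × P GeneratedBy w → X ∈ 𝒟Γ
          from-generator (w , w≉0 , P-gen) = from-line w∈ P-gen u≉0 (U₀-covered (trace∈U₀ w) u≉0)
            where
            w∈ : w ∈ El Θ
            w∈ = P⊑Θ (proj₁ P-gen)
            u≉0 : ¬ (trace w ≈ᴹ 0ᴹ)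
            u≉0 u≈0 = w≉0 (Θ∩A₂ w∈ (∼0⇒∈ A₂ (V/.≈ᴹ-trans A₂ (V/.≈ᴹ-sym A₂ (trace∼ w∈)) (≈⇒∼ A₂ u≈0))))

      spread : IsSpread U₀ t 𝒟Γ
      spread = subspaces , disjoint-or-equal , covering
        where
        subspaces : ∀ X → X ∈ 𝒟Γ → IsSubspaceOfΣ U₀ t X
        subspaces X (i , X≐) = asK (S i) 𝔽q.⊓ U₀ , proj₂ , S-dim i ,
          ≐-trans {i = X} {j = section (S i)} {k = L[ asK (S i) 𝔽q.⊓ U₀ ]} X≐
            ((λ {P} → section⇒L (S i) {P}) , (λ {P} → L⇒section (S i) {P}))
        disjoint-or-equal : ∀ X Y → X ∈ 𝒟Γ → Y ∈ 𝒟Γ → X ≬ Y → X ≐ Y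
        disjoint-or-equal X Y (i , X≐) (j , Y≐) (P , P∈X , P∈Y) =
          ≐-trans {i = X} {j = section (S i)} {k = Y} X≐
            (≡.subst (λ k → section (S k) ≐ Y) (≡.sym i≡j) (≐-sym {x = Y} {y = section (S j)} Y≐))
          where
          i≡j : i ≡ j
          i≡j =
            let P∈Sj = proj₁ Y≐ {P} P∈Y
                (u , (u∈Si , u∈) , u≉0 , P≋⟨u⟩) = section⇒L (S i) {P} (proj₁ X≐ {P} P∈X)
            in T₁.S-disjoint u∈ u≉0 u∈Si (proj₂ (proj₁ P∈Sj) (proj₂ P≋⟨u⟩ (gen ≈ᴹ-refl)))
        covering : ∀ P → P ∈ L[ U₀ ] → ∃[ X ] X ∈ 𝒟Γ × P ∈ X
        covering P (u , u∈ , u≉0 , P≋⟨u⟩) =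
          let (i , u∈S) = U₀-covered u∈ u≉0 in
          section (S i) , (i , (λ P∈ → P∈) , (λ P∈ → P∈)) , L⇒section (S i) {P} (u , (u∈S , u∈) , u≉0 , P≋⟨u⟩)

      -- Γ as a span of conjugates of a director space

      open MultiplesModulo {t} {μ} μ-coprime

      0%t : (0 ℕ.* μ) % t ≡ 0
      0%t = m<n⇒m%n≡m 0<t

      1μ%t : (1 ℕ.* μ) % t ≡ μ
      1μ%t = ≡.trans (≡.cong (_% t) (ℕₚ.*-identityˡ μ)) (m<n⇒m%n≡m μ<t)

      τ : Subspace → Subspace
      τ X = X ^[ Ψ ] (+ μ)

      τ-conjugate⇒φ^ : ∀ X i {w} → w ∈ El (fold X τ i) → ∃[ v ] v ∈ El X × φ^ (i ℕ.* μ) v ≈ᴹ w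
      τ-conjugate⇒φ^ X zero    w∈ = _ , w∈ , ≈ᴹ-refl
      τ-conjugate⇒φ^ X (suc i) w∈ =
        let (y , y∈ , φy≈w) = conjugate⇒φ^ (fold X τ i) μ w∈
            (v , v∈ , φv≈y) = τ-conjugate⇒φ^ X i y∈
        in v , v∈ , ≈ᴹ-trans (φ^-add μ (i ℕ.* μ) v) (≈ᴹ-trans (φ^-cong μ φv≈y) φy≈w)

      φ^⇒τ-conjugate : ∀ X i {v} → v ∈ El X → φ^ (i ℕ.* μ) v ∈ El (fold X τ i)
      φ^⇒τ-conjugate X zero    v∈ = v∈
      φ^⇒τ-conjugate X (suc i) {v} v∈ =
        φ^⇒conjugate (fold X τ i) μ (φ^⇒τ-conjugate X i v∈) (≈ᴹ-sym (φ^-add μ (i ℕ.* μ) v))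

      -- Γ is the sum of the φ^e Θ with e ≢ 0, μ, that is, with e ≡ 2μ, 3μ, …, (t ∸ 1)μ modulo t.
      Θ̄ : Subspace
      Θ̄ = Θ ^[ Ψ ] (+ ((2 ℕ.* μ) % t))

      φ^-2+ : ∀ i v → φ^ (i ℕ.* μ) (φ^ ((2 ℕ.* μ) % t) v) ≈ᴹ φ^ ((2 ℕ.+ i) ℕ.* μ) v
      φ^-2+ i v = ≈ᴹ-trans (φ^-cong (i ℕ.* μ) (≈ᴹ-sym (φ^-% (2 ℕ.* μ) v)))
        (≈ᴹ-trans (≈ᴹ-sym (φ^-add (i ℕ.* μ) (2 ℕ.* μ) v))
          (≈ᴹ-reflexive (≡.cong (λ l → φ^ l v) (≡.trans (≡.sym (ℕₚ.*-distribʳ-+ μ i 2)) (≡.cong (ℕ._* μ) (ℕₚ.+-comm i 2))))))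

      2+i<t : ∀ {i} → i < t ℕ.∸ 2 → 2 ℕ.+ i < t
      2+i<t {i} i<t-2 = ℕₚ.<-≤-trans (ℕₚ.+-monoʳ-< 2 i<t-2) (ℕₚ.≤-reflexive (ℕₚ.m+[n∸m]≡n 2≤t))

      -- The exponents are (2 + i) μ with 2 ≤ 2 + i < t. Coprimality keeps them apart from 0 and
      -- from μ modulo t, so these conjugates of `Θ` lie in both A₂ and A₁.
      Γ⊒ : conjugateSpan (t ℕ.∸ 2) τ Θ̄ ⊑ Γ
      Γ⊒ = span-least Γ (λ { (i , w∈) →
        let (y , y∈ , φy≈w) = τ-conjugate⇒φ^ Θ̄ (toℕ i) w∈
            (θ , θ∈ , φθ≈y) = conjugate⇒φ^ Θ ((2 ℕ.* μ) % t) y∈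
            w≈ = ≈ᴹ-trans (≈ᴹ-sym (φ^-2+ (toℕ i) θ)) (≈ᴹ-trans (φ^-cong (toℕ i ℕ.* μ) φθ≈y) φy≈w)
            2+i = 2+i<t (Finₚ.toℕ<n i)
        in resp Γ w≈ (A₁∩A₂⊑Γ
             (Θ-vanish₁ θ∈ ((2 ℕ.+ toℕ i) ℕ.* μ) λ eq →
               ℕₚ.1+n≢0 (ℕₚ.suc-injective (multiples-injective 2+i (ℕₚ.<-≤-trans (s≤s (s≤s z≤n)) 2≤t) (≡.trans eq (≡.sym 1μ%t)))))
             (Θ-vanish₂ θ∈ ((2 ℕ.+ toℕ i) ℕ.* μ) λ eq →
               ℕₚ.1+n≢0 (multiples-injective 2+i 0<t (≡.trans eq (≡.sym 0%t))))) })

      -- In the decomposition of a vector of Γ the component 0 vanishes since Γ is in A₂. The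
      -- component μ vanishes since Γ is in A₁, which contains all the other summands.
      Γ⊑ : Γ ⊑ conjugateSpan (t ℕ.∸ 2) τ Θ̄
      Γ⊑ {v} v∈ = resp J (≈ᴹ-sym (decomposition v)) (sum∈ J {t} (λ k → term k (toℕ k ℕₚ.≟ 0) (toℕ k ℕₚ.≟ μ)))
        where
        J : Subspace
        J = conjugateSpan (t ℕ.∸ 2) τ Θ̄
        vanishing : ∀ k → component v k ≈ᴹ 0ᴹ → φ^ (toℕ k) (component v k) ∈ El J
        vanishing k eq = resp J (≈ᴹ-sym (≈ᴹ-trans (φ^-cong (toℕ k) eq) (φ^-0 (toℕ k)))) (zero∈ J)
        zeroth : ∀ k → toℕ k ≡ 0 → component v k ≈ᴹ 0ᴹ
        zeroth k k≡0 = Θ∩A₂ (component∈ v k) (∼0⇒∈ A₂ (V/.≈ᴹ-trans A₂ (component∼ v k)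
          (≡.subst (λ l → φ^ (t ℕ.∸ l) v ∼₂ 0ᴹ) (≡.sym k≡0) (V/.≈ᴹ-trans A₂ (≈⇒∼ A₂ (φ^t v)) (∈⇒∼0 A₂ (T₂.Γ⊑A v∈))))))
        μth : ∀ k → toℕ k ≡ μ → component v k ≈ᴹ 0ᴹ
        μth k k≡μ = Θ-kernel₁ (component∈ v k) (≡.subst (λ l → φ^ l (component v k) ∈ El A₁) k≡μ (∼0⇒∈ A₁
          (V/.≈ᴹ-trans A₁ (V/.≈ᴹ-sym A₁ (L/.sum-pick A₁ {t} {λ j → φ^ (toℕ j) (component v j)} k off-diagonal))
            (V/.≈ᴹ-trans A₁ (≈⇒∼ A₁ (≈ᴹ-sym (decomposition v))) (∈⇒∼0 A₁ (T₁.Γ⊑A v∈))))))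
          where
          off-diagonal : ∀ j → j ≢ k → φ^ (toℕ j) (component v j) ∼₁ 0ᴹ
          off-diagonal j j≢k = ∈⇒∼0 A₁ (Θ-vanish₁ (component∈ v j) (toℕ j) λ eq →
            j≢k (Finₚ.toℕ-injective (≡.trans (≡.sym (m<n⇒m%n≡m (Finₚ.toℕ<n j))) (≡.trans eq (≡.sym k≡μ)))))
        -- Write k as i μ modulo t. The values 0 and 1 of i are the excluded exponents 0 and μ; any
        -- other is 2 + i′ with i′ < t - 2, which indexes the i′-th conjugate of `Θ̄` under `τ`.
        other : ∀ k → toℕ k ≢ 0 → toℕ k ≢ μ → ∃[ i ] i < t × (i ℕ.* μ) % t ≡ toℕ k → φ^ (toℕ k) (component v k) ∈ El J
        other k k≢0 k≢μ (zero , _ , eq)        = ⊥-elim (k≢0 (≡.trans (≡.sym eq) 0%t))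
        other k k≢0 k≢μ (suc zero , _ , eq)    = ⊥-elim (k≢μ (≡.trans (≡.sym eq) 1μ%t))
        other k k≢0 k≢μ (suc (suc i) , i<t , eq) = resp J
          (≈ᴹ-trans (φ^-2+ i (component v k)) (≈ᴹ-trans (φ^-% ((2 ℕ.+ i) ℕ.* μ) (component v k))
            (≈ᴹ-reflexive (≡.cong (λ l → φ^ l (component v k)) eq))))
          (gen (fromℕ< i<t-2 , ≡.subst (λ l → φ^ (i ℕ.* μ) y ∈ El (fold Θ̄ τ l)) (≡.sym (Finₚ.toℕ-fromℕ< i<t-2))
            (φ^⇒τ-conjugate Θ̄ i (φ^⇒conjugate Θ ((2 ℕ.* μ) % t) (component∈ v k) ≈ᴹ-refl))))
          where
          y : Carrierᴹ
          y = φ^ ((2 ℕ.* μ) % t) (component v k)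
          i<t-2 : i < t ℕ.∸ 2
          i<t-2 = ℕₚ.∸-monoˡ-< i<t (s≤s (s≤s z≤n))
        term : ∀ k → Dec (toℕ k ≡ 0) → Dec (toℕ k ≡ μ) → φ^ (toℕ k) (component v k) ∈ El J
        term k (yes k≡0) _         = vanishing k (zeroth k k≡0)
        term k (no _)    (yes k≡μ) = vanishing k (μth k k≡μ)
        term k (no k≢0)  (no k≢μ)  = other k k≢0 k≢μ (multiples-surjective (Finₚ.toℕ<n k))

      conclusion : IsDesarguesianSpread 𝒟Γ ×
                   (∃[ Θ̄ ] ∃[ m ] IsDirectorSpace 𝒟Γ Θ̄ × gcd m (+ t) ≡ + 1 ×
                     Γ ≋ conjugateSpan (t ℕ.∸ 2) (_^[ Ψ ] m) Θ̄)
      conclusion = (spread , Θ , Θ-spanning , 𝒟Γ≐𝒟Θ) ,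
        Θ̄ , + μ , (Θ , Θ-spanning , 𝒟Γ≐𝒟Θ , (2 ℕ.* μ) % t , m%n<n _ t , (λ w∈ → w∈) , (λ w∈ → w∈)) ,
        ≡.cong +_ μ-coprime , Γ⊑ , Γ⊒

open import Data.Nat.Base using (_*_; _∸_; _^_)

theorem3p11 :
  ∀ {ℓ} (K F : HeytingField ℓ ℓ ℓ)
    {ι : HeytingField.Carrier K → HeytingField.Carrier F} (ι-mono : IsSubfield K F ι)
    (V : Module (ring F) ℓ ℓ) (q n t : ℕ) →
  2 ≤ n → 3 ≤ t → HasOrder K q → HasOrder F (q ^ t) →
  let open Geometry K F ι-mono V in
  HasDim whole (t * n) →
  (Λ : Subspace) → HasDim Λ (2 * n) →
  (Ψ : Collineation) → HasCollineationOrder Ψ t →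
  (U₀ : 𝔽q.Subspace) → IsSubgeometry (t * n) U₀ (Fix Ψ) →
  (U : 𝔽q.Subspace) {N : ℕ} (s : Fin N → Subspace) → IsPseudoregulus q n t Λ U s →
  (Γ : Subspace) → HasDim Γ (n * (t ∸ 2)) → PG Γ ⊥ Fix Ψ → PG Γ ⊥ PG Λ →
  L[ U ] ≐ projection Γ Λ (Fix Ψ) →
  let open Desarguesian n t Ψ U₀
      D = 𝒟ᴸ Γ s (Fix Ψ)
  in
  IsDesarguesianSpread D ×
  (∃[ Θ̄ ] ∃[ m ] IsDirectorSpace D Θ̄ × gcd m (+ t) ≡ + 1 ×
    Γ ≋ conjugateSpan (t ∸ 2) (_^[ Ψ ] m) Θ̄)
theorem3p11 K F ι-mono V q n t 2≤n 3≤t K-order F-order _ Λ _ Ψ Ψ-order U₀ subgeometry U s pseudoregulus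
    Γ Γ-dim Γ⊥Fix Γ⊥Λ L≐p =
  Frame.Configuration.Pseudoregulus.conclusion K F ι-mono V {q} {t} K-order F-order {n} 2≤n 3≤t
    Λ Ψ Ψ-order U₀ subgeometry U s pseudoregulus Γ Γ-dim (λ {P} → Γ⊥Fix {P}) (λ {P} → Γ⊥Λ {P}) L≐p
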